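{- Let $\mathbb{F}_q$ be a finite field and let $f_1,\ldots,f_r\in\mathbb{F}_q[x_1,\ldots,x_n]$ be polynomials of total degrees $d_1,\ldots,d_r$, with $d=d_1+\cdots+d_r$. For a subset $S\subseteq\mathbb{A}^n(\mathbb{F}_q)=\mathbb{F}_q^n$ let $\mathcal{N}(S)=\#\{\mathbf{x}\in S: f_1(\mathbf{x})=\cdots=f_r(\mathbf{x})=0\}$. Then for any two parallel affine linear subspaces $L_1,L_2\subseteq\mathbb{A}^n(\mathbb{F}_q)$ of dimension at least $d$ we have \[\mathcal{N}(L_1)\equiv\mathcal{N}(L_2)\pmod{q}.\]
   Context: Affine linear subspaces $L_1,L_2$ of $\mathbb{F}_q^n$ are parallel if one is a translate of the other (they need not pass through the origin). -}

module Defs where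

open import Level using (Level; _⊔_)
open import Algebra.Bundles using (CommutativeRing)
open import Data.Nat as ℕ using (ℕ; zero; suc)
open import Data.Fin using (Fin; zero; suc)
open import Data.List using (List; []; _∷_; foldr; length)
open import Data.List.Relation.Unary.All using (All)
open import Data.List.Relation.Unary.Any using (Any)
open import Data.List.Relation.Unary.AllPairs using (AllPairs)
open import Data.Product using (Σ; ∃; _×_; _,_; proj₁; proj₂)
open import Relation.Nullary using (¬_)

sumℕ : ∀ {r} → (Fin r → ℕ) → ℕ
sumℕ {zero}  _ = 0
sumℕ {suc r} a = a zero ℕ.+ sumℕ (λ i → a (suc i))

module _ {c ℓ : Level} (R : CommutativeRing c ℓ) where
  open CommutativeRing R hiding (zero)

  IsField : Set (c ⊔ ℓ)
  IsField = (¬ (1# ≈ 0#)) × (∀ x → ¬ (x ≈ 0#) → ∃ λ y → (x * y) ≈ 1#)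

  record IsFinite : Set (c ⊔ ℓ) where
    field
      elems    : List Carrier
      complete : ∀ x → Any (x ≈_) elems
      distinct : AllPairs (λ a b → ¬ (a ≈ b)) elems

  card : IsFinite → ℕ
  card fin = length (IsFinite.elems fin)

  Point : ℕ → Set c
  Point n = Fin n → Carrier

  _≈ᵥ_ : ∀ {n} → Point n → Point n → Set ℓ
  x ≈ᵥ y = ∀ i → x i ≈ y i

  Σᶠ : ∀ {k} → (Fin k → Carrier) → Carrier
  Σᶠ {zero}  _ = 0#
  Σᶠ {suc k} a = a zero + Σᶠ (λ i → a (suc i))

  Πᶠ : ∀ {k} → (Fin k → Carrier) → Carrier
  Πᶠ {zero}  _ = 1#
  Πᶠ {suc k} a = a zero * Πᶠ (λ i → a (suc i))

  _^_ : Carrier → ℕ → Carrier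
  x ^ zero  = 1#
  x ^ suc m = x * (x ^ m)

  -- Polynomials in F[x_1..x_n]: finite sums of terms c · x^e, with
  -- e : Fin n → ℕ an exponent vector.
  Monomial : ℕ → Set
  Monomial n = Fin n → ℕ

  Poly : ℕ → Set c
  Poly n = List (Carrier × Monomial n)

  evalMono : ∀ {n} → Monomial n → Point n → Carrier
  evalMono e x = Πᶠ (λ i → x i ^ e i)

  eval : ∀ {n} → Poly n → Point n → Carrier
  eval f x = foldr (λ t acc → (proj₁ t * evalMono (proj₂ t) x) + acc) 0# f

  mdeg : ∀ {n} → Monomial n → ℕ
  mdeg e = sumℕ e

  DegreeAtMost : ∀ {n} → Poly n → ℕ → Set c
  DegreeAtMost f d = All (λ t → mdeg (proj₂ t) ℕ.≤ d) f

  record AffineSubspace (n : ℕ) : Set (c ⊔ ℓ) where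
    field
      dim   : ℕ
      base  : Point n
      dir   : Fin dim → Point n
      indep : ∀ (t : Fin dim → Carrier) →
              (∀ i → Σᶠ (λ j → t j * dir j i) ≈ 0#) → ∀ j → t j ≈ 0#

  _∈ᴸ_ : ∀ {n} → Point n → AffineSubspace n → Set (c ⊔ ℓ)
  x ∈ᴸ L = ∃ λ (t : Fin (AffineSubspace.dim L) → Carrier) →
             ∀ i → x i ≈ (AffineSubspace.base L i
                          + Σᶠ (λ j → t j * AffineSubspace.dir L j i))

  Parallel : ∀ {n} → AffineSubspace n → AffineSubspace n → Set (c ⊔ ℓ)
  Parallel L₁ L₂ = ∃ λ (w : Point _) →
    ∀ x → (x ∈ᴸ L₂ → (λ i → x i - w i) ∈ᴸ L₁)
        × ((λ i → x i - w i) ∈ᴸ L₁ → x ∈ᴸ L₂)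

  CommonZero : ∀ {n r} → (Fin r → Poly n) → Point n → Set ℓ
  CommonZero f x = ∀ j → eval (f j) x ≈ 0#

  -- The list zs enumerates (without repetition, up to ≈) the points of
  -- F^n satisfying P; its length is then #{x : P x}.
  Enumerates : ∀ {n p} → (Point n → Set p) → List (Point n) → Set (c ⊔ ℓ ⊔ p)
  Enumerates P zs = All P zs
                  × (∀ x → P x → Any (x ≈ᵥ_) zs)
                  × AllPairs (λ a b → ¬ (a ≈ᵥ b)) zs

  CountsZerosIn : ∀ {n r} → (Fin r → Poly n) → AffineSubspace n → List (Point n) → Set (c ⊔ ℓ)
  CountsZerosIn f L zs = Enumerates (λ x → (x ∈ᴸ L) × CommonZero f x) zs

{-# OPTIONS --safe #-}
module Submission where

-- Let q = pᵐ, let A = ℤ[F] be the ring of the multiplicative monoid of F, with basis [x], and let I be the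
-- kernel of A → F.  Modulo Iᵐ the indicator of f(x) = 0 is 1 − f̃(x)ᴹ, where f̃(x) ∈ A lifts f(x) and
-- M = (q − 1) pᵐ.  Since (Σ Xᵢ)ᵖ ≡ Σ Xᵢᵖ mod p, the coefficients of f̃ᴹ are divisible by powers of p that are
-- bounded below by digit counts, one for each of the m rotations e ↦ pᶜe mod (q − 1) of the exponents.
-- If there are more than Σ dⱼ variables, a monomial whose sum over all points is not already in Iᵐ pays at least
-- one factor p for each of the m rotations; hence the number of zeros lies in Iᵐ.  The Frobenius lift
-- [x] ↦ [xᵖ] shows ℤ ∩ Iᵐ = pᵐℤ, so q divides the number of zeros (Ax).
-- Following Heath-Brown, apply this to the homogenisation of t ↦ f(b + tV) in one extra variable s: its zeros
-- are those with s = 0, which do not depend on b, and q − 1 copies of the zeros on the flat b + tV.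

open import Defs renaming (_^_ to power)
open import Level using (Level; _⊔_)
open import Algebra.Bundles using (CommutativeMonoid; CommutativeRing)
import Algebra.Construct.Pointwise as Pointwise
open import Data.Bool using (true; false; if_then_else_)
open import Data.Empty using (⊥-elim)
open import Data.Fin using (Fin; zero; suc; toℕ; inject₁; fromℕ)
import Data.Fin.Properties as Fin
open import Data.Integer as ℤ using (ℤ)
import Data.Integer.Divisibility as ℤ
import Data.Integer.Divisibility.Signed as Signed
import Data.Integer.Properties as ℤ
open import Data.Integer.Tactic.RingSolver using () renaming (solve-∀ to solve-ℤ)
open import Data.List using (List; []; _∷_; _++_; map; length; concatMap; filter)
open import Data.List.Membership.Setoid.Properties using (∈-filter⁺; ∈-filter⁻)
open import Data.List.Properties using (length-filter; length-++; length-map; ++-assoc; map-++)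
open import Data.List.Relation.Unary.All as All using (All; []; _∷_)
import Data.List.Relation.Unary.All.Properties as All
open import Data.List.Relation.Unary.AllPairs as AllPairs using (AllPairs; []; _∷_)
import Data.List.Relation.Unary.AllPairs.Properties as AllPairs
open import Data.List.Relation.Unary.Any as Any using (Any; here; there)
import Data.List.Relation.Unary.Any.Properties as Any
open import Data.Maybe using (nothing)
open import Data.Nat as ℕ using (ℕ; zero; suc; s≤s; z≤n; _≤_)
open import Data.Nat.Combinatorics using (_C_; nCk+nC[k+1]≡[n+1]C[k+1]; nCn≡1; nC1≡n; k>n⇒nCk≡0)
open import Data.Nat.Divisibility as ℕ using (divides)
import Data.Nat.DivMod as ℕ
open import Data.Nat.GCD using (gcd-GCD; gcd[m,n]∣m; gcd[m,n]∣n; module Bézout)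
open import Data.Nat.ListAction using (product)
open import Data.Nat.Primality using (Prime; euclidsLemma; prime⇒irreducible; prime⇒nonZero; prime⇒nonTrivial)
open import Data.Nat.Primality.Factorisation using (factorise; PrimeFactorisation)
import Data.Nat.Properties as ℕ
open import Data.Nat.Tactic.RingSolver using () renaming (solve-∀ to solve-ℕ)
open import Data.Product using (∃; _×_; _,_; proj₁; proj₂)
open import Data.Sign as Sign using (Sign)
open import Data.Sum using (_⊎_; inj₁; inj₂)
open import Relation.Binary.Bundles using (Setoid)
open import Relation.Binary.PropositionalEquality as ≡ using (_≡_)
open import Relation.Nullary using (¬_; Dec; yes; no; ¬?; does)
open import Tactic.RingSolver using (solve-∀)
open import Tactic.RingSolver.Core.AlmostCommutativeRing using (AlmostCommutativeRing; fromCommutativeRing)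

-- The price is that p does not generate I and that there are zero divisors, so the p-adic valuation
-- gives way to the order along the powers of I, where p has order at least one. The constant M: the
-- factor q - 1 turns a nonzero value into 1 modulo I, and the factor p^m sharpens this to a
-- congruence modulo Iᵐ. In base p it has m nonzero digits, all p - 1, so f̃ᴹ is a product of only
-- m(p - 1) factors f̃^(p^b). Each of them is charged (q - 1)/(p - 1) over the m rotations, m(q - 1)
-- in all: exactly one allowance of degree (q - 1)d per rotation. Any excess has to come from
-- factors p. The extra variable s does two things: it makes dimension at least d into more than d
-- variables, and, as q - 1 is -1 modulo q, it turns divisibility of the total into equality modulo
-- q of the affine count and the count at s = 0.

module DistinctLists {a b : Level} (S : Setoid a b) where
  open Setoid S

  Distinct : List Carrier → Set (a ⊔ b)
  Distinct = AllPairs (λ x y → ¬ (x ≈ y))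

  infix 4 _∈_
  _∈_ : Carrier → List Carrier → Set (a ⊔ b)
  x ∈ xs = Any (x ≈_) xs

  ∈-resp : ∀ {x y xs} → x ≈ y → x ∈ xs → y ∈ xs
  ∈-resp e (here e′)  = here (trans (sym e) e′)
  ∈-resp e (there x∈) = there (∈-resp e x∈)

  fresh⇒≉ : ∀ {x z xs} → All (λ y → ¬ (x ≈ y)) xs → z ∈ xs → ¬ (z ≈ x)
  fresh⇒≉ (x≉y ∷ _) (here z≈y)  z≈x = x≉y (trans (sym z≈x) z≈y)
  fresh⇒≉ (_ ∷ f)   (there z∈) z≈x = fresh⇒≉ f z∈ z≈x

  ∉⇒fresh : ∀ {x} ys → ¬ (x ∈ ys) → All (λ y → ¬ (x ≈ y)) ys
  ∉⇒fresh []       n = []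
  ∉⇒fresh (z ∷ zs) n = (λ e → n (here e)) ∷ ∉⇒fresh zs (λ i → n (there i))

  ∈-lookup : ∀ {p} {P : Carrier → Set p} {x xs} → (∀ {y z} → y ≈ z → P y → P z) → All P xs → x ∈ xs → P x
  ∈-lookup r (px ∷ _)   (here e)   = r (sym e) px
  ∈-lookup r (_ ∷ pxs) (there x∈) = ∈-lookup r pxs x∈

  -- Equality in a setoid is not assumed decidable. Two members of a repetition-free list are equal
  -- exactly when their membership proofs point to the same position, and positions can be compared.
  ≈-dec : ∀ {xs x y} → Distinct xs → x ∈ xs → y ∈ xs → Dec (x ≈ y)
  ≈-dec ds       (here e)   (here e′)  = yes (trans e (sym e′))
  ≈-dec (f ∷ ds) (here e)   (there y∈) = no (λ x≈y → fresh⇒≉ f y∈ (trans (sym x≈y) e))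
  ≈-dec (f ∷ ds) (there x∈) (here e)   = no (λ x≈y → fresh⇒≉ f x∈ (trans x≈y e))
  ≈-dec (f ∷ ds) (there x∈) (there y∈) = ≈-dec ds x∈ y∈

-- Sums over repetition-free lists in a commutative monoid

module ListSum {c ℓ : Level} (M : CommutativeMonoid c ℓ) where
  open CommutativeMonoid M
  open import Algebra.Properties.CommutativeSemigroup commutativeSemigroup using (interchange; x∙yz≈y∙xz)
  open import Relation.Binary.Reasoning.Setoid setoid

  ∑ : ∀ {a} {X : Set a} → List X → (X → Carrier) → Carrier
  ∑ []       h = ε
  ∑ (x ∷ xs) h = h x ∙ ∑ xs h

  ∑-cong : ∀ {a} {X : Set a} (xs : List X) {g h : X → Carrier} →
           (∀ x → g x ≈ h x) → ∑ xs g ≈ ∑ xs h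
  ∑-cong []       e = refl
  ∑-cong (x ∷ xs) e = ∙-cong (e x) (∑-cong xs e)

  ∑-congAll : ∀ {a b} {X : Set a} {P : X → Set b} {xs : List X} {g h : X → Carrier} → All P xs →
              (∀ x → P x → g x ≈ h x) → ∑ xs g ≈ ∑ xs h
  ∑-congAll []         e = refl
  ∑-congAll (px ∷ pxs) e = ∙-cong (e _ px) (∑-congAll pxs e)

  ∑-ε : ∀ {a} {X : Set a} (xs : List X) → ∑ xs (λ _ → ε) ≈ ε
  ∑-ε []       = refl
  ∑-ε (x ∷ xs) = trans (identityˡ _) (∑-ε xs)

  ∑-∙ : ∀ {a} {X : Set a} (xs : List X) (g h : X → Carrier) →
        ∑ xs (λ x → g x ∙ h x) ≈ ∑ xs g ∙ ∑ xs h
  ∑-∙ []       g h = sym (identityˡ ε)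
  ∑-∙ (x ∷ xs) g h = trans (∙-congˡ (∑-∙ xs g h)) (interchange _ _ _ _)

  ∑-swap : ∀ {a b} {X : Set a} {Y : Set b} (xs : List X) (ys : List Y) (h : X → Y → Carrier) →
           ∑ xs (λ x → ∑ ys (h x)) ≈ ∑ ys (λ y → ∑ xs (λ x → h x y))
  ∑-swap []       ys h = sym (∑-ε ys)
  ∑-swap (x ∷ xs) ys h = trans (∙-congˡ (∑-swap xs ys h)) (sym (∑-∙ ys (h x) _))

  ∑-++ : ∀ {a} {X : Set a} (xs ys : List X) (h : X → Carrier) →
         ∑ (xs ++ ys) h ≈ ∑ xs h ∙ ∑ ys h
  ∑-++ []       ys h = sym (identityˡ _)
  ∑-++ (x ∷ xs) ys h = trans (∙-congˡ (∑-++ xs ys h)) (sym (assoc _ _ _))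

  ∑-map : ∀ {a b} {X : Set a} {Y : Set b} (f : X → Y) (xs : List X) (h : Y → Carrier) →
          ∑ (map f xs) h ≡ ∑ xs (λ x → h (f x))
  ∑-map f []       h = ≡.refl
  ∑-map f (x ∷ xs) h = ≡.cong (h (f x) ∙_) (∑-map f xs h)

  ∑-concatMap : ∀ {a b} {X : Set a} {Y : Set b} (f : X → List Y) (xs : List X) (h : Y → Carrier) →
                ∑ (concatMap f xs) h ≈ ∑ xs (λ x → ∑ (f x) h)
  ∑-concatMap f []       h = refl
  ∑-concatMap f (x ∷ xs) h = trans (∑-++ (f x) _ h) (∙-congˡ (∑-concatMap f xs h))

  module _ {a b} (S : Setoid a b) where
    private module S = Setoid S
    open DistinctLists S

    private
      -- Deletion is driven by a proof of membership, since no decision procedure for equality is at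
      -- hand to filter with. The last three fields pin down the members of `rest` as those of `ys`
      -- other than x.
      record Removal (x : S.Carrier) (ys : List S.Carrier) (h : S.Carrier → Carrier) : Set (a ⊔ b ⊔ ℓ) where
        field
          rest     : List S.Carrier
          total    : ∑ ys h ≈ h x ∙ ∑ rest h
          distinct : Distinct rest
          forget   : ∀ z → z ∈ rest → z ∈ ys
          avoid    : ∀ z → z ∈ rest → ¬ (z S.≈ x)
          keep     : ∀ z → z ∈ ys → ¬ (z S.≈ x) → z ∈ rest

      remove : ∀ {x ys} (h : S.Carrier → Carrier) → (∀ {y z} → y S.≈ z → h y ≈ h z) →
               Distinct ys → x ∈ ys → Removal x ys h
      remove {x} {y ∷ ys} h hc (f ∷ ds) (here x≈y) = record
        { rest = ys ; total = ∙-congʳ (hc (S.sym x≈y)) ; distinct = ds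
        ; forget = λ z → there
        ; avoid = λ z z∈ z≈x → fresh⇒≉ f z∈ (S.trans z≈x x≈y)
        ; keep = λ { z (here z≈y) n → ⊥-elim (n (S.trans z≈y (S.sym x≈y))) ; z (there z∈) n → z∈ } }
      remove {x} {y ∷ ys} h hc (f ∷ ds) (there x∈) = record
        { rest = y ∷ rest
        ; total = trans (∙-congˡ total) (x∙yz≈y∙xz _ _ _)
        ; distinct = ∉⇒fresh rest (λ y∈ → fresh⇒≉ f (forget y y∈) S.refl) ∷ distinct
        ; forget = λ { z (here e) → here e ; z (there z∈) → there (forget z z∈) }
        ; avoid = λ { z (here z≈y) z≈x → fresh⇒≉ f x∈ (S.trans (S.sym z≈x) z≈y) ; z (there z∈) → avoid z z∈ }
        ; keep = λ { z (here e) n → here e ; z (there z∈) n → there (keep z z∈ n) } }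
        where open Removal (remove h hc ds x∈)

    -- Equal sets of members stand in for a permutation: the members of `xs` are deleted from `ys`
    -- one at a time. Every counting bijection below rests on this, with ℕ as the monoid for
    -- cardinalities, multiplication in F for Fermat's theorem, and addition for power sums.
    ∑-reindex : ∀ (h : S.Carrier → Carrier) → (∀ {y z} → y S.≈ z → h y ≈ h z) →
                ∀ xs ys → Distinct xs → Distinct ys →
                (∀ z → z ∈ xs → z ∈ ys) → (∀ z → z ∈ ys → z ∈ xs) → ∑ xs h ≈ ∑ ys h
    ∑-reindex h hc []       []       dx dy f g = refl
    ∑-reindex h hc []       (y ∷ ys) dx dy f g with () ← g y (here S.refl)
    ∑-reindex h hc (x ∷ xs) ys       (n ∷ dx) dy f g = begin
      h x ∙ ∑ xs h    ≈⟨ ∙-congˡ (∑-reindex h hc xs rest dx distinct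
                            (λ z z∈ → keep z (f z (there z∈)) (fresh⇒≉ n z∈))
                            (λ z z∈ → back z (avoid z z∈) (g z (forget z z∈)))) ⟩
      h x ∙ ∑ rest h  ≈⟨ total ⟨
      ∑ ys h          ∎
      where
      open Removal (remove {x} h hc dy (f x (here S.refl)))
      back : ∀ z → ¬ (z S.≈ x) → z ∈ (x ∷ xs) → z ∈ xs
      back z z≉x (here e)   = ⊥-elim (z≉x e)
      back z z≉x (there z∈) = z∈

-- Binomial coefficients divisible by a prime

[k+1]*[n+1]C[k+1] : ∀ n k → suc k ℕ.* (suc n C suc k) ≡ suc n ℕ.* (n C k)
[k+1]*[n+1]C[k+1] zero    zero    = ≡.refl
[k+1]*[n+1]C[k+1] zero    (suc k)
  rewrite k>n⇒nCk≡0 {1} {2 ℕ.+ k} (s≤s (s≤s z≤n)) | k>n⇒nCk≡0 {0} {suc k} (s≤s z≤n) = ℕ.*-zeroʳ k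
[k+1]*[n+1]C[k+1] (suc n) zero    = ≡.trans (ℕ.*-identityˡ _) (≡.trans (nC1≡n (2 ℕ.+ n)) (≡.sym (ℕ.*-identityʳ _)))
[k+1]*[n+1]C[k+1] (suc n) (suc k) = begin
  suc (suc k) ℕ.* ((2 ℕ.+ n) C (2 ℕ.+ k))
    ≡⟨ ≡.cong (suc (suc k) ℕ.*_) (nCk+nC[k+1]≡[n+1]C[k+1] (suc n) (suc k)) ⟨
  suc (suc k) ℕ.* (X ℕ.+ Y)               ≡⟨ ℕ.*-distribˡ-+ (2 ℕ.+ k) X Y ⟩
  (X ℕ.+ suc k ℕ.* X) ℕ.+ suc (suc k) ℕ.* Y
    ≡⟨ ≡.cong₂ (λ a b → (X ℕ.+ a) ℕ.+ b) ([k+1]*[n+1]C[k+1] n k) ([k+1]*[n+1]C[k+1] n (suc k)) ⟩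
  (X ℕ.+ suc n ℕ.* (n C k)) ℕ.+ suc n ℕ.* (n C suc k)
    ≡⟨ ℕ.+-assoc X _ _ ⟩
  X ℕ.+ (suc n ℕ.* (n C k) ℕ.+ suc n ℕ.* (n C suc k))
    ≡⟨ ≡.cong (X ℕ.+_) (ℕ.*-distribˡ-+ (suc n) (n C k) (n C suc k)) ⟨
  X ℕ.+ suc n ℕ.* ((n C k) ℕ.+ (n C suc k))
    ≡⟨ ≡.cong (λ a → X ℕ.+ suc n ℕ.* a) (nCk+nC[k+1]≡[n+1]C[k+1] n k) ⟩
  suc (suc n) ℕ.* X ∎
  where
  open ≡.≡-Reasoning
  X = suc n C suc k
  Y = suc n C (2 ℕ.+ k)

-- By absorption p divides the product of k + 1 and the binomial coefficient; as k + 1 is less than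
-- p, Euclid's lemma leaves the second factor.
prime∣pCk : ∀ {n} k → Prime (suc n) → k ℕ.< n → suc n ℕ.∣ (suc n C suc k)
prime∣pCk {n} k pr k<n with euclidsLemma (suc k) (suc n C suc k) pr
                              (ℕ.∣-trans (ℕ.m∣m*n (n C k)) (ℕ.∣-reflexive (≡.sym ([k+1]*[n+1]C[k+1] n k))))
... | inj₁ p∣k = ⊥-elim (ℕ.<⇒≱ (s≤s k<n) (ℕ.∣⇒≤ p∣k))
... | inj₂ p∣C = p∣C

module _ {a b : Level} (S : Setoid a b) where
  open DistinctLists S

  length-unique : ∀ xs ys → Distinct xs → Distinct ys →
                  (∀ z → z ∈ xs → z ∈ ys) → (∀ z → z ∈ ys → z ∈ xs) → length xs ≡ length ys
  length-unique xs ys dx dy f g = ≡.trans (length≡∑1 xs)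
    (≡.trans (∑-reindex S (λ _ → 1) (λ _ → ≡.refl) xs ys dx dy f g) (≡.sym (length≡∑1 ys)))
    where
    open ListSum ℕ.+-0-commutativeMonoid
    length≡∑1 : ∀ {c} {X : Set c} (zs : List X) → length zs ≡ ∑ zs (λ _ → 1)
    length≡∑1 []       = ≡.refl
    length≡∑1 (z ∷ zs) = ≡.cong suc (length≡∑1 zs)

-- Commutative rings and the p-th power of a sum

module Identities {c ℓ : Level} (R : CommutativeRing c ℓ) where
  private
    S : AlmostCommutativeRing c ℓ
    S = fromCommutativeRing R (λ _ → nothing)
  open AlmostCommutativeRing S

  x+[y+z]≈z+x+y : ∀ x y z → x + (y + z) ≈ z + x + y
  x+[y+z]≈z+x+y = solve-∀ S

  divide-step : ∀ y a b g h → (a + y) * (g + y * h) + b ≈ (a * g + b) + y * ((a + y) * h + g)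
  divide-step = solve-∀ S

  x+y+z≈x+z+y : ∀ x y z → x + y + z ≈ x + z + y
  x+y+z≈x+z+y = solve-∀ S

module RingFacts {c ℓ : Level} (R : CommutativeRing c ℓ) where
  open CommutativeRing R hiding (zero) public
  open import Algebra.Properties.CommutativeSemiring.Exp commutativeSemiring public
    using (_^_; ^-congˡ; ^-congʳ; ^-homo-*; ^-assocʳ; ^-distrib-*)
  open import Algebra.Properties.Semiring.Mult semiring public
    using (×-congʳ; ×-congˡ; ×-homo-+; ×-assocˡ; ×-assoc-*; ×-comm-*; ×1-homo-*) renaming (_×_ to _·_)
  open import Algebra.Properties.CommutativeMonoid.Mult +-commutativeMonoid public using () renaming (×-distrib-+ to ·-distrib-+)
  open import Algebra.Properties.Semiring.Sum semiring public using (sum; sum-cong-≋; sum-init-last)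
  open import Algebra.Properties.CommutativeSemiring.Binomial commutativeSemiring using (theorem; binomialTerm)
  open import Algebra.Properties.Ring ring public using (-‿distribˡ-*; -‿distribʳ-*; -‿involutive; -‿+-comm; -0#≈0#; +-cancelˡ; +-cancelʳ)
  open import Algebra.Properties.CommutativeSemigroup +-commutativeSemigroup public using (interchange)
  open import Algebra.Properties.Group +-group public using () renaming (x∙y⁻¹≈ε⇒x≈y to x-y≈0⇒x≈y; x≈y⇒x∙y⁻¹≈ε to x≈y⇒x-y≈0)
  module R+ = ListSum +-commutativeMonoid
  module R* = ListSum *-commutativeMonoid
  open R+ public using (∑; ∑-cong; ∑-congAll; ∑-ε; ∑-swap; ∑-++; ∑-map; ∑-concatMap; ∑-reindex)
  open import Relation.Binary.Reasoning.Setoid setoid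

  open Identities R public

  a+[x-a]≈x : ∀ a x → a + (x - a) ≈ x
  a+[x-a]≈x a x = trans (+-comm _ _) (trans (+-assoc _ _ _) (trans (+-congˡ (-‿inverseˡ a)) (+-identityʳ x)))

  *-distribˡ-∑ : ∀ {a} {X : Set a} (xs : List X) (h : X → Carrier) y → y * ∑ xs h ≈ ∑ xs (λ x → y * h x)
  *-distribˡ-∑ []       h y = zeroʳ y
  *-distribˡ-∑ (x ∷ xs) h y = trans (distribˡ _ _ _) (+-congˡ (*-distribˡ-∑ xs h y))

  ∑-const : ∀ {a} {X : Set a} (xs : List X) y → ∑ xs (λ _ → y) ≈ length xs · y
  ∑-const []       y = refl
  ∑-const (x ∷ xs) y = +-congˡ (∑-const xs y)

  1^n≈1 : ∀ n → 1# ^ n ≈ 1#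
  1^n≈1 zero    = refl
  1^n≈1 (suc n) = trans (*-identityˡ _) (1^n≈1 n)

  ·≈·1* : ∀ n x → n · x ≈ (n · 1#) * x
  ·≈·1* n x = trans (×-congʳ n (sym (*-identityˡ x))) (sym (×-assoc-* n 1# x))

  ·-zeroʳ : ∀ n → n · 0# ≈ 0#
  ·-zeroʳ n = trans (·≈·1* n 0#) (zeroʳ _)

  ·-distrib-minus : ∀ n x y → n · (x - y) ≈ n · x - n · y
  ·-distrib-minus n x y = begin
    n · (x - y)                    ≈⟨ ·-distrib-+ x (- y) n ⟩
    n · x + n · (- y)              ≈⟨ +-congˡ (trans (·≈·1* n (- y)) (sym (-‿distribʳ-* _ y))) ⟩
    n · x - (n · 1#) * y           ≈⟨ +-congˡ (-‿cong (·≈·1* n y)) ⟨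
    n · x - n · y                  ∎

  module _ {n : ℕ} (pr : Prime (suc n)) where
    private
      coeff : Fin n → ℕ
      coeff i = ℕ.quotient (prime∣pCk (toℕ i) pr (Fin.toℕ<n i))

    -- The inner terms of the expansion of (a + b)^p after division by p. The division is carried
    -- out on the binomial coefficients, so it makes sense in every commutative ring.
    middle : Carrier → Carrier → Carrier
    middle a b = sum {n} (λ i → coeff i · (a ^ suc (toℕ i) * b ^ (n ℕ.∸ toℕ i)))

    private
      last-term : ∀ a b → binomialTerm a b (suc n) (suc (fromℕ n)) ≈ a ^ suc n
      last-term a b rewrite Fin.toℕ-fromℕ n | nCn≡1 (suc n) | ℕ.n∸n≡0 n = trans (+-identityʳ _) (*-identityʳ _)

      mid-term : ∀ a b i → binomialTerm a b (suc n) (suc (inject₁ i)) ≈ suc n · (coeff i · (a ^ suc (toℕ i) * b ^ (n ℕ.∸ toℕ i)))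
      mid-term a b i rewrite Fin.toℕ-inject₁ i = trans
        (×-congˡ (≡.trans (ℕ._∣_.equality (prime∣pCk (toℕ i) pr (Fin.toℕ<n i))) (ℕ.*-comm (coeff i) (suc n))))
        (sym (×-assocˡ _ (suc n) (coeff i)))

      sum-· : ∀ {k} m (t : Fin k → Carrier) → sum (λ i → m · t i) ≈ m · sum t
      sum-· {zero}  m t = sym (·-zeroʳ m)
      sum-· {suc k} m t = trans (+-congˡ (sum-· m (λ i → t (suc i)))) (sym (·-distrib-+ _ _ m))

    freshman : ∀ a b → (a + b) ^ suc n ≈ a ^ suc n + b ^ suc n + suc n · middle a b
    freshman a b = begin
      (a + b) ^ suc n ≈⟨ theorem (suc n) a b ⟩
      t zero + sum (λ i → t (suc i))
        ≈⟨ +-cong (trans (+-identityʳ _) (*-identityˡ _)) (sum-init-last (λ i → t (suc i))) ⟩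
      b ^ suc n + (sum (λ i → t (suc (inject₁ i))) + t (suc (fromℕ n)))
        ≈⟨ +-congˡ (+-cong (trans (sum-cong-≋ (mid-term a b)) (sum-· {n} (suc n) _)) (last-term a b)) ⟩
      b ^ suc n + (suc n · middle a b + a ^ suc n) ≈⟨ x+[y+z]≈z+x+y _ _ _ ⟩
      a ^ suc n + b ^ suc n + suc n · middle a b ∎
      where
      t = binomialTerm a b (suc n)

    -- Both exponents in a mixed product are positive, and the coefficients are natural numbers, so
    -- closure of `Q` under addition is enough. The lemma serves for the powers of the ideal I and
    -- for the classes of functions `T` alike.
    middle-closed : ∀ {k} (Q : Carrier → Set k) → Q 0# → (∀ {x y} → Q x → Q y → Q (x + y)) →
      ∀ a b → (∀ i → i ℕ.< n → Q (a ^ suc i * b ^ (n ℕ.∸ i))) → Q (middle a b)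
    middle-closed Q q0 q+ a b q = go {n} _ (λ i → mult (coeff i) (q (toℕ i) (Fin.toℕ<n i)))
      where
      mult : ∀ k {x} → Q x → Q (k · x)
      mult zero    qx = q0
      mult (suc k) qx = q+ qx (mult k qx)
      go : ∀ {k} (t : Fin k → Carrier) → (∀ i → Q (t i)) → Q (sum t)
      go {zero}  t qt = q0
      go {suc k} t qt = q+ (qt zero) (go (λ i → t (suc i)) (λ i → qt (suc i)))

n<m^n : ∀ {m} → 1 ℕ.< m → ∀ n → n ℕ.< m ℕ.^ n
n<m^n 1<m zero    = s≤s z≤n
n<m^n {m@(suc _)} 1<m (suc n) = ℕ.≤-trans (s≤s (n<m^n 1<m n)) (ℕ.≤-trans
  (ℕ.m<m*n (m ℕ.^ n) m {{ℕ.m^n≢0 m n}} 1<m) (ℕ.≤-reflexive (ℕ.*-comm (m ℕ.^ n) m)))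

-- Finite fields: Fermat, roots of polynomials, characteristic, order

module FieldFacts {c ℓ : Level} (F : CommutativeRing c ℓ) (isField : IsField F) (fin : IsFinite F) where
  open RingFacts F public
  open IsFinite fin public
  open DistinctLists setoid public
  open import Relation.Binary.Reasoning.Setoid setoid

  infix 4 _≟_
  _≟_ : ∀ x y → Dec (x ≈ y)
  x ≟ y = ≈-dec distinct (complete x) (complete y)

  0≉1 : ¬ (1# ≈ 0#)
  0≉1 = proj₁ isField

  cancel-nonzero : ∀ {x y z} → ¬ (x ≈ 0#) → x * y ≈ x * z → y ≈ z
  cancel-nonzero {x} {y} {z} x≉0 e with x⁻¹ , xx⁻¹≈1 ← proj₂ isField x x≉0 = trans (sym (go y)) (trans (*-congˡ e) (go z))
    where
    go : ∀ w → x⁻¹ * (x * w) ≈ w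
    go w = trans (sym (*-assoc _ _ _)) (trans (*-congʳ (trans (*-comm _ _) xx⁻¹≈1)) (*-identityˡ w))

  *-nonzero : ∀ {x y} → ¬ (x ≈ 0#) → ¬ (y ≈ 0#) → ¬ (x * y ≈ 0#)
  *-nonzero x≉0 y≉0 e = y≉0 (cancel-nonzero x≉0 (trans e (sym (zeroʳ _))))

  q : ℕ
  q = length elems

  private
    nonzero? : ∀ x → Dec (¬ (x ≈ 0#))
    nonzero? x = ¬? (x ≟ 0#)

    nonzero-resp : ∀ {x y} → x ≈ y → ¬ (x ≈ 0#) → ¬ (y ≈ 0#)
    nonzero-resp x≈y x≉0 y≈0 = x≉0 (trans x≈y y≈0)

  units : List Carrier
  units = filter nonzero? elems

  units-nonzero : All (λ x → ¬ (x ≈ 0#)) units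
  units-nonzero = All.all-filter nonzero? elems

  ∈-units : ∀ x → ¬ (x ≈ 0#) → x ∈ units
  ∈-units x x≉0 = ∈-filter⁺ setoid nonzero? nonzero-resp (complete x) x≉0

  units-distinct : Distinct units
  units-distinct = AllPairs.filter⁺ nonzero? distinct

  private
    0∷units-distinct : Distinct (0# ∷ units)
    0∷units-distinct = All.map (λ x≉0 0≈x → x≉0 (sym 0≈x)) units-nonzero ∷ units-distinct

    0∷units-complete : ∀ x → x ∈ (0# ∷ units)
    0∷units-complete x with x ≟ 0#
    ... | yes x≈0 = here x≈0
    ... | no  x≉0 = there (∈-units x x≉0)

  N : ℕ
  N = length units

  q≡1+N : q ≡ suc N
  q≡1+N = length-unique setoid elems (0# ∷ units) distinct 0∷units-distinct
            (λ z _ → 0∷units-complete z) (λ z _ → complete z)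

  N>0 : 0 ℕ.< N
  N>0 = nonempty (∈-units 1# 0≉1)
    where
    nonempty : ∀ {xs} → 1# ∈ xs → 0 ℕ.< length xs
    nonempty {_ ∷ _} _ = s≤s z≤n

  module _ {a b : Level} (M : CommutativeMonoid a b) where
    private module M = CommutativeMonoid M
    open ListSum M using () renaming (∑ to ∑M; ∑-map to ∑M-map; ∑-reindex to ∑M-reindex)

    ∑-split-zero : ∀ (h : Carrier → M.Carrier) → (∀ {x y} → x ≈ y → h x M.≈ h y) →
                   ∑M elems h M.≈ h 0# M.∙ ∑M units h
    ∑-split-zero h hc = ∑M-reindex setoid h hc elems (0# ∷ units) distinct 0∷units-distinct
                          (λ z _ → 0∷units-complete z) (λ z _ → complete z)

    ∑-permute : ∀ (f g : Carrier → Carrier) → (∀ {x y} → x ≈ y → f x ≈ f y) → (∀ {x y} → x ≈ y → g x ≈ g y) →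
                (∀ x → f (g x) ≈ x) → (∀ x → g (f x) ≈ x) →
                ∀ (h : Carrier → M.Carrier) → (∀ {x y} → x ≈ y → h x M.≈ h y) →
                ∑M elems (λ x → h (f x)) M.≈ ∑M elems h
    ∑-permute f g fc gc fg gf h hc = M.trans (M.reflexive (≡.sym (∑M-map f elems h)))
      (∑M-reindex setoid h hc (map f elems) elems
        (AllPairs.map⁺ (AllPairs.map (λ n e → n (trans (sym (gf _)) (trans (gc e) (gf _)))) distinct)) distinct
        (λ z _ → complete z)
        (λ z _ → Any.map⁺ (Any.map (λ e → trans (sym (fg z)) (fc e)) (complete (g z)))))

    ∑-scale : ∀ {x} → ¬ (x ≈ 0#) → ∀ (h : Carrier → M.Carrier) → (∀ {y z} → y ≈ z → h y M.≈ h z) →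
              ∑M elems (λ y → h (x * y)) M.≈ ∑M elems h
    ∑-scale {x} x≉0 h hc with x⁻¹ , xx⁻¹≈1 ← proj₂ isField x x≉0 =
      ∑-permute (x *_) (x⁻¹ *_) *-congˡ *-congˡ
        (λ y → trans (sym (*-assoc _ _ _)) (trans (*-congʳ xx⁻¹≈1) (*-identityˡ y)))
        (λ y → trans (sym (*-assoc _ _ _)) (trans (*-congʳ (trans (*-comm _ _) xx⁻¹≈1)) (*-identityˡ y))) h hc

  fermat : ∀ {x} → ¬ (x ≈ 0#) → x ^ N ≈ 1#
  fermat {x} x≉0 = cancel-nonzero (prod-nonzero units units-nonzero) (begin
    P * x ^ N                    ≈⟨ *-comm _ _ ⟩
    x ^ N * P                    ≈⟨ *-congʳ (∏-const units) ⟨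
    R*.∑ units (λ _ → x) * P     ≈⟨ R*.∑-∙ units (λ _ → x) (λ y → y) ⟨
    R*.∑ units (x *_)            ≡⟨ R*.∑-map (x *_) units (λ y → y) ⟨
    R*.∑ (map (x *_) units) (λ y → y)
      ≈⟨ R*.∑-reindex setoid (λ y → y) (λ e → e) (map (x *_) units) units
           (AllPairs.map⁺ (AllPairs.map (λ n e → n (cancel-nonzero x≉0 e)) units-distinct)) units-distinct into onto ⟩
    P                            ≈⟨ *-identityʳ P ⟨
    P * 1#                       ∎)
    where
    P = R*.∑ units (λ y → y)
    prod-nonzero : ∀ xs → All (λ y → ¬ (y ≈ 0#)) xs → ¬ (R*.∑ xs (λ y → y) ≈ 0#)
    prod-nonzero []       []       = 0≉1
    prod-nonzero (y ∷ ys) (n ∷ ns) = *-nonzero n (prod-nonzero ys ns)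
    ∏-const : ∀ xs → R*.∑ {X = Carrier} xs (λ _ → x) ≈ x ^ length xs
    ∏-const []       = refl
    ∏-const (y ∷ ys) = *-congˡ (∏-const ys)
    into : ∀ z → z ∈ map (x *_) units → z ∈ units
    into z z∈ = ∈-units z (∈-lookup nonzero-resp (All.map⁺ (All.map (*-nonzero x≉0) units-nonzero)) z∈)
    onto : ∀ z → z ∈ units → z ∈ map (x *_) units
    onto z z∈ with x⁻¹ , xx⁻¹≈1 ← proj₂ isField x x≉0 =
      Any.map⁺ (Any.map (λ e → trans (sym xx⁻¹z≈z) (*-congˡ e)) (∈-units (x⁻¹ * z) (*-nonzero x⁻¹≉0 z≉0)))
      where
      z≉0 = ∈-lookup nonzero-resp units-nonzero z∈
      x⁻¹≉0 : ¬ (x⁻¹ ≈ 0#)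
      x⁻¹≉0 e = 0≉1 (trans (sym xx⁻¹≈1) (trans (*-congˡ e) (zeroʳ x)))
      xx⁻¹z≈z : x * (x⁻¹ * z) ≈ z
      xx⁻¹z≈z = trans (sym (*-assoc _ _ _)) (trans (*-congʳ xx⁻¹≈1) (*-identityˡ z))

  -- Powers of a unit depend on the exponent modulo N only. The statement carries x^e = 1 over to an
  -- exponent r congruent to a multiple of e, the form in which rotated exponents occur.
  ^-reduce : ∀ {x r u e} → ¬ (x ≈ 0#) → ∀ j → r ℕ.+ u ℕ.* N ≡ j ℕ.* e → x ^ e ≈ 1# → x ^ r ≈ 1#
  ^-reduce {x} {r} {u} {e} x≉0 j r+uN≡je x^e≈1 = begin
    x ^ r                   ≈⟨ trans (*-congˡ (trans (^-congˡ u (fermat x≉0)) (1^n≈1 u))) (*-identityʳ _) ⟨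
    x ^ r * (x ^ N) ^ u     ≈⟨ *-congˡ (trans (^-assocʳ x N u) (^-congʳ x (ℕ.*-comm N u))) ⟩
    x ^ r * x ^ (u ℕ.* N)   ≈⟨ ^-homo-* x r _ ⟨
    x ^ (r ℕ.+ u ℕ.* N)     ≈⟨ ^-congʳ x (≡.trans r+uN≡je (ℕ.*-comm j e)) ⟩
    x ^ (e ℕ.* j)           ≈⟨ ^-assocʳ x e j ⟨
    (x ^ e) ^ j             ≈⟨ trans (^-congˡ j x^e≈1) (1^n≈1 j) ⟩
    1#                      ∎

  -- Horner form.
  data Monic : ℕ → (Carrier → Carrier) → Set (c ⊔ ℓ) where
    one   : ∀ {f} → (∀ x → f x ≈ 1#) → Monic 0 f
    shift : ∀ {k f g} a → Monic k g → (∀ x → f x ≈ x * g x + a) → Monic (suc k) f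

  -- Synthetic division: if h is the quotient of g at a, then the quotient of x g(x) + b is x h(x) +
  -- g(a).
  divideRoot : ∀ {k f} → Monic (suc k) f → ∀ a →
               ∃ λ g → Monic k g × (∀ x → f x ≈ f a + (x - a) * g x)
  divideRoot {f = f} (shift {g = g} b (one g≈1) e) a = g , one g≈1 , λ x → begin
    f x                           ≈⟨ trans (e x) (+-congʳ (trans (*-congˡ (g≈1 x)) (*-identityʳ x))) ⟩
    x + b                         ≈⟨ +-congʳ (a+[x-a]≈x a x) ⟨
    (a + (x - a)) + b             ≈⟨ x+y+z≈x+z+y _ _ _ ⟩
    (a + b) + (x - a)             ≈⟨ +-cong (trans (e a) (+-congʳ (trans (*-congˡ (g≈1 a)) (*-identityʳ a)))) (trans (*-congˡ (g≈1 x)) (*-identityʳ _)) ⟨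
    f a + (x - a) * g x           ∎
  divideRoot {f = f} (shift {g = g} b m@(shift _ _ _) e) a with h , mh , eh ← divideRoot m a =
    (λ x → x * h x + g a) , shift (g a) mh (λ _ → refl) , λ x → begin
      f x                                   ≈⟨ trans (e x) (+-congʳ (*-congˡ (eh x))) ⟩
      x * (g a + (x - a) * h x) + b         ≈⟨ +-congʳ (*-congʳ (a+[x-a]≈x a x)) ⟨
      (a + (x - a)) * (g a + (x - a) * h x) + b ≈⟨ divide-step (x - a) a b (g a) (h x) ⟩
      (a * g a + b) + (x - a) * ((a + (x - a)) * h x + g a)
                                            ≈⟨ +-congˡ (*-congˡ (+-congʳ (*-congʳ (a+[x-a]≈x a x)))) ⟩
      (a * g a + b) + (x - a) * (x * h x + g a) ≈⟨ +-congʳ (e a) ⟨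
      f a + (x - a) * (x * h x + g a)       ∎

  roots-bound : ∀ {k f} → Monic k f → ∀ xs → Distinct xs → All (λ x → f x ≈ 0#) xs → length xs ℕ.≤ k
  roots-bound m         []       _        _        = z≤n
  roots-bound (one f≈1) (x ∷ xs) _        (r ∷ _)  = ⊥-elim (0≉1 (trans (sym (f≈1 x)) r))
  roots-bound m@(shift _ _ _) (a ∷ xs) (n ∷ ds) (r ∷ rs) with g , mg , e ← divideRoot m a =
    s≤s (roots-bound mg xs ds (All.zipWith (λ (a≉x , fx≈0) → root a≉x fx≈0) (n , rs)))
    where
    root : ∀ {x} → ¬ (a ≈ x) → _ ≈ 0# → g x ≈ 0#
    root {x} a≉x fx≈0 = cancel-nonzero (λ x-a≈0 → a≉x (sym (x-y≈0⇒x≈y x a x-a≈0)))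
      (trans (trans (trans (sym (+-identityˡ _)) (+-congʳ (sym r))) (trans (sym (e x)) fx≈0)) (sym (zeroʳ _)))

  -- Otherwise x^k - 1 would have N roots, more than its degree. This takes the place of a generator
  -- of the unit group.
  exponent-bound : ∀ k → 0 ℕ.< k → (∀ x → ¬ (x ≈ 0#) → x ^ k ≈ 1#) → N ℕ.≤ k
  exponent-bound (suc k) _ e = roots-bound
    (shift {f = λ x → x ^ suc k - 1#} (- 1#) (monic-power k) (λ _ → refl)) units units-distinct
    (All.map (λ {x} x≉0 → x≈y⇒x-y≈0 (e x x≉0)) units-nonzero)
    where
    monic-power : ∀ k → Monic k (_^ k)
    monic-power zero    = one (λ _ → refl)
    monic-power (suc k) = shift 0# (monic-power k) (λ _ → sym (+-identityʳ _))

  -- Translation by 1 permutes F, so the sum of all x + 1 equals the sum of all x, and the latter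
  -- cancels.
  q·1≈0 : q · 1# ≈ 0#
  q·1≈0 = +-cancelʳ S (q · 1#) 0# (begin
    q · 1# + S                    ≈⟨ +-congʳ (∑-const elems 1#) ⟨
    ∑ elems (λ _ → 1#) + S        ≈⟨ R+.∑-∙ elems (λ _ → 1#) (λ x → x) ⟨
    ∑ elems (1# +_)               ≈⟨ ∑-permute +-commutativeMonoid (1# +_) (- 1# +_) +-congˡ +-congˡ
                                       (λ x → trans (sym (+-assoc _ _ _)) (trans (+-congʳ (-‿inverseʳ 1#)) (+-identityˡ x)))
                                       (λ x → trans (sym (+-assoc _ _ _)) (trans (+-congʳ (-‿inverseˡ 1#)) (+-identityˡ x)))
                                       (λ x → x) (λ e → e) ⟩
    S                             ≈⟨ +-identityˡ S ⟨
    0# + S                        ∎)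
    where S = ∑ elems (λ x → x)

  -- The image of q in F is the product of the images of its prime factors. It vanishes and F has no
  -- zero divisors, so one of the factors vanishes.
  characteristic : ∃ λ p → Prime p × p · 1# ≈ 0#
  characteristic = go (PrimeFactorisation.factors fact) (PrimeFactorisation.factorsPrime fact)
                      (trans (sym (×-congˡ (PrimeFactorisation.isFactorisation fact))) q·1≈0)
    where
    fact = factorise q {{ ≡.subst ℕ.NonZero (≡.sym q≡1+N) _ }}
    go : ∀ ps → All Prime ps → product ps · 1# ≈ 0# → ∃ λ p → Prime p × p · 1# ≈ 0#
    go []       _          e = ⊥-elim (0≉1 (trans (sym (+-identityʳ 1#)) e))
    go (p ∷ ps) (pr ∷ prs) e with p · 1# ≟ 0#
    ... | yes p·1≈0 = p , pr , p·1≈0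
    ... | no  p·1≉0 = go ps prs (cancel-nonzero p·1≉0 (trans (sym (×1-homo-* p (product ps))) (trans e (sym (zeroʳ _)))))

  module _ {p : ℕ} (pr : Prime p) (p·1≈0 : p · 1# ≈ 0#) where

    multiple-vanishes : ∀ a → (a ℕ.* p) · 1# ≈ 0#
    multiple-vanishes a = trans (×1-homo-* a p) (trans (*-congˡ p·1≈0) (zeroʳ _))

    char-∣ : ∀ n → n · 1# ≈ 0# → p ℕ.∣ n
    char-∣ n n·1≈0 with prime⇒irreducible pr (gcd[m,n]∣m p n)
    ... | inj₂ g≡p = ≡.subst (ℕ._∣ n) g≡p (gcd[m,n]∣n p n)
    ... | inj₁ g≡1 = ⊥-elim (0≉1 (bezout (≡.subst (λ d → Bézout.Identity d p n) g≡1 (Bézout.identity (gcd-GCD p n)))))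
      where
      kills : ∀ a b {k} → (∀ b → (b ℕ.* k) · 1# ≈ 0#) → (1 ℕ.+ a) · 1# ≈ (b ℕ.* k) · 1# → a · 1# ≈ 0# → 1# ≈ 0#
      kills a b z e a·1≈0 = trans (sym (trans (+-congˡ a·1≈0) (+-identityʳ 1#))) (trans e (z b))
      bezout : Bézout.Identity 1 p n → 1# ≈ 0#
      bezout (Bézout.+- x y eq) = kills (y ℕ.* n) x multiple-vanishes (×-congˡ eq) (n-vanishes y)
        where
        n-vanishes : ∀ a → (a ℕ.* n) · 1# ≈ 0#
        n-vanishes a = trans (×1-homo-* a n) (trans (*-congˡ n·1≈0) (zeroʳ _))
      bezout (Bézout.-+ x y eq) = kills (x ℕ.* p) y n-vanishes (×-congˡ eq) (multiple-vanishes x)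
        where
        n-vanishes : ∀ a → (a ℕ.* n) · 1# ≈ 0#
        n-vanishes a = trans (×1-homo-* a n) (trans (*-congˡ n·1≈0) (zeroʳ _))

    ·-% : ∀ n x → let instance _ = prime⇒nonZero pr in (n ℕ.% p) · x ≈ n · x
    ·-% n x = sym (begin
      n · x                                       ≈⟨ ×-congˡ (ℕ.m≡m%n+[m/n]*n n p) ⟩
      (n ℕ.% p ℕ.+ (n ℕ./ p) ℕ.* p) · x           ≈⟨ ×-homo-+ x (n ℕ.% p) _ ⟩
      (n ℕ.% p) · x + ((n ℕ./ p) ℕ.* p) · x       ≈⟨ +-congˡ (trans (·≈·1* ((n ℕ./ p) ℕ.* p) x) (trans (*-congʳ (multiple-vanishes (n ℕ./ p))) (zeroˡ x))) ⟩
      (n ℕ.% p) · x + 0#                          ≈⟨ +-identityʳ _ ⟩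
      (n ℕ.% p) · x                               ∎)
      where instance _ = prime⇒nonZero pr

    private
      1<p : 1 ℕ.< p
      1<p = ℕ.nonTrivial⇒n>1 p {{prime⇒nonTrivial pr}}

      0<p : 0 ℕ.< p
      0<p = ℕ.<-trans (s≤s z≤n) 1<p

    -- F is a vector space over its prime field. Instead of a basis, a chain of additive subgroups
    -- of orders 1, p, p², ... is built up to F. No closure under negation is asked for: in
    -- characteristic p it follows from closure under sums.
    record Subgroup (k : ℕ) : Set (c ⊔ ℓ) where
      field
        members  : List Carrier
        members! : Distinct members
        size     : length members ≡ p ℕ.^ k
        zero∈    : 0# ∈ members
        sum∈     : ∀ {x y} → x ∈ members → y ∈ members → x + y ∈ members

      multiple∈ : ∀ n {x} → x ∈ members → n · x ∈ members
      multiple∈ zero    x∈ = zero∈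
      multiple∈ (suc n) x∈ = sum∈ x∈ (multiple∈ n x∈)

    module _ {k : ℕ} (V : Subgroup k) {x : Carrier} (x∉ : ¬ (x ∈ Subgroup.members V)) where
      open Subgroup V

      private
        cosets : ℕ → List Carrier
        cosets zero    = []
        cosets (suc j) = map (j · x +_) members ++ cosets j

        ∈-cosets⁺ : ∀ {i v z} j → i ℕ.< j → v ∈ members → z ≈ i · x + v → z ∈ cosets j
        ∈-cosets⁺ {i} (suc j) (s≤s i≤j) v∈ e with i ℕ.≟ j
        ... | yes ≡.refl = Any.++⁺ˡ (Any.map⁺ (Any.map (λ v≈y → trans e (+-congˡ v≈y)) v∈))
        ... | no  i≢j    = Any.++⁺ʳ (map (j · x +_) members) (∈-cosets⁺ j (ℕ.≤∧≢⇒< i≤j i≢j) v∈ e)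

        ∈-cosets⁻ : ∀ {z} j → z ∈ cosets j → ∃ λ i → ∃ λ v → i ℕ.< j × v ∈ members × z ≈ i · x + v
        ∈-cosets⁻ (suc j) z∈ with Any.++⁻ (map (j · x +_) members) z∈
        ... | inj₁ z∈map = let w = Any.map⁻ z∈map in
                           j , Any.lookup w , ℕ.≤-refl , Any.map reflexive (lookup-∈ w) , Any.lookup-result w
          where
          lookup-∈ : ∀ {P : Carrier → Set ℓ} {xs} (w : Any P xs) → Any (Any.lookup w ≡_) xs
          lookup-∈ (here _)  = here ≡.refl
          lookup-∈ (there w) = there (lookup-∈ w)
        ... | inj₂ z∈rest with i , v , i<j , v∈ , e ← ∈-cosets⁻ j z∈rest = i , v , ℕ.m≤n⇒m≤1+n i<j , v∈ , e

        length-cosets : ∀ j → length (cosets j) ≡ j ℕ.* p ℕ.^ k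
        length-cosets zero    = ≡.refl
        length-cosets (suc j) = ≡.trans (length-++ (map (j · x +_) members))
          (≡.cong₂ ℕ._+_ (≡.trans (length-map _ members) size) (length-cosets j))

        -- The integer i is a unit of F whose inverse is the image of the integer i^(N - 1), by
        -- Fermat. So i x in V would put x itself, a multiple of i x, into V.
        i·x∉ : ∀ i → 0 ℕ.< i → i ℕ.< p → ¬ (i · x ∈ members)
        i·x∉ i@(suc _) _ i<p ix∈ = x∉ (∈-resp (begin
          (i ℕ.^ N′) · (i · x)          ≈⟨ ×-assocˡ x (i ℕ.^ N′) i ⟩
          (i ℕ.^ N′ ℕ.* i) · x          ≈⟨ ×-congˡ (≡.trans (ℕ.*-comm (i ℕ.^ N′) i) (≡.cong (i ℕ.^_) (≡.sym N≡1+N′))) ⟩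
          (i ℕ.^ N) · x                 ≈⟨ ·≈·1* (i ℕ.^ N) x ⟩
          ((i ℕ.^ N) · 1#) * x          ≈⟨ *-congʳ (trans (·1-^ i N) (fermat i·1≉0)) ⟩
          1# * x                        ≈⟨ *-identityˡ x ⟩
          x                             ∎) (multiple∈ (i ℕ.^ N′) ix∈))
          where
          i·1≉0 : ¬ (i · 1# ≈ 0#)
          i·1≉0 e = ℕ.<⇒≱ i<p (ℕ.∣⇒≤ (char-∣ i e))
          N′ = ℕ.pred N
          N≡1+N′ = ≡.sym (ℕ.suc-pred N {{ℕ.>-nonZero N>0}})
          ·1-^ : ∀ i n → (i ℕ.^ n) · 1# ≈ (i · 1#) ^ n
          ·1-^ i zero    = +-identityʳ 1#
          ·1-^ i (suc n) = trans (×1-homo-* i (i ℕ.^ n)) (*-congˡ (·1-^ i n))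

        disjoint : ∀ {j v} → j ℕ.< p → v ∈ members → ¬ (j · x + v ∈ cosets j)
        disjoint {j} {v} j<p v∈ ∈c with i , v′ , i<j , v′∈ , e ← ∈-cosets⁻ j ∈c =
          i·x∉ (j ℕ.∸ i) (ℕ.m<n⇒0<n∸m i<j) (ℕ.≤-<-trans (ℕ.m∸n≤m j i) j<p)
            (∈-resp (sym ex≈) (sum∈ v′∈ (multiple∈ (ℕ.pred p) v∈)))
          where
          e≈ : (j ℕ.∸ i) · x + v ≈ v′
          e≈ = +-cancelˡ (i · x) _ _ (begin
            i · x + ((j ℕ.∸ i) · x + v)   ≈⟨ +-assoc _ _ _ ⟨
            (i · x + (j ℕ.∸ i) · x) + v   ≈⟨ +-congʳ (×-homo-+ x i (j ℕ.∸ i)) ⟨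
            (i ℕ.+ (j ℕ.∸ i)) · x + v     ≈⟨ +-congʳ (×-congˡ (ℕ.m+[n∸m]≡n (ℕ.<⇒≤ i<j))) ⟩
            j · x + v                     ≈⟨ e ⟩
            i · x + v′                    ∎)
          -- In characteristic p the multiple (p - 1) v serves as -v.
          v+v≈0 : v + ℕ.pred p · v ≈ 0#
          v+v≈0 = begin
            suc (ℕ.pred p) · v   ≈⟨ ×-congˡ (ℕ.suc-pred p {{prime⇒nonZero pr}}) ⟩
            p · v                ≈⟨ ·≈·1* p v ⟩
            (p · 1#) * v         ≈⟨ trans (*-congʳ p·1≈0) (zeroˡ v) ⟩
            0#                   ∎
          ex≈ : (j ℕ.∸ i) · x ≈ v′ + ℕ.pred p · v
          ex≈ = begin
            (j ℕ.∸ i) · x                             ≈⟨ +-identityʳ _ ⟨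
            (j ℕ.∸ i) · x + 0#                        ≈⟨ +-congˡ v+v≈0 ⟨
            (j ℕ.∸ i) · x + (v + ℕ.pred p · v)        ≈⟨ +-assoc _ _ _ ⟨
            ((j ℕ.∸ i) · x + v) + ℕ.pred p · v        ≈⟨ +-congʳ e≈ ⟩
            v′ + ℕ.pred p · v                         ∎

        cosets-distinct : ∀ j → j ℕ.≤ p → Distinct (cosets j)
        cosets-distinct zero    _   = []
        cosets-distinct (suc j) j<p = AllPairs.++⁺
          (AllPairs.map⁺ (AllPairs.map (λ n e → n (+-cancelˡ (j · x) _ _ e)) members!))
          (cosets-distinct j (ℕ.<⇒≤ j<p))
          (All.map⁺ (All.tabulateₛ setoid (λ v∈ → ∉⇒fresh (cosets j) (disjoint j<p v∈))))

      extend : Subgroup (suc k)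
      extend = record
        { members  = cosets p
        ; members! = cosets-distinct p ℕ.≤-refl
        ; size     = length-cosets p
        ; zero∈    = ∈-cosets⁺ p 0<p zero∈ (sym (+-identityʳ 0#))
        ; sum∈     = λ {y} {z} y∈ z∈ → sum-cosets (∈-cosets⁻ p y∈) (∈-cosets⁻ p z∈)
        }
        where
        instance _ = prime⇒nonZero pr
        sum-cosets : ∀ {y z} →
          (∃ λ i → ∃ λ v → i ℕ.< p × v ∈ members × y ≈ i · x + v) →
          (∃ λ i → ∃ λ v → i ℕ.< p × v ∈ members × z ≈ i · x + v) → y + z ∈ cosets p
        sum-cosets {y} {z} (i , v , _ , v∈ , ey) (j , w , _ , w∈ , ez) =
          ∈-cosets⁺ p (ℕ.m%n<n (i ℕ.+ j) p) (sum∈ v∈ w∈) (begin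
            y + z                              ≈⟨ +-cong ey ez ⟩
            (i · x + v) + (j · x + w)          ≈⟨ interchange _ _ _ _ ⟩
            (i · x + j · x) + (v + w)          ≈⟨ +-congʳ (×-homo-+ x i j) ⟨
            (i ℕ.+ j) · x + (v + w)            ≈⟨ +-congʳ (·-% (i ℕ.+ j) x) ⟨
            ((i ℕ.+ j) ℕ.% p) · x + (v + w)    ∎)

    distinct-length≤ : ∀ xs → Distinct xs → length xs ℕ.≤ q
    distinct-length≤ xs dx = ℕ.≤-trans (ℕ.≤-reflexive
      (length-unique setoid xs (filter ∈xs? elems) dx (AllPairs.filter⁺ ∈xs? distinct)
        (λ z z∈ → ∈-filter⁺ setoid ∈xs? ∈-resp (complete z) z∈)
        (λ z z∈ → proj₂ (∈-filter⁻ setoid ∈xs? ∈-resp {xs = elems} z∈)))) (length-filter ∈xs? elems)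
      where
      ∈xs? : ∀ z → Dec (z ∈ xs)
      ∈xs? z = Any.any? (z ≟_) xs

    -- A subgroup that misses an element is extended by it. Since k < p^k and p^k is at most q, the
    -- chain cannot reach k = q, so q is enough fuel.
    prime-power : ∃ λ m → q ≡ p ℕ.^ m
    prime-power = grow q 0 trivial (ℕ.≤-reflexive (≡.sym (ℕ.+-identityʳ q)))
      where
      trivial : Subgroup 0
      trivial = record
        { members = 0# ∷ [] ; members! = [] ∷ [] ; size = ≡.refl ; zero∈ = here refl
        ; sum∈ = λ { (here a) (here b) → here (trans (+-cong a b) (+-identityʳ 0#)) } }
      grow : ∀ fuel k → Subgroup k → q ℕ.≤ fuel ℕ.+ k → ∃ λ m → q ≡ p ℕ.^ m
      grow fuel k V b with All.all? (λ z → Any.any? (z ≟_) (Subgroup.members V)) elems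
      ... | yes all = k , ≡.trans (length-unique setoid elems members distinct members!
                            (λ z z∈ → ∈-lookup ∈-resp all z∈) (λ z _ → complete z)) size
        where open Subgroup V
      grow zero k V b | no _ = ⊥-elim (ℕ.<⇒≱ (n<m^n 1<p k)
        (ℕ.≤-trans (ℕ.≤-reflexive (≡.sym size)) (ℕ.≤-trans (distinct-length≤ members members!) b)))
        where open Subgroup V
      grow (suc fuel) k V b | no ¬all =
        grow fuel (suc k) (extend V (Any.lookup-result (All.¬All⇒Any¬ (λ z → Any.any? (z ≟_) (Subgroup.members V)) elems ¬all)))
          (ℕ.≤-trans b (ℕ.≤-reflexive (≡.sym (ℕ.+-suc fuel k))))

-- Torsion-free rings over F with a lift of Frobenius

record Lifting {c ℓ : Level} (F : CommutativeRing c ℓ) (p : ℕ) : Set (Level.suc (c ⊔ ℓ)) where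
  private module F = CommutativeRing F
  field
    A : CommutativeRing c (c ⊔ ℓ)
  open RingFacts A
  field
    [_]          : F.Carrier → Carrier
    []-cong      : ∀ {x y} → x F.≈ y → [ x ] ≈ [ y ]
    []-*         : ∀ x y → [ x F.* y ] ≈ [ x ] * [ y ]
    []-1         : [ F.1# ] ≈ 1#
    ε            : Carrier → F.Carrier
    ε-cong       : ∀ {a b} → a ≈ b → ε a F.≈ ε b
    ε-+          : ∀ a b → ε (a + b) F.≈ ε a F.+ ε b
    ε-*          : ∀ a b → ε (a * b) F.≈ ε a F.* ε b
    ε-neg        : ∀ a → ε (- a) F.≈ F.- ε a
    ε-[]         : ∀ x → ε [ x ] F.≈ x
    φ            : Carrier → Carrier
    φ-cong       : ∀ {a b} → a ≈ b → φ a ≈ φ b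
    φ-+          : ∀ a b → φ (a + b) ≈ φ a + φ b
    φ-*          : ∀ a b → φ (a * b) ≈ φ a * φ b
    φ-1          : φ 1# ≈ 1#
    -- This field and `torsion-free` together turn the membership of an integer in a power of the
    -- kernel of `ε` into divisibility by a power of p.
    frobenius    : ∀ a → ∃ λ b → φ a ≈ a ^ p + p · b
    torsion-free : ∀ n {a b} → suc n · a ≈ suc n · b → a ≈ b

-- The ring ℤ[F] as a lifting

module MonoidRing {c ℓ : Level} (F : CommutativeRing c ℓ) (isField : IsField F) (fin : IsFinite F) where
  private
    module F = FieldFacts F isField fin
    module Z = RingFacts ℤ.+-*-commutativeRing

  open import Data.Integer using (+_; -[1+_]; _⊖_)

  -- Formal sums of basis elements with signs; a coefficient is expressed by repetition. The basis
  -- element [0] is not the zero of the ring.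
  Elt : Set c
  Elt = List (Sign × F.Carrier)

  private
    sg : Sign → ℤ → ℤ
    sg Sign.+ n = n
    sg Sign.- n = ℤ.- n

    sg-0 : ∀ s → sg s ℤ.0ℤ ≡ ℤ.0ℤ
    sg-0 Sign.+ = ≡.refl
    sg-0 Sign.- = ≡.refl

    sg-+ : ∀ s m n → sg s (m ℤ.+ n) ≡ sg s m ℤ.+ sg s n
    sg-+ Sign.+ m n = ≡.refl
    sg-+ Sign.- m n = ℤ.neg-distrib-+ m n

    sg-neg : ∀ s n → sg (Sign.opposite s) n ≡ ℤ.- sg s n
    sg-neg Sign.+ n = ≡.refl
    sg-neg Sign.- n = ≡.sym (ℤ.neg-involutive n)

    sg-* : ∀ s t n → sg (s Sign.* t) n ≡ sg s (sg t n)
    sg-* Sign.+ t n = ≡.refl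
    sg-* Sign.- t n = sg-neg t n

    sg-∑ : ∀ {a} {X : Set a} s (xs : List X) (h : X → ℤ) → sg s (Z.∑ xs h) ≡ Z.∑ xs (λ x → sg s (h x))
    sg-∑ s []       h = sg-0 s
    sg-∑ s (x ∷ xs) h = ≡.trans (sg-+ s (h x) _) (≡.cong (ℤ._+_ (sg s (h x))) (sg-∑ s xs h))

    Cong : (F.Carrier → ℤ) → Set (c ⊔ ℓ)
    Cong f = ∀ {x y} → x F.≈ y → f x ≡ f y

  ⟦_⟧ : Elt → (F.Carrier → ℤ) → ℤ
  ⟦ a ⟧ f = Z.∑ a (λ (s , x) → sg s (f x))

  -- Two formal sums are equal when the linear extensions of all functions F → ℤ agree on them,
  -- which needs no normal form. The functional of a product is an iterated functional, so the ring
  -- laws become laws of finite sums: commutativity, for one, is an exchange of summations.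
  record _≈_ (a b : Elt) : Set (c ⊔ ℓ) where
    constructor mk
    field at : ∀ f → Cong f → ⟦ a ⟧ f ≡ ⟦ b ⟧ f
  open _≈_

  private
    _+_ _*_ : Elt → Elt → Elt
    a + b = a ++ b
    a * b = concatMap (λ (s , x) → map (λ (t , y) → s Sign.* t , x F.* y) b) a

    -_ : Elt → Elt
    -_ = map (λ (s , x) → Sign.opposite s , x)

    ⟦⟧-ext : ∀ a {f g} → (∀ x → f x ≡ g x) → ⟦ a ⟧ f ≡ ⟦ a ⟧ g
    ⟦⟧-ext a e = Z.∑-cong a (λ (s , x) → ≡.cong (sg s) (e x))

    ⟦+⟧ : ∀ a b f → ⟦ a + b ⟧ f ≡ ⟦ a ⟧ f ℤ.+ ⟦ b ⟧ f
    ⟦+⟧ a b f = Z.∑-++ a b _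

    ⟦-⟧ : ∀ a f → ⟦ - a ⟧ f ≡ ℤ.- ⟦ a ⟧ f
    ⟦-⟧ []            f = ≡.refl
    ⟦-⟧ ((s , x) ∷ a) f = ≡.trans (≡.cong₂ ℤ._+_ (sg-neg s (f x)) (⟦-⟧ a f)) (≡.sym (ℤ.neg-distrib-+ (sg s (f x)) _))

    ⟦*⟧ : ∀ a b f → ⟦ a * b ⟧ f ≡ ⟦ a ⟧ (λ x → ⟦ b ⟧ (λ y → f (x F.* y)))
    ⟦*⟧ a b f = ≡.trans (Z.∑-concatMap _ a _) (Z.∑-cong a (λ (s , x) →
      ≡.trans (Z.∑-map _ b _) (≡.trans (Z.∑-cong b (λ (t , y) → sg-* s t _)) (≡.sym (sg-∑ s b _)))))

    ⟦⟧-swap : ∀ a b (h : F.Carrier → F.Carrier → ℤ) →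
              ⟦ a ⟧ (λ x → ⟦ b ⟧ (λ y → h x y)) ≡ ⟦ b ⟧ (λ y → ⟦ a ⟧ (λ x → h x y))
    ⟦⟧-swap a b h = ≡.trans (Z.∑-cong a (λ (s , x) → sg-∑ s b _)) (≡.trans (Z.∑-swap a b _)
      (Z.∑-cong b (λ (t , y) → ≡.trans (Z.∑-cong a (λ (s , x) → sg-comm s t _)) (≡.sym (sg-∑ t a _)))))
      where
      sg-comm : ∀ s t n → sg s (sg t n) ≡ sg t (sg s n)
      sg-comm Sign.+ t      n = ≡.refl
      sg-comm Sign.- Sign.+ n = ≡.refl
      sg-comm Sign.- Sign.- n = ≡.refl

    ⟦⟧-+ : ∀ a f g → ⟦ a ⟧ (λ x → f x ℤ.+ g x) ≡ ⟦ a ⟧ f ℤ.+ ⟦ a ⟧ g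
    ⟦⟧-+ a f g = ≡.trans (Z.∑-cong a (λ (s , x) → sg-+ s (f x) (g x))) (Z.R+.∑-∙ a _ _)

    ⟦⟧-cong₂ : ∀ b {f} → Cong f → Cong (λ x → ⟦ b ⟧ (λ y → f (x F.* y)))
    ⟦⟧-cong₂ b fc e = ⟦⟧-ext b (λ y → fc (F.*-congʳ e))

    1A : Elt
    1A = (Sign.+ , F.1#) ∷ []

    +-cong′ : ∀ {a a′ b b′} → a ≈ a′ → b ≈ b′ → (a + b) ≈ (a′ + b′)
    +-cong′ {a} {a′} {b} {b′} e e′ .at f fc =
      ≡.trans (⟦+⟧ a b f) (≡.trans (≡.cong₂ ℤ._+_ (e .at f fc) (e′ .at f fc)) (≡.sym (⟦+⟧ a′ b′ f)))

    *-cong′ : ∀ {a a′ b b′} → a ≈ a′ → b ≈ b′ → (a * b) ≈ (a′ * b′)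
    *-cong′ {a} {a′} {b} {b′} e e′ .at f fc = ≡.trans (⟦*⟧ a b f) (≡.trans
      (⟦⟧-ext a (λ x → e′ .at (λ y → f (x F.* y)) (λ y≈z → fc (F.*-congˡ y≈z))))
      (≡.trans (e .at _ (⟦⟧-cong₂ b′ fc)) (≡.sym (⟦*⟧ a′ b′ f))))

    *-comm′ : ∀ a b → (a * b) ≈ (b * a)
    *-comm′ a b .at f fc = ≡.trans (⟦*⟧ a b f) (≡.trans (⟦⟧-swap a b _)
      (≡.trans (⟦⟧-ext b (λ y → ⟦⟧-ext a (λ x → fc (F.*-comm x y)))) (≡.sym (⟦*⟧ b a f))))

    *-assoc′ : ∀ a b d → ((a * b) * d) ≈ (a * (b * d))
    *-assoc′ a b d .at f fc = ≡.trans (⟦*⟧ (a * b) d f) (≡.trans (⟦*⟧ a b _) (≡.trans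
      (⟦⟧-ext a (λ x → ≡.trans (⟦⟧-ext b (λ y → ⟦⟧-ext d (λ z → fc (F.*-assoc x y z)))) (≡.sym (⟦*⟧ b d _))))
      (≡.sym (⟦*⟧ a (b * d) f))))

    *-identityˡ′ : ∀ a → (1A * a) ≈ a
    *-identityˡ′ a .at f fc = ≡.trans (⟦*⟧ 1A a f) (≡.trans (ℤ.+-identityʳ _) (⟦⟧-ext a (λ x → fc (F.*-identityˡ x))))

    distribˡ′ : ∀ a b d → (a * (b + d)) ≈ ((a * b) + (a * d))
    distribˡ′ a b d .at f fc = ≡.trans (⟦*⟧ a (b + d) f) (≡.trans (⟦⟧-ext a (λ x → ⟦+⟧ b d _))
      (≡.trans (⟦⟧-+ a _ _) (≡.trans (≡.sym (≡.cong₂ ℤ._+_ (⟦*⟧ a b f) (⟦*⟧ a d f))) (≡.sym (⟦+⟧ (a * b) (a * d) f)))))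

    ≈-trans : ∀ {a b d} → a ≈ b → b ≈ d → a ≈ d
    ≈-trans e e′ .at f fc = ≡.trans (e .at f fc) (e′ .at f fc)

    +-comm′ : ∀ a b → (a + b) ≈ (b + a)
    +-comm′ a b .at f fc = ≡.trans (⟦+⟧ a b f) (≡.trans (ℤ.+-comm (⟦ a ⟧ f) _) (≡.sym (⟦+⟧ b a f)))

    inverseˡ′ : ∀ a → ((- a) + a) ≈ []
    inverseˡ′ a .at f fc = ≡.trans (⟦+⟧ (- a) a f) (≡.trans (≡.cong (ℤ._+ ⟦ a ⟧ f) (⟦-⟧ a f)) (ℤ.+-inverseˡ (⟦ a ⟧ f)))

  ring : CommutativeRing c (c ⊔ ℓ)
  ring = record
    { Carrier = Elt ; _≈_ = _≈_ ; _+_ = _+_ ; _*_ = _*_ ; -_ = -_ ; 0# = [] ; 1# = 1A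
    ; isCommutativeRing = record
      { isRing = record
        { +-isAbelianGroup = record
          { isGroup = record
            { isMonoid = record
              { isSemigroup = record
                { isMagma = record
                  { isEquivalence = record
                    { refl = mk (λ f fc → ≡.refl)
                    ; sym = λ e → mk (λ f fc → ≡.sym (e .at f fc))
                    ; trans = ≈-trans }
                  ; ∙-cong = +-cong′ }
                ; assoc = λ a b d → mk (λ f fc → ≡.cong (λ l → ⟦ l ⟧ f) (++-assoc a b d)) }
              ; identity = (λ a → mk (λ f fc → ≡.refl)) , (λ a → +-comm′ a []) }
            ; inverse = inverseˡ′ , (λ a → ≈-trans (+-comm′ a (- a)) (inverseˡ′ a))
            ; ⁻¹-cong = λ {a} {b} e → mk (λ f fc → ≡.trans (⟦-⟧ a f) (≡.trans (≡.cong ℤ.-_ (e .at f fc)) (≡.sym (⟦-⟧ b f)))) }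
          ; comm = +-comm′ }
        ; *-cong = *-cong′
        ; *-assoc = *-assoc′
        ; *-identity = *-identityˡ′ , (λ a → ≈-trans (*-comm′ a 1A) (*-identityˡ′ a))
        ; distrib = distribˡ′ , (λ a b d → ≈-trans (*-comm′ (b + d) a)
                      (≈-trans (distribˡ′ a b d) (+-cong′ (*-comm′ a b) (*-comm′ a d)))) }
      ; *-comm = *-comm′ } }

  private module A = RingFacts ring

  [_] : F.Carrier → Elt
  [ x ] = (Sign.+ , x) ∷ []

  []-cong : ∀ {x y} → x F.≈ y → [ x ] ≈ [ y ]
  []-cong e .at f fc = ≡.cong (ℤ._+ ℤ.0ℤ) (fc e)

  []-* : ∀ x y → [ x F.* y ] ≈ ([ x ] * [ y ])
  []-* x y = A.refl

  torsion-free : ∀ n {a b} → (suc n A.· a) ≈ (suc n A.· b) → a ≈ b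
  torsion-free n {a} {b} e .at f fc = ℤ.*-cancelˡ-≡ (+ suc n) (⟦ a ⟧ f) (⟦ b ⟧ f)
    (≡.trans (≡.sym (⟦·⟧ (suc n) a)) (≡.trans (e .at f fc) (⟦·⟧ (suc n) b)))
    where
    ⟦·⟧ : ∀ k a → ⟦ k A.· a ⟧ f ≡ + k ℤ.* ⟦ a ⟧ f
    ⟦·⟧ zero    a = ≡.sym (ℤ.*-zeroˡ (⟦ a ⟧ f))
    ⟦·⟧ (suc k) a = ≡.trans (⟦+⟧ a (k A.· a) f) (≡.trans (≡.cong (ℤ._+_ (⟦ a ⟧ f)) (⟦·⟧ k a)) (≡.sym (ℤ.suc-* (+ k) (⟦ a ⟧ f))))

  private
    sgF : Sign → F.Carrier → F.Carrier
    sgF Sign.+ x = x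
    sgF Sign.- x = F.- x

    sgF-0 : ∀ s → sgF s F.0# F.≈ F.0#
    sgF-0 Sign.+ = F.refl
    sgF-0 Sign.- = F.-0#≈0#

    sgF-+ : ∀ s x y → sgF s (x F.+ y) F.≈ sgF s x F.+ sgF s y
    sgF-+ Sign.+ x y = F.refl
    sgF-+ Sign.- x y = F.sym (F.-‿+-comm x y)

    sgF-* : ∀ s t x y → sgF (s Sign.* t) (x F.* y) F.≈ sgF s x F.* sgF t y
    sgF-* Sign.+ Sign.+ x y = F.refl
    sgF-* Sign.+ Sign.- x y = F.-‿distribʳ-* x y
    sgF-* Sign.- Sign.+ x y = F.-‿distribˡ-* x y
    sgF-* Sign.- Sign.- x y = F.trans (F.sym (F.-‿involutive (x F.* y))) (F.trans (F.-‿cong (F.-‿distribˡ-* x y)) (F.-‿distribʳ-* (F.- x) y))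

    sgF-cong : ∀ s {x y} → x F.≈ y → sgF s x F.≈ sgF s y
    sgF-cong Sign.+ e = e
    sgF-cong Sign.- e = F.-‿cong e

    sgF-∑ : ∀ {a} {X : Set a} s (xs : List X) (h : X → F.Carrier) → sgF s (F.∑ xs h) F.≈ F.∑ xs (λ x → sgF s (h x))
    sgF-∑ s []       h = sgF-0 s
    sgF-∑ s (x ∷ xs) h = F.trans (sgF-+ s (h x) _) (F.+-congˡ (sgF-∑ s xs h))

  ε : Elt → F.Carrier
  ε a = F.∑ a (λ (s , x) → sgF s x)

  ε-+ : ∀ a b → ε (a + b) F.≈ ε a F.+ ε b
  ε-+ a b = F.∑-++ a b _

  ε-neg : ∀ a → ε (- a) F.≈ F.- ε a
  ε-neg []            = F.sym F.-0#≈0#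
  ε-neg ((s , x) ∷ a) = F.trans (F.+-cong (sgF-opp s) (ε-neg a)) (F.-‿+-comm _ _)
    where
    sgF-opp : ∀ s → sgF (Sign.opposite s) x F.≈ F.- sgF s x
    sgF-opp Sign.+ = F.refl
    sgF-opp Sign.- = F.sym (F.-‿involutive x)

  ε-* : ∀ a b → ε (a * b) F.≈ ε a F.* ε b
  ε-* a b = F.trans (F.∑-concatMap _ a _) (F.trans
    (F.∑-cong a (λ (s , x) → F.trans (F.reflexive (F.∑-map _ b _))
      (F.trans (F.∑-cong b (λ (t , y) → sgF-* s t x y)) (F.trans (F.sym (F.*-distribˡ-∑ b _ _)) (F.*-comm _ _)))))
    (F.trans (F.sym (F.*-distribˡ-∑ a _ _)) (F.*-comm _ _)))

  ε-[] : ∀ x → ε [ x ] F.≈ x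
  ε-[] x = F.+-identityʳ x

  private
    ι : ℤ → F.Carrier
    ι (+ n)    = n F.· F.1#
    ι -[1+ n ] = F.- (suc n F.· F.1#)

    ι-⊖ : ∀ m n → ι (m ⊖ n) F.≈ m F.· F.1# F.- n F.· F.1#
    ι-⊖ m       zero    = F.sym (F.trans (F.+-congˡ F.-0#≈0#) (F.+-identityʳ _))
    ι-⊖ zero    (suc n) = F.sym (F.+-identityˡ _)
    ι-⊖ (suc m) (suc n) = F.trans (F.reflexive (≡.cong ι (ℤ.[1+m]⊖[1+n]≡m⊖n m n))) (F.trans (ι-⊖ m n) (F.sym (
      F.trans (F.+-congˡ (F.sym (F.-‿+-comm _ _))) (F.trans (F.interchange _ _ _ _)
        (F.trans (F.+-congʳ (F.-‿inverseʳ _)) (F.+-identityˡ _))))))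

    ι-+ : ∀ m n → ι (m ℤ.+ n) F.≈ ι m F.+ ι n
    ι-+ (+ m)    (+ n)    = F.×-homo-+ F.1# m n
    ι-+ (+ m)    -[1+ n ] = ι-⊖ m (suc n)
    ι-+ -[1+ m ] (+ n)    = F.trans (ι-⊖ n (suc m)) (F.+-comm _ _)
    ι-+ -[1+ m ] -[1+ n ] = F.trans (F.-‿cong (F.trans (F.×-congˡ (≡.cong suc (≡.sym (ℕ.+-suc m n)))) (F.×-homo-+ F.1# (suc m) (suc n))))
      (F.sym (F.-‿+-comm _ _))

    ι-neg : ∀ n → ι (ℤ.- n) F.≈ F.- ι n
    ι-neg (+ zero)  = F.sym F.-0#≈0#
    ι-neg (+ suc n) = F.refl
    ι-neg -[1+ n ]  = F.sym (F.-‿involutive _)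

    ι-sg : ∀ s n → ι (sg s n) F.≈ sgF s (ι n)
    ι-sg Sign.+ n = F.refl
    ι-sg Sign.- n = ι-neg n

    sgF-*ˡ : ∀ s x y → sgF s x F.* y F.≈ sgF s (x F.* y)
    sgF-*ˡ Sign.+ x y = F.refl
    sgF-*ˡ Sign.- x y = F.sym (F.-‿distribˡ-* x y)

    indicator : F.Carrier → F.Carrier → ℤ
    indicator y x = if does (x F.≟ y) then ℤ.1ℤ else ℤ.0ℤ

    indicator-cong : ∀ y → Cong (indicator y)
    indicator-cong y {x} {x′} e with x F.≟ y | x′ F.≟ y
    ... | yes _ | yes _ = ≡.refl
    ... | no  _ | no  _ = ≡.refl
    ... | yes a | no  b = ⊥-elim (b (F.trans (F.sym e) a))
    ... | no  a | yes b = ⊥-elim (a (F.trans e b))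

    term-≈ : ∀ x y → x F.≈ y → ι (indicator y x) F.* y F.≈ x
    term-≈ x y e with x F.≟ y
    ... | yes _ = F.trans (F.*-congʳ (F.+-identityʳ _)) (F.trans (F.*-identityˡ y) (F.sym e))
    ... | no  n = ⊥-elim (n e)

    term-≉ : ∀ x y → ¬ (x F.≈ y) → ι (indicator y x) F.* y F.≈ F.0#
    term-≉ x y n with x F.≟ y
    ... | yes e = ⊥-elim (n e)
    ... | no  _ = F.zeroˡ y

    pick : ∀ {xs} x → F.Distinct xs → x F.∈ xs → F.∑ xs (λ y → ι (indicator y x) F.* y) F.≈ x
    pick {y ∷ ys} x (f ∷ _) (here x≈y) = F.trans (F.+-cong (term-≈ x y x≈y) (F.trans
      (F.∑-congAll f (λ z y≉z → term-≉ x z (λ x≈z → y≉z (F.trans (F.sym x≈y) x≈z)))) (F.∑-ε ys))) (F.+-identityʳ x)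
    pick {y ∷ ys} x (f ∷ d) (there x∈) = F.trans (F.+-cong (term-≉ x y (F.fresh⇒≉ f x∈)) (pick x d x∈)) (F.+-identityˡ x)

    -- `ε` is computed from a list, and it has to be shown to depend on the formal sum only. The
    -- functional of the indicator of y yields the coefficient of [y]; this expresses `ε` through
    -- functionals, which respect equality by definition.
    ε-coefficients : ∀ a → ε a F.≈ F.∑ F.elems (λ y → ι (⟦ a ⟧ (indicator y)) F.* y)
    ε-coefficients [] = F.sym (F.trans (F.∑-cong F.elems (λ y → F.zeroˡ y)) (F.∑-ε F.elems))
    ε-coefficients ((s , x) ∷ a) = F.sym (begin
      F.∑ F.elems (λ y → ι (sg s (indicator y x) ℤ.+ ⟦ a ⟧ (indicator y)) F.* y)
        ≈⟨ F.∑-cong F.elems (λ y → F.trans (F.*-congʳ (F.trans (ι-+ (sg s (indicator y x)) _) (F.+-congʳ (ι-sg s (indicator y x)))))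
             (F.trans (F.distribʳ _ _ _) (F.+-congʳ (sgF-*ˡ s _ y)))) ⟩
      F.∑ F.elems (λ y → sgF s (ι (indicator y x) F.* y) F.+ ι (⟦ a ⟧ (indicator y)) F.* y)
        ≈⟨ F.R+.∑-∙ F.elems _ _ ⟩
      F.∑ F.elems (λ y → sgF s (ι (indicator y x) F.* y)) F.+ F.∑ F.elems (λ y → ι (⟦ a ⟧ (indicator y)) F.* y)
        ≈⟨ F.+-cong (F.trans (F.sym (sgF-∑ s F.elems _)) (sgF-cong s (pick x F.distinct (F.complete x)))) (F.sym (ε-coefficients a)) ⟩
      sgF s x F.+ ε a ∎)
      where open import Relation.Binary.Reasoning.Setoid F.setoid

  ε-cong : ∀ {a b} → a ≈ b → ε a F.≈ ε b
  ε-cong {a} {b} e = F.trans (ε-coefficients a) (F.trans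
    (F.∑-cong F.elems (λ y → F.*-congʳ (F.reflexive (≡.cong ι (e .at (indicator y) (indicator-cong y))))))
    (F.sym (ε-coefficients b)))

  module Frobenius (p : ℕ) where
    φ : Elt → Elt
    φ = map (λ (s , x) → s , x F.^ p)

    private
      ⟦φ⟧ : ∀ a f → ⟦ φ a ⟧ f ≡ ⟦ a ⟧ (λ x → f (x F.^ p))
      ⟦φ⟧ a f = Z.∑-map _ a _

    φ-cong : ∀ {a b} → a ≈ b → φ a ≈ φ b
    φ-cong {a} {b} e .at f fc = ≡.trans (⟦φ⟧ a f) (≡.trans (e .at _ (λ x≈y → fc (F.^-congˡ p x≈y))) (≡.sym (⟦φ⟧ b f)))

    φ-+ : ∀ a b → φ (a + b) ≈ (φ a + φ b)
    φ-+ a b = A.reflexive (map-++ _ a b)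

    φ-neg : ∀ a → φ (- a) ≈ (- φ a)
    φ-neg a .at f fc = ≡.trans (⟦φ⟧ (- a) f) (≡.trans (⟦-⟧ a _) (≡.trans (≡.cong ℤ.-_ (≡.sym (⟦φ⟧ a f))) (≡.sym (⟦-⟧ (φ a) f))))

    φ-* : ∀ a b → φ (a * b) ≈ (φ a * φ b)
    φ-* a b .at f fc = ≡.trans (⟦φ⟧ (a * b) f) (≡.trans (⟦*⟧ a b _) (≡.trans
      (⟦⟧-ext a (λ x → ≡.trans (⟦⟧-ext b (λ y → fc (F.^-distrib-* x y p))) (≡.sym (⟦φ⟧ b _))))
      (≡.trans (≡.sym (⟦φ⟧ a _)) (≡.sym (⟦*⟧ (φ a) (φ b) f)))))

    φ-1 : φ 1A ≈ 1A
    φ-1 = []-cong (F.1^n≈1 p)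

    φ-[] : ∀ x → φ [ x ] ≈ ([ x ] A.^ p)
    φ-[] x = go p
      where
      go : ∀ n → [ x F.^ n ] ≈ ([ x ] A.^ n)
      go zero    = A.refl
      go (suc n) = A.trans ([]-* x (x F.^ n)) (*-cong′ {[ x ]} {[ x ]} A.refl (go n))

  lifting : ∀ {n} → Prime (suc n) → Lifting F (suc n)
  lifting {n} pr = record
    { A = ring ; [_] = [_] ; []-cong = []-cong ; []-* = []-* ; []-1 = A.refl
    ; ε = ε ; ε-cong = ε-cong ; ε-+ = ε-+ ; ε-* = ε-* ; ε-neg = ε-neg ; ε-[] = ε-[]
    ; φ = φ ; φ-cong = φ-cong ; φ-+ = φ-+ ; φ-* = φ-* ; φ-1 = φ-1
    ; frobenius = frobenius ; torsion-free = torsion-free }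
    where
    open Frobenius (suc n)
    open import Relation.Binary.Reasoning.Setoid A.setoid

    p = suc n

    Frob : Elt → Set (c ⊔ ℓ)
    Frob a = ∃ λ b → φ a ≈ ((a A.^ p) A.+ p A.· b)

    frob-[] : ∀ x → Frob [ x ]
    frob-[] x = [] , A.trans (φ-[] x) (A.sym (A.trans (A.+-congˡ {[ x ] A.^ p} (A.·-zeroʳ p)) (A.+-identityʳ ([ x ] A.^ p))))

    -- Expanding 0 = (a + (-a))^p gives -a^p = (-a)^p up to a multiple of p. This avoids the sign of
    -- (-1)^p, which is different for p = 2.
    frob-neg : ∀ a → Frob a → Frob (A.- a)
    frob-neg a (b , e) = m A.- b , (begin
      φ (A.- a)                                     ≈⟨ φ-neg a ⟩
      A.- φ a                                       ≈⟨ A.-‿cong e ⟩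
      A.- (a A.^ p A.+ p A.· b)                     ≈⟨ A.-‿+-comm (a A.^ p) (p A.· b) ⟨
      A.- (a A.^ p) A.+ A.- (p A.· b)               ≈⟨ A.+-congʳ { A.- (p A.· b)} -a^p≈ ⟩
      ((A.- a) A.^ p A.+ p A.· m) A.+ A.- (p A.· b) ≈⟨ A.+-assoc ((A.- a) A.^ p) (p A.· m) (A.- (p A.· b)) ⟩
      (A.- a) A.^ p A.+ (p A.· m A.+ A.- (p A.· b)) ≈⟨ A.+-congˡ {(A.- a) A.^ p} (A.·-distrib-minus p m b) ⟨
      (A.- a) A.^ p A.+ p A.· (m A.- b)             ∎)
      where
      m = A.middle pr a (A.- a)
      -a^p≈ : A.- (a A.^ p) A.≈ ((A.- a) A.^ p) A.+ p A.· m
      -a^p≈ = A.+-cancelˡ (a A.^ p) (A.- (a A.^ p)) (((A.- a) A.^ p) A.+ p A.· m) (begin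
        a A.^ p A.+ A.- (a A.^ p)                   ≈⟨ A.-‿inverseʳ (a A.^ p) ⟩
        A.0#                                        ≈⟨ A.zeroˡ (A.0# A.^ n) ⟨
        A.0# A.^ p                                  ≈⟨ A.^-congˡ p (A.-‿inverseʳ a) ⟨
        (a A.+ A.- a) A.^ p                         ≈⟨ A.freshman pr a (A.- a) ⟩
        (a A.^ p A.+ (A.- a) A.^ p) A.+ p A.· m     ≈⟨ A.+-assoc (a A.^ p) ((A.- a) A.^ p) (p A.· m) ⟩
        a A.^ p A.+ ((A.- a) A.^ p A.+ p A.· m)     ∎)

    frob-+ : ∀ a b → Frob a → Frob b → Frob (a A.+ b)
    frob-+ a b (a′ , ea) (b′ , eb) = (a′ A.+ b′) A.- m , (begin
      φ (a A.+ b)                                           ≈⟨ φ-+ a b ⟩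
      φ a A.+ φ b                                           ≈⟨ A.+-cong ea eb ⟩
      (a A.^ p A.+ p A.· a′) A.+ (b A.^ p A.+ p A.· b′)     ≈⟨ A.interchange (a A.^ p) (p A.· a′) (b A.^ p) (p A.· b′) ⟩
      X A.+ (p A.· a′ A.+ p A.· b′)                         ≈⟨ A.+-congˡ {X} (A.·-distrib-+ a′ b′ p) ⟨
      X A.+ p A.· (a′ A.+ b′)                               ≈⟨ A.+-congˡ {X} (A.a+[x-a]≈x (p A.· m) (p A.· (a′ A.+ b′))) ⟨
      X A.+ (p A.· m A.+ (p A.· (a′ A.+ b′) A.- p A.· m))   ≈⟨ A.+-assoc X (p A.· m) (p A.· (a′ A.+ b′) A.- p A.· m) ⟨
      (X A.+ p A.· m) A.+ (p A.· (a′ A.+ b′) A.- p A.· m)   ≈⟨ A.+-cong (A.freshman pr a b) (A.·-distrib-minus p (a′ A.+ b′) m) ⟨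
      (a A.+ b) A.^ p A.+ p A.· ((a′ A.+ b′) A.- m)         ∎)
      where
      m = A.middle pr a b
      X = (a A.^ p) A.+ (b A.^ p)

    frobenius : ∀ a → Frob a
    frobenius []                 = [] , A.sym (A.trans (A.+-cong (A.zeroˡ (A.0# A.^ n)) (A.·-zeroʳ p)) (A.+-identityˡ []))
    frobenius ((Sign.+ , x) ∷ a) = frob-+ [ x ] a (frob-[] x) (frobenius a)
    frobenius ((Sign.- , x) ∷ a) = frob-+ (A.- [ x ]) a (frob-neg [ x ] (frob-[] x)) (frobenius a)

-- Powers of the kernel I of `ε`

module Filtration {c ℓ : Level} (F : CommutativeRing c ℓ) (isField : IsField F) (fin : IsFinite F)
                  {n : ℕ} (pr : Prime (suc n))
                  (p·1≈0 : CommutativeRing._≈_ F (RingFacts._·_ F (suc n) (CommutativeRing.1# F)) (CommutativeRing.0# F))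
                  (L : Lifting F (suc n)) where
  private module F = FieldFacts F isField fin
  open Lifting L public
  open RingFacts A public
  open import Relation.Binary.Reasoning.Setoid setoid

  p : ℕ
  p = suc n

  -- `Pow k` is the ideal Iᵏ, presented by generators: sums of products with k factors from I.
  data Pow : ℕ → Carrier → Set (c ⊔ ℓ) where
    base : ∀ {a} → Pow 0 a
    mult : ∀ {k a b} → ε a F.≈ F.0# → Pow k b → Pow (suc k) (a * b)
    add  : ∀ {k a b} → Pow k a → Pow k b → Pow k (a + b)
    resp : ∀ {k a b} → a ≈ b → Pow k a → Pow k b

  ε-1 : ε 1# F.≈ F.1#
  ε-1 = F.trans (ε-cong (sym []-1)) (ε-[] F.1#)

  ε-0 : ε 0# F.≈ F.0#
  ε-0 = F.+-cancelˡ (ε 0#) _ _ (F.trans (F.sym (ε-+ 0# 0#)) (F.trans (ε-cong (+-identityʳ 0#)) (F.sym (F.+-identityʳ _))))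

  ε-· : ∀ k a → ε (k · a) F.≈ k F.· ε a
  ε-· zero    a = ε-0
  ε-· (suc k) a = F.trans (ε-+ a (k · a)) (F.+-congˡ (ε-· k a))

  ε-^ : ∀ a k → ε (a ^ k) F.≈ ε a F.^ k
  ε-^ a zero    = ε-1
  ε-^ a (suc k) = F.trans (ε-* a (a ^ k)) (F.*-congˡ (ε-^ a k))

  Pow-0 : ∀ k → Pow k 0#
  Pow-0 zero    = base
  Pow-0 (suc k) = resp (zeroˡ 0#) (mult ε-0 (Pow-0 k))

  Pow-1 : ∀ {a} → ε a F.≈ F.0# → Pow 1 a
  Pow-1 e = resp (*-identityʳ _) (mult e base)

  Pow-scale : ∀ {k} a {b} → Pow k b → Pow k (a * b)
  Pow-scale a base       = base
  Pow-scale a (mult {a = x} {b = y} e b) = resp (begin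
    x * (a * y) ≈⟨ *-assoc x a y ⟨
    (x * a) * y ≈⟨ *-congʳ (*-comm x a) ⟩
    (a * x) * y ≈⟨ *-assoc a x y ⟩
    a * (x * y) ∎) (mult e (Pow-scale a b))
  Pow-scale a (add b b′) = resp (sym (distribˡ _ _ _)) (add (Pow-scale a b) (Pow-scale a b′))
  Pow-scale a (resp e b) = resp (*-congˡ e) (Pow-scale a b)

  Pow-neg : ∀ {k a} → Pow k a → Pow k (- a)
  Pow-neg {a = a} b = resp (trans (sym (-‿distribˡ-* 1# a)) (-‿cong (*-identityˡ a))) (Pow-scale (- 1#) b)

  Pow-pred : ∀ {k a} → Pow (suc k) a → Pow k a
  Pow-pred (mult {a = x} e b) = Pow-scale x b
  Pow-pred (add a b)  = add (Pow-pred a) (Pow-pred b)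
  Pow-pred (resp e a) = resp e (Pow-pred a)

  Pow-≤ : ∀ {j k a} → j ℕ.≤ k → Pow k a → Pow j a
  Pow-≤ j≤k a = go (ℕ.≤⇒≤′ j≤k) a
    where
    go : ∀ {j k a} → j ℕ.≤′ k → Pow k a → Pow j a
    go ℕ.≤′-refl     a = a
    go (ℕ.≤′-step l) a = go l (Pow-pred a)

  Pow-* : ∀ {j k a b} → Pow j a → Pow k b → Pow (j ℕ.+ k) (a * b)
  Pow-* {a = a} base b = Pow-scale a b
  Pow-* (mult e a) b   = resp (sym (*-assoc _ _ _)) (mult e (Pow-* a b))
  Pow-* (add a a′) b   = resp (sym (distribʳ _ _ _)) (add (Pow-* a b) (Pow-* a′ b))
  Pow-* (resp e a) b   = resp (*-congʳ e) (Pow-* a b)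

  Pow-^ : ∀ {a} k → ε a F.≈ F.0# → Pow k (a ^ k)
  Pow-^ zero    e = base
  Pow-^ (suc k) e = mult e (Pow-^ k e)

  Pow-∑ : ∀ {k a} {X : Set a} (xs : List X) {h : X → Carrier} → (∀ x → Pow k (h x)) → Pow k (∑ xs h)
  Pow-∑ []       e = Pow-0 _
  Pow-∑ (x ∷ xs) e = add (e x) (Pow-∑ xs e)

  ε-p : ε (p · 1#) F.≈ F.0#
  ε-p = F.trans (ε-· p 1#) (F.trans (F.×-congʳ p ε-1) p·1≈0)

  Pow-p : ∀ {k a} → Pow k a → Pow (suc k) (p · a)
  Pow-p {a = a} b = resp (sym (·≈·1* p a)) (mult ε-p b)

  Pow-p^ : ∀ v a → Pow v ((p ℕ.^ v) · a)
  Pow-p^ zero    a = base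
  Pow-p^ (suc v) a = resp (×-assocˡ a p (p ℕ.^ v)) (Pow-p (Pow-p^ v a))

  0<n : 0 ℕ.< n
  0<n = ℕ.s≤s⁻¹ (ℕ.nonTrivial⇒n>1 p {{prime⇒nonTrivial pr}})

  private
    Pow-^-pos : ∀ {k a} j → 0 ℕ.< j → Pow k a → Pow k (a ^ j)
    Pow-^-pos (suc j) _ a = resp (*-comm _ _) (Pow-scale _ a)

  -- Writing φ a = a ^ p + p δ(a), the operator δ lowers the order of vanishing by at most one.
  φ-Pow : ∀ {k a} → Pow (suc k) a → ∃ λ b → Pow k b × φ a ≈ a ^ p + p · b
  φ-Pow {zero}  {a} _ with b , e ← frobenius a = b , base , e
  φ-Pow {suc k} (mult {a = a} {b = b} εa≈0 h) with a′ , ea ← frobenius a | b′ , h′ , eb ← φ-Pow h =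
    -- The product rule δ(ab) = δ(a) b^p + φ(a) δ(b). The first summand keeps the order of b; in the
    -- second, δ(b) has lost one order and φ(a), which lies in I, restores it.
    a′ * b ^ p + φ a * b′ , add (Pow-scale a′ (Pow-^-pos p (s≤s z≤n) h)) (mult εφa≈0 h′) , (begin
      φ (a * b)                                          ≈⟨ φ-* a b ⟩
      φ a * φ b                                          ≈⟨ *-congˡ eb ⟩
      φ a * (b ^ p + p · b′)                             ≈⟨ distribˡ _ _ _ ⟩
      φ a * b ^ p + φ a * (p · b′)                       ≈⟨ +-cong (*-congʳ ea) (×-comm-* p (φ a) b′) ⟩
      (a ^ p + p · a′) * b ^ p + p · (φ a * b′)          ≈⟨ +-congʳ (distribʳ _ _ _) ⟩
      (a ^ p * b ^ p + (p · a′) * b ^ p) + p · (φ a * b′) ≈⟨ +-assoc _ _ _ ⟩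
      a ^ p * b ^ p + ((p · a′) * b ^ p + p · (φ a * b′)) ≈⟨ +-cong (sym (^-distrib-* a b p)) (+-congʳ (×-assoc-* p a′ _)) ⟩
      (a * b) ^ p + (p · (a′ * b ^ p) + p · (φ a * b′))  ≈⟨ +-congˡ (·-distrib-+ _ _ p) ⟨
      (a * b) ^ p + p · (a′ * b ^ p + φ a * b′)          ∎)
    where
    εφa≈0 : ε (φ a) F.≈ F.0#
    εφa≈0 = F.trans (ε-cong ea) (F.trans (ε-+ _ _) (F.trans (F.+-cong
      (F.trans (ε-^ a p) (F.trans (F.*-congʳ εa≈0) (F.zeroˡ _)))
      (F.trans (ε-cong (·≈·1* p a′)) (F.trans (ε-* _ _) (F.trans (F.*-congʳ ε-p) (F.zeroˡ _))))) (F.+-identityˡ _)))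
  φ-Pow {suc k} (add {a = a} {b = b} ha hb) with a′ , ha′ , ea ← φ-Pow ha | b′ , hb′ , eb ← φ-Pow hb =
    (a′ + b′) - m , add (add ha′ hb′) (Pow-neg (Pow-pred m∈)) , (begin
      φ (a + b)                                    ≈⟨ φ-+ a b ⟩
      φ a + φ b                                    ≈⟨ +-cong ea eb ⟩
      (a ^ p + p · a′) + (b ^ p + p · b′)          ≈⟨ interchange _ _ _ _ ⟩
      (a ^ p + b ^ p) + (p · a′ + p · b′)          ≈⟨ +-congˡ (·-distrib-+ a′ b′ p) ⟨
      (a ^ p + b ^ p) + p · (a′ + b′)              ≈⟨ +-congˡ (a+[x-a]≈x (p · m) _) ⟨
      (a ^ p + b ^ p) + (p · m + (p · (a′ + b′) - p · m)) ≈⟨ +-assoc _ _ _ ⟨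
      (a ^ p + b ^ p + p · m) + (p · (a′ + b′) - p · m) ≈⟨ +-cong (freshman pr a b) (·-distrib-minus p _ m) ⟨
      (a + b) ^ p + p · ((a′ + b′) - m)            ∎)
    where
    m = middle pr a b
    m∈ : Pow (suc (suc k)) m
    m∈ = middle-closed pr (Pow (suc (suc k))) (Pow-0 _) add a b
           (λ i i<n → Pow-scale (a ^ suc i) (Pow-^-pos (n ℕ.∸ i) (ℕ.m<n⇒0<n∸m i<n) hb))
  φ-Pow {suc k} (resp e h) with b , h′ , eb ← φ-Pow h =
    b , h′ , trans (φ-cong (sym e)) (trans eb (+-congʳ (^-congˡ p e)))

  φ-·1 : ∀ k → φ (k · 1#) ≈ k · 1#
  φ-·1 zero    = +-cancelˡ (φ 0#) _ _ (trans (sym (φ-+ 0# 0#)) (trans (φ-cong (+-identityʳ 0#)) (sym (+-identityʳ _))))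
  φ-·1 (suc k) = trans (φ-+ 1# (k · 1#)) (+-cong φ-1 (φ-·1 k))

  ε-Pow : ∀ {a} → Pow 1 a → ε a F.≈ F.0#
  ε-Pow (mult {a = x} {b = y} e _) = F.trans (ε-* x y) (F.trans (F.*-congʳ e) (F.zeroˡ _))
  ε-Pow (add {a = x} {b = y} h h′) = F.trans (ε-+ x y) (F.trans (F.+-cong (ε-Pow h) (ε-Pow h′)) (F.+-identityˡ _))
  ε-Pow (resp e h) = F.trans (ε-cong (sym e)) (ε-Pow h)

  -- φ fixes integers, so a = a^p + p δ(a). Dividing by p gives a/p = (a/p) a^(p - 1) + δ(a). If a
  -- has order k + 1, both summands have order at least k, and the induction continues with a/p.
  Pow-integer : ∀ k a → Pow k (a · 1#) → p ℕ.^ k ℕ.∣ a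
  Pow-integer zero    a _ = ℕ.1∣ a
  Pow-integer (suc k) a h
    with divides a′ ≡.refl ← F.char-∣ pr p·1≈0 a (F.trans (F.×-congʳ a (F.sym ε-1)) (F.trans (F.sym (ε-· a 1#)) (ε-Pow (Pow-≤ (s≤s z≤n) h))))
       | b , hb , e ← φ-Pow h = ℕ.∣-trans (ℕ.*-monoʳ-∣ p (Pow-integer k a′ a′∈)) (ℕ.∣-reflexive (ℕ.*-comm p a′))
    where
    u = (a′ ℕ.* p) · 1#
    u≈p·a′ : u ≈ p · (a′ · 1#)
    u≈p·a′ = trans (×-congˡ (ℕ.*-comm a′ p)) (sym (×-assocˡ 1# p a′))
    a′≈ : (a′ · 1#) * u ^ n + b ≈ a′ · 1#
    a′≈ = torsion-free n (begin
      p · ((a′ · 1#) * u ^ n + b)        ≈⟨ ·-distrib-+ _ _ p ⟩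
      p · ((a′ · 1#) * u ^ n) + p · b    ≈⟨ +-congʳ (×-assoc-* p _ _) ⟨
      (p · (a′ · 1#)) * u ^ n + p · b    ≈⟨ +-congʳ (*-congʳ u≈p·a′) ⟨
      u ^ p + p · b                      ≈⟨ e ⟨
      φ u                                ≈⟨ φ-·1 (a′ ℕ.* p) ⟩
      u                                  ≈⟨ u≈p·a′ ⟩
      p · (a′ · 1#)                      ∎)
    a′∈ : Pow k (a′ · 1#)
    a′∈ = resp a′≈ (add (Pow-scale _ (Pow-^-pos n 0<n (Pow-pred h))) hb)

  -- Each p-th power gains one order: in (1 + u)^p = 1 + u^p + p (...) the term u^p contains at
  -- least two factors u, and the mixed terms contain u and p, which lies in I.
  unit-power : ∀ {a} k → ε a F.≈ F.1# → Pow (suc k) (a ^ (p ℕ.^ k) - 1#)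
  unit-power {a} zero e = Pow-1 (F.trans (ε-+ _ _) (F.trans (F.+-cong (F.trans (ε-cong (*-identityʳ a)) e)
    (F.trans (ε-neg 1#) (F.-‿cong ε-1))) (F.-‿inverseʳ F.1#)))
  unit-power {a} (suc k) e = resp (sym (begin
      a ^ (p ℕ.* p ℕ.^ k) - 1#                          ≈⟨ +-congʳ (trans (^-congʳ a (ℕ.*-comm p (p ℕ.^ k))) (sym (^-assocʳ a (p ℕ.^ k) p))) ⟩
      (a ^ (p ℕ.^ k)) ^ p - 1#                          ≈⟨ +-congʳ (^-congˡ p (a+[x-a]≈x 1# _)) ⟨
      (1# + u) ^ p - 1#                                 ≈⟨ +-congʳ (freshman pr 1# u) ⟩
      (1# ^ p + u ^ p + p · m) - 1#                     ≈⟨ +-congʳ (trans (+-assoc _ _ _) (+-congʳ (1^n≈1 p))) ⟩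
      (1# + (u ^ p + p · m)) - 1#                       ≈⟨ +-assoc _ _ _ ⟩
      1# + ((u ^ p + p · m) - 1#)                       ≈⟨ a+[x-a]≈x 1# _ ⟩
      u ^ p + p · m                                     ∎))
    (add (Pow-≤ (s≤s (ℕ.m≤n+m (suc k) k)) (Pow-* u∈ (Pow-^-pos n 0<n u∈))) (Pow-p m∈))
    where
    u = a ^ (p ℕ.^ k) - 1#
    u∈ = unit-power k e
    m = middle pr 1# u
    m∈ : Pow (suc k) m
    m∈ = middle-closed pr (Pow (suc k)) (Pow-0 _) add 1# u
           (λ i i<n → Pow-scale (1# ^ suc i) (Pow-^-pos (n ℕ.∸ i) (ℕ.m<n⇒0<n∸m i<n) u∈))

  powerSum : ℕ → Carrier
  powerSum e = ∑ F.elems (λ x → [ x ] ^ e)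

  -- Scaling the summation variable by g gives ([g]^e - 1) S = 0. The factor is invertible modulo I
  -- but may be a zero divisor, so S = 0 does not follow. An inverse modulo I yields u in I with u S
  -- = S instead, and iteration puts S into every power of I.
  powerSum-vanishes : ∀ e {g} → ¬ (g F.≈ F.0#) → ¬ (g F.^ e F.≈ F.1#) → ∀ k → Pow k (powerSum e)
  powerSum-vanishes e {g} g≉0 g^e≉1 = vanish
    where
    S = powerSum e
    w = [ g ] ^ e - 1#
    invariant : [ g ] ^ e * S ≈ S
    invariant = begin
      [ g ] ^ e * S                               ≈⟨ *-distribˡ-∑ F.elems _ _ ⟩
      ∑ F.elems (λ x → [ g ] ^ e * [ x ] ^ e)     ≈⟨ ∑-cong F.elems (λ x → trans (^-congˡ e ([]-* g x)) (^-distrib-* [ g ] [ x ] e)) ⟨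
      ∑ F.elems (λ x → [ g F.* x ] ^ e)           ≈⟨ F.∑-scale +-commutativeMonoid g≉0 (λ x → [ x ] ^ e) (λ x≈y → ^-congˡ e ([]-cong x≈y)) ⟩
      S                                           ∎
    wS≈0 : w * S ≈ 0#
    wS≈0 = begin
      w * S                         ≈⟨ distribʳ _ _ _ ⟩
      [ g ] ^ e * S + - 1# * S      ≈⟨ +-cong invariant (trans (sym (-‿distribˡ-* 1# S)) (-‿cong (*-identityˡ S))) ⟩
      S - S                         ≈⟨ -‿inverseʳ S ⟩
      0#                            ∎
    εw≉0 : ¬ (ε w F.≈ F.0#)
    εw≉0 εw≈0 = g^e≉1 (F.x-y≈0⇒x≈y _ _ (F.trans (F.sym (F.trans (ε-+ _ _) (F.+-cong
      (F.trans (ε-^ [ g ] e) (F.^-congˡ e (ε-[] g))) (F.trans (ε-neg 1#) (F.-‿cong ε-1))))) εw≈0))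
    y = proj₁ (proj₂ isField (ε w) εw≉0)
    u = 1# - [ y ] * w
    εu≈0 : ε u F.≈ F.0#
    εu≈0 = F.trans (ε-+ _ _) (F.trans (F.+-cong ε-1 (F.trans (ε-neg _) (F.-‿cong (F.trans (ε-* _ _)
      (F.trans (F.*-congʳ (ε-[] y)) (F.trans (F.*-comm _ _) (proj₂ (proj₂ isField (ε w) εw≉0)))))))) (F.-‿inverseʳ F.1#))
    uS≈S : u * S ≈ S
    uS≈S = begin
      u * S                             ≈⟨ distribʳ _ _ _ ⟩
      1# * S + - ([ y ] * w) * S        ≈⟨ +-cong (*-identityˡ S) (sym (-‿distribˡ-* _ S)) ⟩
      S - [ y ] * w * S                 ≈⟨ +-congˡ (-‿cong (trans (*-assoc _ _ _) (trans (*-congˡ wS≈0) (zeroʳ _)))) ⟩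
      S - 0#                            ≈⟨ trans (+-congˡ -0#≈0#) (+-identityʳ S) ⟩
      S                                 ∎
    vanish : ∀ k → Pow k S
    vanish zero    = base
    vanish (suc k) = resp uS≈S (mult εu≈0 (vanish k))

-- Sums of natural numbers, and powers of p rotated modulo q - 1

sumℕ-+ : ∀ {r} (f g : Fin r → ℕ) → sumℕ (λ i → f i ℕ.+ g i) ≡ sumℕ f ℕ.+ sumℕ g
sumℕ-+ {zero}  f g = ≡.refl
sumℕ-+ {suc r} f g = ≡.trans (≡.cong (ℕ._+_ (f zero ℕ.+ g zero)) (sumℕ-+ (λ i → f (suc i)) (λ i → g (suc i)))) (swap (f zero) _ _ _)
  where
  swap : ∀ a b c d → (a ℕ.+ b) ℕ.+ (c ℕ.+ d) ≡ (a ℕ.+ c) ℕ.+ (b ℕ.+ d)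
  swap = solve-ℕ

sumℕ-* : ∀ {r} a (f : Fin r → ℕ) → sumℕ (λ i → a ℕ.* f i) ≡ a ℕ.* sumℕ f
sumℕ-* {zero}  a f = ≡.sym (ℕ.*-zeroʳ a)
sumℕ-* {suc r} a f = ≡.trans (≡.cong (ℕ._+_ (a ℕ.* f zero)) (sumℕ-* a (λ i → f (suc i)))) (≡.sym (ℕ.*-distribˡ-+ a _ _))

sumℕ-≥ : ∀ {r} a (f : Fin r → ℕ) → (∀ i → a ℕ.≤ f i) → r ℕ.* a ℕ.≤ sumℕ f
sumℕ-≥ {zero}  a f b = z≤n
sumℕ-≥ {suc r} a f b = ℕ.+-mono-≤ (b zero) (sumℕ-≥ a (λ i → f (suc i)) (λ i → b (suc i)))

∑< : ℕ → (ℕ → ℕ) → ℕ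
∑< zero    f = 0
∑< (suc m) f = ∑< m f ℕ.+ f m

∑<-cong : ∀ m {f g : ℕ → ℕ} → (∀ c → c ℕ.< m → f c ≡ g c) → ∑< m f ≡ ∑< m g
∑<-cong zero    e = ≡.refl
∑<-cong (suc m) e = ≡.cong₂ ℕ._+_ (∑<-cong m (λ c c<m → e c (ℕ.m<n⇒m<1+n c<m))) (e m ℕ.≤-refl)

∑<-+ : ∀ m (f g : ℕ → ℕ) → ∑< m (λ c → f c ℕ.+ g c) ≡ ∑< m f ℕ.+ ∑< m g
∑<-+ zero    f g = ≡.refl
∑<-+ (suc m) f g = ≡.trans (≡.cong (ℕ._+ (f m ℕ.+ g m)) (∑<-+ m f g)) (swap (∑< m f) _ _ _)
  where
  swap : ∀ a b c d → (a ℕ.+ b) ℕ.+ (c ℕ.+ d) ≡ (a ℕ.+ c) ℕ.+ (b ℕ.+ d)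
  swap = solve-ℕ

∑<-* : ∀ m a (f : ℕ → ℕ) → ∑< m (λ c → a ℕ.* f c) ≡ a ℕ.* ∑< m f
∑<-* zero    a f = ≡.sym (ℕ.*-zeroʳ a)
∑<-* (suc m) a f = ≡.trans (≡.cong (ℕ._+ a ℕ.* f m) (∑<-* m a f)) (≡.sym (ℕ.*-distribˡ-+ a _ _))

∑<-≥ : ∀ m {f : ℕ → ℕ} → (∀ c → 0 ℕ.< f c) → m ℕ.≤ ∑< m f
∑<-≥ zero    b = z≤n
∑<-≥ (suc m) b = ℕ.≤-trans (ℕ.≤-reflexive (ℕ.+-comm 1 m)) (ℕ.+-mono-≤ (∑<-≥ m b) (b m))

-- When f has period m, the two boundary terms agree and cancel: the sum over a full period is
-- invariant under rotation.
∑<-shift : ∀ m (f : ℕ → ℕ) → ∑< m (λ c → f (suc c)) ℕ.+ f 0 ≡ ∑< m f ℕ.+ f m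
∑<-shift zero    f = ≡.refl
∑<-shift (suc m) f = ≡.trans (swap (∑< m (λ c → f (suc c))) (f (suc m)) (f 0)) (≡.cong (ℕ._+ f (suc m)) (∑<-shift m f))
  where
  swap : ∀ a b c → (a ℕ.+ b) ℕ.+ c ≡ (a ℕ.+ c) ℕ.+ b
  swap = solve-ℕ

geometric : ∀ n m → suc (n ℕ.* ∑< m (suc n ℕ.^_)) ≡ suc n ℕ.^ m
geometric n zero    = ≡.cong suc (ℕ.*-zeroʳ n)
geometric n (suc m) = ≡.trans (≡.cong suc (ℕ.*-distribˡ-+ n (∑< m (suc n ℕ.^_)) _)) (≡.cong (ℕ._+ n ℕ.* suc n ℕ.^ m) (geometric n m))

-- Congruence modulo N, oriented because a reduced exponent never exceeds the original one.
infix 4 _≼[_]_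
_≼[_]_ : ℕ → ℕ → ℕ → Set
a ≼[ N ] b = ∃ λ u → a ℕ.+ u ℕ.* N ≡ b

≼-refl : ∀ {N a} → a ≼[ N ] a
≼-refl {a = a} = 0 , ℕ.+-identityʳ a

≼-+ : ∀ {N a b a′ b′} → a ≼[ N ] b → a′ ≼[ N ] b′ → a ℕ.+ a′ ≼[ N ] b ℕ.+ b′
≼-+ {N} {a} {a′ = a′} (u , ≡.refl) (u′ , ≡.refl) = u ℕ.+ u′ , eq a a′ u u′ N
  where
  eq : ∀ a a′ u u′ N → (a ℕ.+ a′) ℕ.+ (u ℕ.+ u′) ℕ.* N ≡ (a ℕ.+ u ℕ.* N) ℕ.+ (a′ ℕ.+ u′ ℕ.* N)
  eq = solve-ℕ

≼-* : ∀ {N a b} e → a ≼[ N ] b → a ℕ.* e ≼[ N ] b ℕ.* e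
≼-* {N} {a} e (u , ≡.refl) = e ℕ.* u , eq a e u N
  where
  eq : ∀ a e u N → a ℕ.* e ℕ.+ (e ℕ.* u) ℕ.* N ≡ (a ℕ.+ u ℕ.* N) ℕ.* e
  eq = solve-ℕ

≼-trans : ∀ {N a b d} → a ≼[ N ] b → b ≼[ N ] d → a ≼[ N ] d
≼-trans {N} {a} (u , ≡.refl) (u′ , ≡.refl) = u ℕ.+ u′ , eq a u u′ N
  where
  eq : ∀ a u u′ N → a ℕ.+ (u ℕ.+ u′) ℕ.* N ≡ (a ℕ.+ u ℕ.* N) ℕ.+ u′ ℕ.* N
  eq = solve-ℕ

≼-substʳ : ∀ {N a b b′} → b ≡ b′ → a ≼[ N ] b → a ≼[ N ] b′
≼-substʳ ≡.refl h = h

module RotatedPowers (p m N : ℕ) {{_ : ℕ.NonZero m}} {{_ : ℕ.NonZero p}} (1+N≡p^m : suc N ≡ p ℕ.^ m) where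
  -- A positive representative of p^c modulo N. Because p^m is 1 modulo N, passing from c to c + 1
  -- rotates the list 1, p, ..., p^(m - 1).
  rotPow : ℕ → ℕ
  rotPow c = p ℕ.^ (c ℕ.% m)

  rotPow-period : ∀ c → rotPow (c ℕ.+ m) ≡ rotPow c
  rotPow-period c = ≡.cong (p ℕ.^_) (ℕ.[m+n]%n≡m%n c m)

  rotPow-pos : ∀ c → 0 ℕ.< rotPow c
  rotPow-pos c = ℕ.m^n>0 p (c ℕ.% m)

  rotPow-sum : ∑< m rotPow ≡ ∑< m (p ℕ.^_)
  rotPow-sum = ∑<-cong m (λ c c<m → ≡.cong (p ℕ.^_) (ℕ.m<n⇒m%n≡m c<m))

  rotPow-≼ : ∀ c → rotPow c ≼[ N ] p ℕ.^ c
  rotPow-≼ c = ≼-substʳ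
    (≡.trans (≡.sym (ℕ.^-distribˡ-+-* p ((c ℕ./ m) ℕ.* m) (c ℕ.% m)))
      (≡.cong (p ℕ.^_) (≡.trans (ℕ.+-comm ((c ℕ./ m) ℕ.* m) _) (≡.sym (ℕ.m≡m%n+[m/n]*n c m)))))
    (≼-trans (0 , ≡.trans (ℕ.+-identityʳ _) (≡.sym (ℕ.*-identityˡ (rotPow c)))) (≼-* (rotPow c) (go (c ℕ./ m))))
    where
    go : ∀ j → 1 ≼[ N ] p ℕ.^ (j ℕ.* m)
    go zero    = ≼-refl
    go (suc j) = ≼-trans (go j) (p ℕ.^ (j ℕ.* m) , ≡.trans (≡.sym (ℕ.*-suc (p ℕ.^ (j ℕ.* m)) N))
      (≡.trans (≡.cong (p ℕ.^ (j ℕ.* m) ℕ.*_) 1+N≡p^m)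
        (≡.trans (ℕ.*-comm (p ℕ.^ (j ℕ.* m)) _) (≡.sym (ℕ.^-distribˡ-+-* p m (j ℕ.* m))))))

-- Counting points of F^k

χ : ∀ {a} {P : Set a} → Dec P → ℕ
χ d = if does d then 1 else 0

χ-cong : ∀ {a b} {P : Set a} {Q : Set b} (d : Dec P) (d′ : Dec Q) → (P → Q) → (Q → P) → χ d ≡ χ d′
χ-cong (yes p) (yes q) f g = ≡.refl
χ-cong (yes p) (no ¬q) f g = ⊥-elim (¬q (f p))
χ-cong (no ¬p) (yes q) f g = ⊥-elim (¬p (g q))
χ-cong (no ¬p) (no ¬q) f g = ≡.refl

length-filter≡∑χ : ∀ {a b} {X : Set a} {P : X → Set b} (P? : ∀ x → Dec (P x)) xs →
  length (filter P? xs) ≡ ListSum.∑ ℕ.+-0-commutativeMonoid xs (λ x → χ (P? x))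
length-filter≡∑χ P? []       = ≡.refl
length-filter≡∑χ P? (x ∷ xs) with does (P? x)
... | true  = ≡.cong suc (length-filter≡∑χ P? xs)
... | false = length-filter≡∑χ P? xs

module PointSums {c ℓ : Level} (F : CommutativeRing c ℓ) (isField : IsField F) (fin : IsFinite F) where
  open FieldFacts F isField fin hiding (∑; ∑-cong; ∑-concatMap; ∑-map)

  infixr 5 _∷ₚ_
  _∷ₚ_ : ∀ {k} → Carrier → Point F k → Point F (suc k)
  (a ∷ₚ x) zero    = a
  (a ∷ₚ x) (suc i) = x i

  points : ∀ k → List (Point F k)
  points zero    = (λ ()) ∷ []
  points (suc k) = concatMap (λ a → map (a ∷ₚ_) (points k)) elems

  module _ {a b : Level} (M : CommutativeMonoid a b) where
    private module M = CommutativeMonoid M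
    open ListSum M

    ∑-points-suc : ∀ k (h : Point F (suc k) → M.Carrier) →
                   ∑ (points (suc k)) h M.≈ ∑ elems (λ a → ∑ (points k) (λ x → h (a ∷ₚ x)))
    ∑-points-suc k h = M.trans (∑-concatMap _ elems h) (∑-cong elems (λ a → M.reflexive (∑-map (a ∷ₚ_) (points k) h)))

  vanishes? : ∀ {r} (y : Fin r → Carrier) → Dec (∀ j → y j ≈ 0#)
  vanishes? y = Fin.all? (λ j → y j ≟ 0#)

  count : ∀ {a r} {X : Set a} → List X → (X → Fin r → Carrier) → ℕ
  count xs g = ListSum.∑ ℕ.+-0-commutativeMonoid xs (λ x → χ (vanishes? (g x)))

-- Ax's theorem: q divides the number of zeros

module Weighted {c ℓ : Level} (F : CommutativeRing c ℓ) (isField : IsField F) (fin : IsFinite F)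
                {n : ℕ} (pr : Prime (suc n))
                (p·1≈0 : CommutativeRing._≈_ F (RingFacts._·_ F (suc n) (CommutativeRing.1# F)) (CommutativeRing.0# F))
                (L : Lifting F (suc n))
                (m : ℕ) {{_ : ℕ.NonZero m}} (q≡p^m : card F fin ≡ suc n ℕ.^ m) (k : ℕ) where
  private module F = FieldFacts F isField fin
  open Filtration F isField fin pr p·1≈0 L
  open import Relation.Binary.Reasoning.Setoid setoid

  N : ℕ
  N = F.N

  open RotatedPowers p m N (≡.trans (≡.sym F.q≡1+N) q≡p^m)

  -- This is (q - 1)/(p - 1), the unit of cost: what one monomial contributes over a full rotation.
  θ : ℕ
  θ = ∑< m (p ℕ.^_)

  N≡nθ : N ≡ n ℕ.* θ
  N≡nθ = ℕ.suc-injective (≡.trans (≡.sym F.q≡1+N) (≡.trans q≡p^m (≡.sym (geometric n m))))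

  mono : ∀ {k} → (Fin k → ℕ) → Point F k → Carrier
  mono E x = Πᶠ A (λ i → [ x i ] ^ E i)

  mono-0 : ∀ {k} (x : Point F k) → mono (λ _ → 0) x ≈ 1#
  mono-0 {zero}  x = refl
  mono-0 {suc k} x = trans (*-identityˡ _) (mono-0 (λ i → x (suc i)))

  mono-+ : ∀ {k} (E E′ : Fin k → ℕ) x → mono (λ i → E i ℕ.+ E′ i) x ≈ mono E x * mono E′ x
  mono-+ {zero}  E E′ x = sym (*-identityˡ 1#)
  mono-+ {suc k} E E′ x = trans (*-cong (^-homo-* _ (E zero) (E′ zero)) (mono-+ (λ i → E (suc i)) (λ i → E′ (suc i)) (λ i → x (suc i))))
    (*-interchange _ _ _ _)
    where open import Algebra.Properties.CommutativeSemigroup *-commutativeSemigroup using () renaming (interchange to *-interchange)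

  mono-* : ∀ {k} j (E : Fin k → ℕ) x → mono (λ i → j ℕ.* E i) x ≈ mono E x ^ j
  mono-* zero    E x = mono-0 x
  mono-* (suc j) E x = trans (mono-+ E (λ i → j ℕ.* E i) x) (*-congˡ (mono-* j E x))

  -- The expansions are identities between functions F^k → A rather than between polynomials. The
  -- facts on p-th powers in commutative rings then apply directly, and the exponents are recorded
  -- in the terms.
  Fun : CommutativeRing (c ⊔ c) (c ⊔ (c ⊔ ℓ))
  Fun = Pointwise.commutativeRing (Point F k) A

  private module Fun = RingFacts Fun

  -- The vectors `rot c` play the role of pᶜE reduced modulo N; having them for all c at once is
  -- what allows the divisibility by q instead of p.
  record Exponent : Set where
    field
      E     : Fin k → ℕ
      rot   : ℕ → Fin k → ℕ
      rot-≼ : ∀ c i → rot c i ≼[ N ] p ℕ.^ c ℕ.* E i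
      rot-0 : ∀ c i → 0 ℕ.< E i → 0 ℕ.< rot c i
  open Exponent

  _⊕_ : Exponent → Exponent → Exponent
  (X ⊕ Y) .E i         = X .E i ℕ.+ Y .E i
  (X ⊕ Y) .rot c i     = X .rot c i ℕ.+ Y .rot c i
  (X ⊕ Y) .rot-≼ c i   = ≼-substʳ (≡.sym (ℕ.*-distribˡ-+ (p ℕ.^ c) (X .E i) (Y .E i))) (≼-+ (X .rot-≼ c i) (Y .rot-≼ c i))
  (X ⊕ Y) .rot-0 c i 0<E with X .E i in eq
  ... | zero  = ℕ.≤-trans (Y .rot-0 c i 0<E) (ℕ.m≤n+m _ _)
  ... | suc _ = ℕ.≤-trans (X .rot-0 c i (ℕ.≤-trans (s≤s z≤n) (ℕ.≤-reflexive (≡.sym eq)))) (ℕ.m≤m+n _ _)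

  ∅ : Exponent
  ∅ .E i = 0
  ∅ .rot c i = 0
  ∅ .rot-≼ c i = 0 , ≡.sym (ℕ.*-zeroʳ (p ℕ.^ c))
  ∅ .rot-0 c i ()

  p⊛_ : Exponent → Exponent
  (p⊛ X) .E i       = p ℕ.* X .E i
  (p⊛ X) .rot c     = X .rot (suc c)
  (p⊛ X) .rot-≼ c i = ≼-substʳ (≡.trans (≡.cong (ℕ._* X .E i) (ℕ.*-comm p (p ℕ.^ c))) (ℕ.*-assoc (p ℕ.^ c) p _)) (X .rot-≼ (suc c) i)
  (p⊛ X) .rot-0 c i 0<pE with X .E i in eq
  ... | zero  = ⊥-elim (ℕ.<-irrefl (≡.sym (ℕ.*-zeroʳ p)) 0<pE)
  ... | suc _ = X .rot-0 (suc c) i (ℕ.≤-trans (s≤s z≤n) (ℕ.≤-reflexive (≡.sym eq)))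

  -- For a product of powers X^(p^b) of monomials X of a polynomial of degree d, B c is the sum of the
  -- p^((b + c) mod m).  Taking p-th powers only rotates B, so it preserves the cost inequality.
  record Term (d w D : ℕ) : Set (c ⊔ ℓ) where
    field
      coeff  : Carrier
      v      : ℕ
      order  : Pow v coeff
      expo   : Exponent
      B      : ℕ → ℕ
      B-per  : ∀ c → B (c ℕ.+ m) ≡ B c
      B-pos  : ∀ c → 0 ℕ.< B c
      B-≼    : ∀ c → B c ≼[ N ] p ℕ.^ c ℕ.* D
      degree : ∀ c → sumℕ (expo .rot c) ℕ.≤ d ℕ.* B c
      cost   : ∑< m B ℕ.≤ N ℕ.* v ℕ.+ w ℕ.* θ

    value : Fun.Carrier
    value x = coeff * mono (expo .E) x

  -- The shape of an expansion of f̃^D for f of degree at most d. The weight w is the number of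
  -- factors f̃^(p^b) for which it is charged; keeping it far below D is the point of the
  -- bookkeeping.
  data T (d w D : ℕ) : Fun.Carrier → Set (c ⊔ ℓ) where
    zeroT : T d w D Fun.0#
    term  : (t : Term d w D) → T d w D (Term.value t)
    addT  : ∀ {g h} → T d w D g → T d w D h → T d w D (g Fun.+ h)
    respT : ∀ {g h} → g Fun.≈ h → T d w D g → T d w D h

  private
    swap* : ∀ a b c d → (a * b) * (c * d) ≈ (a * c) * (b * d)
    swap* = interchange*
      where open import Algebra.Properties.CommutativeSemigroup *-commutativeSemigroup using () renaming (interchange to interchange*)

  Term-* : ∀ {d w w′ D D′} (t : Term d w D) (t′ : Term d w′ D′) → Term d (w ℕ.+ w′) (D ℕ.+ D′)
  Term-* {d} {w} {w′} {D} {D′} t t′ = record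
    { coeff  = t.coeff * t′.coeff
    ; v      = t.v ℕ.+ t′.v
    ; order  = Pow-* t.order t′.order
    ; expo   = t.expo ⊕ t′.expo
    ; B      = λ c → t.B c ℕ.+ t′.B c
    ; B-per  = λ c → ≡.cong₂ ℕ._+_ (t.B-per c) (t′.B-per c)
    ; B-pos  = λ c → ℕ.≤-trans (t.B-pos c) (ℕ.m≤m+n _ _)
    ; B-≼    = λ c → ≼-substʳ (≡.sym (ℕ.*-distribˡ-+ (p ℕ.^ c) D D′)) (≼-+ (t.B-≼ c) (t′.B-≼ c))
    ; degree = λ c → ℕ.≤-trans (ℕ.≤-reflexive (sumℕ-+ (t.expo .rot c) (t′.expo .rot c)))
                 (ℕ.≤-trans (ℕ.+-mono-≤ (t.degree c) (t′.degree c)) (ℕ.≤-reflexive (≡.sym (ℕ.*-distribˡ-+ d (t.B c) (t′.B c)))))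
    ; cost   = ℕ.≤-trans (ℕ.≤-reflexive (∑<-+ m t.B t′.B)) (ℕ.≤-trans (ℕ.+-mono-≤ t.cost t′.cost)
                 (ℕ.≤-reflexive (eq N t.v t′.v w w′ θ)))
    }
    where
    module t = Term t
    module t′ = Term t′
    eq : ∀ N v v′ w w′ θ → (N ℕ.* v ℕ.+ w ℕ.* θ) ℕ.+ (N ℕ.* v′ ℕ.+ w′ ℕ.* θ) ≡ N ℕ.* (v ℕ.+ v′) ℕ.+ (w ℕ.+ w′) ℕ.* θ
    eq = solve-ℕ

  T-* : ∀ {d w w′ D D′ g h} → T d w D g → T d w′ D′ h → T d (w ℕ.+ w′) (D ℕ.+ D′) (g Fun.* h)
  T-* {h = h} zeroT _          = respT (λ x → sym (zeroˡ (h x))) zeroT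
  T-* (addT a a′) b            = respT (λ x → sym (distribʳ _ _ _)) (addT (T-* a b) (T-* a′ b))
  T-* (respT e a) b            = respT (λ x → *-congʳ (e x)) (T-* a b)
  T-* (term t) zeroT           = respT (λ x → sym (zeroʳ (Term.value t x))) zeroT
  T-* (term t) (addT b b′)     = respT (λ x → sym (distribˡ _ _ _)) (addT (T-* (term t) b) (T-* (term t) b′))
  T-* (term t) (respT e b)     = respT (λ x → *-congˡ (e x)) (T-* (term t) b)
  T-* (term t) (term t′)       = respT (λ x → trans (*-congˡ (mono-+ (Term.expo t .E) (Term.expo t′ .E) x)) (swap* _ _ _ _)) (term (Term-* t t′))

  T-^ : ∀ {d w D h} j → T d w D h → T d (suc j ℕ.* w) (suc j ℕ.* D) (h Fun.^ suc j)
  T-^ {d} {w} {D} {h} zero a = respT (λ x → sym (*-identityʳ (h x)))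
    (≡.subst₂ (λ w D → T d w D h) (≡.sym (ℕ.+-identityʳ w)) (≡.sym (ℕ.+-identityʳ D)) a)
  T-^ (suc j) a = T-* a (T-^ j a)

  -- One more order in the coefficient is worth N = (p - 1) θ in the cost inequality, so a factor p
  -- pays for p - 1 units of weight.
  T-p : ∀ {d w D h} → T d (n ℕ.+ w) D h → T d w D (p Fun.· h)
  T-p {d} {w} {D} (term t) = respT (λ x → trans (×-assoc-* p t.coeff _) (pointwise p x)) (term (record
    { coeff = p · t.coeff ; v = suc t.v ; order = Pow-p t.order ; expo = t.expo
    ; B = t.B ; B-per = t.B-per ; B-pos = t.B-pos ; B-≼ = t.B-≼ ; degree = t.degree
    ; cost = ℕ.≤-trans t.cost (ℕ.≤-reflexive (≡.trans (eq N t.v n w θ)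
               (≡.trans (≡.cong (λ z → N ℕ.* t.v ℕ.+ z ℕ.+ w ℕ.* θ) (≡.sym N≡nθ)) (eq′ N t.v (w ℕ.* θ))))) }))
    where
    module t = Term t
    pointwise : ∀ j x → j · t.value x ≈ (j Fun.· t.value) x
    pointwise zero    x = refl
    pointwise (suc j) x = +-congˡ (pointwise j x)
    eq : ∀ N v n w θ → N ℕ.* v ℕ.+ (n ℕ.+ w) ℕ.* θ ≡ N ℕ.* v ℕ.+ n ℕ.* θ ℕ.+ w ℕ.* θ
    eq = solve-ℕ
    eq′ : ∀ N v z → N ℕ.* v ℕ.+ N ℕ.+ z ≡ N ℕ.* suc v ℕ.+ z
    eq′ = solve-ℕ
  T-p zeroT          = respT (Fun.sym (Fun.·-zeroʳ p)) zeroT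
  T-p (addT a b)     = respT (Fun.sym (Fun.·-distrib-+ _ _ p)) (addT (T-p a) (T-p b))
  T-p (respT e a)    = respT (Fun.×-congʳ p e) (T-p a)

  -- A p-th power is charged as one factor, not as p. For a sum, the two pure powers have weight 1
  -- by induction; the mixed products have weight p, and the factor p in front of them pays for p -
  -- 1.
  T-frobenius : ∀ {d D h} → T d 1 D h → T d 1 (p ℕ.* D) (h Fun.^ p)
  T-frobenius zeroT = respT (Fun.sym (Fun.zeroˡ _)) zeroT
  T-frobenius (respT e a) = respT (Fun.^-congˡ p e) (T-frobenius a)
  T-frobenius {d} {D} (addT {g} {h} a b) = respT (Fun.sym (Fun.freshman pr g h))
    (addT (addT (T-frobenius a) (T-frobenius b)) (T-p (Fun.middle-closed pr (T d (n ℕ.+ 1) (p ℕ.* D)) zeroT addT g h mid)))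
    where
    mid : ∀ i → i ℕ.< n → T d (n ℕ.+ 1) (p ℕ.* D) ((g Fun.^ suc i) Fun.* (h Fun.^ (n ℕ.∸ i)))
    mid i i<n with n ℕ.∸ i in eq
    ... | zero  = ⊥-elim (ℕ.<⇒≱ i<n (ℕ.m∸n≡0⇒m≤n eq))
    ... | suc j = ≡.subst₂ (λ w D → T d w D ((g Fun.^ suc i) Fun.* (h Fun.^ suc j)))
                    (≡.trans (≡.cong₂ ℕ._+_ (ℕ.*-identityʳ (suc i)) (ℕ.*-identityʳ (suc j))) (≡.trans sum≡p (ℕ.+-comm 1 n)))
                    (≡.trans (≡.sym (ℕ.*-distribʳ-+ D (suc i) (suc j))) (≡.cong (ℕ._* D) sum≡p))
                    (T-* (T-^ i a) (T-^ j b))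
      where
      sum≡p : suc i ℕ.+ suc j ≡ p
      sum≡p = ≡.cong suc (≡.trans (≡.cong (i ℕ.+_) (≡.sym eq)) (ℕ.m+[n∸m]≡n (ℕ.<⇒≤ i<n)))
  T-frobenius {d} {D} (term t) = respT (λ x → trans (*-congˡ (mono-* p (t.expo .E) x))
      (trans (sym (^-distrib-* t.coeff _ p)) (pointwise p x))) (term (record
    { coeff = t.coeff ^ p ; v = t.v ; order = resp (*-comm _ _) (Pow-scale _ t.order) ; expo = p⊛ t.expo
    ; B = λ c → t.B (suc c) ; B-per = λ c → t.B-per (suc c) ; B-pos = λ c → t.B-pos (suc c)
    ; B-≼ = λ c → ≼-substʳ (≡.trans (≡.cong (ℕ._* D) (ℕ.*-comm p (p ℕ.^ c))) (ℕ.*-assoc (p ℕ.^ c) p D)) (t.B-≼ (suc c))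
    ; degree = λ c → t.degree (suc c)
    ; cost = ℕ.≤-trans (ℕ.≤-reflexive (ℕ.+-cancelʳ-≡ (t.B 0) _ _
               (≡.trans (∑<-shift m t.B) (≡.cong (∑< m t.B ℕ.+_) (t.B-per 0))))) t.cost }))
    where
    module t = Term t
    pointwise : ∀ j x → t.value x ^ j ≈ (t.value Fun.^ j) x
    pointwise zero    x = refl
    pointwise (suc j) x = *-congˡ (pointwise j x)

  T-p^ : ∀ {d h} j → T d 1 1 h → T d 1 (p ℕ.^ j) (h Fun.^ (p ℕ.^ j))
  T-p^ {h = h} zero    a = respT (λ x → sym (*-identityʳ (h x))) a
  T-p^ {h = h} (suc j) a = respT (Fun.trans (Fun.^-assocʳ h (p ℕ.^ j) p) (Fun.^-congʳ h (ℕ.*-comm (p ℕ.^ j) p))) (T-frobenius (T-p^ j a))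

  T-^′ : ∀ {d w D h} j → 0 ℕ.< j → T d w D h → T d (j ℕ.* w) (j ℕ.* D) (h Fun.^ j)
  T-^′ (suc j) _ = T-^ j

  -- The number (q - 1) p^m in base p: its nonzero digits are m copies of p - 1. The digit sum m(p -
  -- 1) is the weight of f̃ᴹ.
  M : ℕ
  M = ∑< m (λ i → n ℕ.* p ℕ.^ (m ℕ.+ i))

  M≡N*p^m : M ≡ N ℕ.* p ℕ.^ m
  M≡N*p^m = ≡.trans (∑<-* m n _) (≡.trans
    (≡.cong (n ℕ.*_) (≡.trans (∑<-cong m (λ i _ → ℕ.^-distribˡ-+-* p m i))
      (≡.trans (∑<-* m (p ℕ.^ m) _) (ℕ.*-comm (p ℕ.^ m) θ))))
    (≡.trans (≡.sym (ℕ.*-assoc n θ _)) (≡.cong (ℕ._* p ℕ.^ m) (≡.sym N≡nθ))))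

  T-^M : ∀ {d h} → T d 1 1 h → T d (m ℕ.* n) M (h Fun.^ M)
  T-^M {d} {h} a = ≡.subst (λ j → T d (j ℕ.* n) (D j) (h Fun.^ D j)) (ℕ.suc-pred m) (go (ℕ.pred m))
    where
    D : ℕ → ℕ
    D j = ∑< j (λ i → n ℕ.* p ℕ.^ (m ℕ.+ i))
    block : ∀ j → T d n (n ℕ.* p ℕ.^ (m ℕ.+ j)) (h Fun.^ (n ℕ.* p ℕ.^ (m ℕ.+ j)))
    block j = ≡.subst (λ w → T d w (n ℕ.* p ℕ.^ (m ℕ.+ j)) (h Fun.^ (n ℕ.* p ℕ.^ (m ℕ.+ j)))) (ℕ.*-identityʳ n)
      (respT (Fun.trans (Fun.^-assocʳ h (p ℕ.^ (m ℕ.+ j)) n) (Fun.^-congʳ h (ℕ.*-comm (p ℕ.^ (m ℕ.+ j)) n)))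
        (T-^′ n 0<n (T-p^ (m ℕ.+ j) a)))
    go : ∀ j → T d (suc j ℕ.* n) (D (suc j)) (h Fun.^ D (suc j))
    go zero    = ≡.subst (λ w → T d w (D 1) (h Fun.^ D 1)) (≡.sym (ℕ.+-identityʳ n)) (block 0)
    go (suc j) = respT (Fun.sym (Fun.^-homo-* h (D (suc j)) _))
      (≡.subst (λ w → T d w (D (suc (suc j))) ((h Fun.^ D (suc j)) Fun.* (h Fun.^ (n ℕ.* p ℕ.^ (m ℕ.+ suc j)))))
        (ℕ.+-comm (suc j ℕ.* n) n) (T-* (go j) (block (suc j))))

  -- What is kept of a term of f̃^D once N divides D. Each `B c` is then a positive multiple of N,
  -- written N (`V c` + 1). `V c` is what rotation c owes for degree beyond N d, and the order of
  -- the coefficient covers the debts of all rotations. In contrast to `T`, the class admits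
  -- constants, and products may combine different polynomials, with degrees adding up.
  record UTerm (d : ℕ) : Set (c ⊔ ℓ) where
    field
      coeff  : Carrier
      v      : ℕ
      order  : Pow v coeff
      expo   : Exponent
      V      : ℕ → ℕ
      V-sum  : ∑< m V ℕ.≤ v
      degree : ∀ c → V c ≡ 0 → sumℕ (expo .rot c) ℕ.≤ N ℕ.* d

    value : Fun.Carrier
    value x = coeff * mono (expo .E) x

  data U (d : ℕ) : Fun.Carrier → Set (c ⊔ ℓ) where
    zeroU : U d Fun.0#
    term  : (t : UTerm d) → U d (UTerm.value t)
    addU  : ∀ {g h} → U d g → U d h → U d (g Fun.+ h)
    respU : ∀ {g h} → g Fun.≈ h → U d g → U d h

  T⇒U : ∀ {d D h} → N ℕ.∣ D → T d (m ℕ.* n) D h → U d h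
  T⇒U N∣D zeroT       = zeroU
  T⇒U N∣D (addT a b)  = addU (T⇒U N∣D a) (T⇒U N∣D b)
  T⇒U N∣D (respT e a) = respU e (T⇒U N∣D a)
  T⇒U {d} {D} N∣D (term t) = term (record
    { coeff = coeff ; v = v ; order = order ; expo = expo ; V = V
    -- The weight m(p - 1) is worth m N, exactly one N for each of the m rotations. What the `B c`
    -- contain beyond that must be paid by the order v.
    ; V-sum = ℕ.+-cancelʳ-≤ m _ _ (ℕ.*-cancelˡ-≤ N (ℕ.≤-trans (ℕ.≤-reflexive ∑B≡) (ℕ.≤-trans cost (ℕ.≤-reflexive budget))))
    ; degree = λ c Vc≡0 → ℕ.≤-trans (degree c) (ℕ.≤-reflexive (≡.trans (≡.cong (d ℕ.*_)
                 (≡.trans (B≡ c) (≡.trans (≡.cong (λ z → N ℕ.* (z ℕ.+ 1)) Vc≡0) (ℕ.*-identityʳ N)))) (ℕ.*-comm d N))) })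
    where
    open Term t
    instance _ = ℕ.>-nonZero F.N>0
    N∣B : ∀ c → N ℕ.∣ B c
    N∣B c with u , e ← B-≼ c = ℕ.∣m+n∣m⇒∣n (≡.subst (N ℕ.∣_) (≡.trans (≡.sym e) (ℕ.+-comm (B c) _))
                                 (ℕ.∣n⇒∣m*n (p ℕ.^ c) N∣D)) (ℕ.n∣m*n u)
    excess : ∀ {a} → N ℕ.∣ a → 0 ℕ.< a → ∃ λ j → a ≡ N ℕ.* (j ℕ.+ 1)
    excess (divides zero    e) 0<a = ⊥-elim (ℕ.<-irrefl (≡.sym e) 0<a)
    excess (divides (suc j) e) _   = j , ≡.trans e (≡.trans (ℕ.*-comm (suc j) N) (≡.cong (N ℕ.*_) (ℕ.+-comm 1 j)))
    V : ℕ → ℕ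
    V c = excess (N∣B c) (B-pos c) .proj₁
    B≡ : ∀ c → B c ≡ N ℕ.* (V c ℕ.+ 1)
    B≡ c = excess (N∣B c) (B-pos c) .proj₂
    ∑1 : ∀ j → ∑< j (λ _ → 1) ≡ j
    ∑1 zero    = ≡.refl
    ∑1 (suc j) = ≡.trans (ℕ.+-comm _ 1) (≡.cong suc (∑1 j))
    ∑B≡ : N ℕ.* (∑< m V ℕ.+ m) ≡ ∑< m B
    ∑B≡ = ≡.sym (≡.trans (∑<-cong m (λ c _ → B≡ c)) (≡.trans (∑<-* m N _)
            (≡.cong (N ℕ.*_) (≡.trans (∑<-+ m V _) (≡.cong (∑< m V ℕ.+_) (∑1 m))))))
    budget : N ℕ.* v ℕ.+ m ℕ.* n ℕ.* θ ≡ N ℕ.* (v ℕ.+ m)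
    budget = ≡.trans (≡.cong (N ℕ.* v ℕ.+_) (≡.trans (ℕ.*-assoc m n θ) (≡.trans (≡.cong (m ℕ.*_) (≡.sym N≡nθ)) (ℕ.*-comm m N))))
      (≡.sym (ℕ.*-distribˡ-+ N v m))

  U-* : ∀ {d d′ g h} → U d g → U d′ h → U (d ℕ.+ d′) (g Fun.* h)
  U-* {h = h} zeroU _          = respU (λ x → sym (zeroˡ (h x))) zeroU
  U-* (addU a a′) b            = respU (λ x → sym (distribʳ _ _ _)) (addU (U-* a b) (U-* a′ b))
  U-* (respU e a) b            = respU (λ x → *-congʳ (e x)) (U-* a b)
  U-* (term t) zeroU           = respU (λ x → sym (zeroʳ (UTerm.value t x))) zeroU
  U-* (term t) (addU b b′)     = respU (λ x → sym (distribˡ _ _ _)) (addU (U-* (term t) b) (U-* (term t) b′))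
  U-* (term t) (respU e b)     = respU (λ x → *-congˡ (e x)) (U-* (term t) b)
  U-* {d} {d′} (term t) (term t′) = respU (λ x → trans (*-congˡ (mono-+ (t.expo .E) (t′.expo .E) x)) (swap* _ _ _ _)) (term (record
    { coeff  = t.coeff * t′.coeff
    ; v      = t.v ℕ.+ t′.v
    ; order  = Pow-* t.order t′.order
    ; expo   = t.expo ⊕ t′.expo
    ; V      = λ c → t.V c ℕ.+ t′.V c
    ; V-sum  = ℕ.≤-trans (ℕ.≤-reflexive (∑<-+ m t.V t′.V)) (ℕ.+-mono-≤ t.V-sum t′.V-sum)
    ; degree = λ c e → ℕ.≤-trans (ℕ.≤-reflexive (sumℕ-+ (t.expo .rot c) (t′.expo .rot c)))
                 (ℕ.≤-trans (ℕ.+-mono-≤ (t.degree c (ℕ.m+n≡0⇒m≡0 _ e)) (t′.degree c (ℕ.m+n≡0⇒n≡0 (t.V c) e)))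
                   (ℕ.≤-reflexive (≡.sym (ℕ.*-distribˡ-+ N d d′)))) }))
    where
    module t = UTerm t
    module t′ = UTerm t′

  U-const : ∀ {d} a → U d (λ _ → a)
  U-const a = respU (λ x → trans (*-congˡ (mono-0 x)) (*-identityʳ a)) (term (record
    { coeff = a ; v = 0 ; order = base ; expo = ∅ ; V = λ _ → 0
    ; V-sum = ℕ.≤-reflexive (∑0 m) ; degree = λ c _ → ℕ.≤-trans (ℕ.≤-reflexive (sumℕ0 k)) z≤n }))
    where
    ∑0 : ∀ j → ∑< j (λ _ → 0) ≡ 0
    ∑0 zero    = ≡.refl
    ∑0 (suc j) = ≡.trans (ℕ.+-identityʳ _) (∑0 j)
    sumℕ0 : ∀ j → sumℕ {j} (λ _ → 0) ≡ 0
    sumℕ0 zero    = ≡.refl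
    sumℕ0 (suc j) = sumℕ0 j

  U-scale : ∀ {d h} a → U d h → U d (λ x → a * h x)
  U-scale a b = U-* {0} (U-const a) b

  U-Π : ∀ {r} (ds : Fin r → ℕ) (G : Fin r → Fun.Carrier) → (∀ l → U (ds l) (G l)) →
        U (sumℕ ds) (λ x → Πᶠ A (λ l → G l x))
  U-Π {zero}  ds G g = U-const 1#
  U-Π {suc r} ds G g = U-* (g zero) (U-Π (λ l → ds (suc l)) (λ l → G (suc l)) (λ l → g (suc l)))

  open PointSums F isField fin

  ∑-mono : ∀ {k} (E : Fin k → ℕ) → ∑ (points k) (mono E) ≈ Πᶠ A (λ i → powerSum (E i))
  ∑-mono {zero}  E = +-identityʳ 1#
  ∑-mono {suc k} E = begin
    ∑ (points (suc k)) (mono E)                                         ≈⟨ ∑-points-suc +-commutativeMonoid k (mono E) ⟩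
    ∑ F.elems (λ a → ∑ (points k) (λ x → [ a ] ^ E zero * mono E′ x))   ≈⟨ ∑-cong F.elems (λ a → *-distribˡ-∑ (points k) (mono E′) _) ⟨
    ∑ F.elems (λ a → [ a ] ^ E zero * ∑ (points k) (mono E′))           ≈⟨ ∑-cong F.elems (λ a → trans (*-congˡ (∑-mono E′)) (*-comm _ _)) ⟩
    ∑ F.elems (λ a → P * [ a ] ^ E zero)                                ≈⟨ *-distribˡ-∑ F.elems _ P ⟨
    P * powerSum (E zero)                                               ≈⟨ *-comm _ _ ⟩
    powerSum (E zero) * P                                               ∎
    where
    E′ = λ i → E (suc i)
    P = Πᶠ A (λ i → powerSum (E′ i))

  Pow-Π : ∀ {j r} {t : Fin r → Carrier} l → Pow j (t l) → Pow j (Πᶠ A t)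
  Pow-Π zero    h = resp (*-comm _ _) (Pow-scale _ h)
  Pow-Π (suc l) h = Pow-scale _ (Pow-Π l h)

  private
    find : ∀ {a b} {P : F.Carrier → Set a} {Q : F.Carrier → Set b} {xs} → All P xs → Any Q xs → ∃ λ x → P x × Q x
    find (px ∷ _)  (here qx) = _ , px , qx
    find (_ ∷ pxs) (there h) = find pxs h

  -- For exponent 0 the power sum is q = p^m, which has order at least m. For a positive exponent e,
  -- either some unit has g^e different from 1 and scaling applies, or all units satisfy g^e = 1.
  -- Then they also satisfy it for each rotated exponent, which is congruent to p^c e and positive,
  -- hence at least N.
  powerSum-or-large : ∀ (X : Exponent) i → Pow m (powerSum (X .E i)) ⊎ (∀ c → N ℕ.≤ X .rot c i)
  powerSum-or-large X i with X .E i in eq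
  ... | zero = inj₁ (resp (trans (×-congˡ (≡.sym q≡p^m)) (sym (∑-const F.elems 1#))) (Pow-p^ m 1#))
  ... | e@(suc _) with All.all? (λ g → g F.^ e F.≟ F.1#) F.units
  ...   | no ¬all with i , g≉0 , h ← find F.units-nonzero (All.¬All⇒Any¬ (λ g → g F.^ e F.≟ F.1#) _ ¬all) = inj₁ (powerSum-vanishes e g≉0 h m)
  ...   | yes all = inj₂ (λ c → F.exponent-bound (X .rot c i) (X .rot-0 c i (ℕ.≤-trans (s≤s z≤n) (ℕ.≤-reflexive (≡.sym eq))))
                      (λ g g≉0 → F.^-reduce {r = X .rot c i} {u = X .rot-≼ c i .proj₁} g≉0 (p ℕ.^ c)
                        (≡.trans (X .rot-≼ c i .proj₂) (≡.cong (p ℕ.^ c ℕ.*_) eq))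
                        (F.∈-lookup (λ y≈z h → F.trans (F.^-congˡ e (F.sym y≈z)) h) all (F.∈-units g g≉0))))

  -- The sum of a monomial over all points is a product of power sums. If none of these is known to
  -- have order m, every rotated degree is at least N k > N d, so every `V c` is positive. The m
  -- rotations then force order m on the coefficient.
  U-sum : ∀ {d h} → d ℕ.< k → U d h → Pow m (∑ (points k) h)
  U-sum d<k zeroU       = resp (sym (∑-ε (points k))) (Pow-0 m)
  U-sum d<k (addU a b)  = resp (sym (R+.∑-∙ (points k) _ _)) (add (U-sum d<k a) (U-sum d<k b))
  U-sum d<k (respU e a) = resp (∑-cong (points k) e) (U-sum d<k a)
  U-sum {d} d<k (term t) = resp (trans (*-congˡ (sym (∑-mono (expo .E)))) (*-distribˡ-∑ (points k) _ coeff))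
                             (body (search (powerSum-or-large expo)))
    where
    open UTerm t
    search : ∀ {r} {P : Fin r → Set (c ⊔ ℓ)} {Q : Fin r → Set} → (∀ i → P i ⊎ Q i) → (∃ P) ⊎ (∀ i → Q i)
    search {zero}  f = inj₂ (λ ())
    search {suc r} {P} {Q} f with f zero | search {P = λ i → P (suc i)} {Q = λ i → Q (suc i)} (λ i → f (suc i))
    ... | inj₁ p₀ | _             = inj₁ (zero , p₀)
    ... | inj₂ _  | inj₁ (i , pᵢ) = inj₁ (suc i , pᵢ)
    ... | inj₂ q₀ | inj₂ qs       = inj₂ (λ { zero → q₀ ; (suc i) → qs i })
    body : (∃ λ i → Pow m (powerSum (expo .E i))) ⊎ (∀ i c → N ℕ.≤ expo .rot c i) → Pow m (coeff * Πᶠ A (λ i → powerSum (expo .E i)))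
    body (inj₁ (i , h)) = Pow-scale coeff (Pow-Π i h)
    body (inj₂ large)   = resp (*-comm _ _) (Pow-scale _ (Pow-≤ (ℕ.≤-trans (∑<-≥ m V>0) V-sum) order))
      where
      V>0 : ∀ c → 0 ℕ.< V c
      V>0 c with V c in eq
      ... | suc _ = s≤s z≤n
      ... | zero  = ⊥-elim (ℕ.<⇒≱ (ℕ.*-monoʳ-< N {{ℕ.>-nonZero F.N>0}} d<k)
                      (ℕ.≤-trans (ℕ.≤-reflexive (ℕ.*-comm N k))
                        (ℕ.≤-trans (sumℕ-≥ N (expo .rot c) (λ i → large i c)) (degree c eq))))

  lift : Poly F k → Fun.Carrier
  lift f x = ∑ f (λ (a , e) → [ a ] * mono e x)

  -- The start of the bookkeeping: weight 1 and exponent 1. Reducing p^c alone, not its products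
  -- with the exponents, keeps the rotated degree within d times the rotated power; the cost
  -- inequality is an equality here.
  lift-T : ∀ {d} f → DegreeAtMost F f d → T d 1 1 (lift f)
  lift-T []            []       = zeroT
  lift-T {d} ((a , e) ∷ f) (b ∷ bs) = addT (term (record
    { coeff = [ a ] ; v = 0 ; order = base
    ; expo = record
      { E     = e
      ; rot   = λ c i → rotPow c ℕ.* e i
      ; rot-≼ = λ c i → ≼-* (e i) (rotPow-≼ c)
      ; rot-0 = λ c i 0<e → ℕ.*-mono-≤ (rotPow-pos c) 0<e }
    ; B = rotPow ; B-per = rotPow-period ; B-pos = rotPow-pos
    ; B-≼ = λ c → ≼-substʳ (≡.sym (ℕ.*-identityʳ (p ℕ.^ c))) (rotPow-≼ c)
    ; degree = λ c → ℕ.≤-trans (ℕ.≤-reflexive (≡.trans (sumℕ-* (rotPow c) e) (ℕ.*-comm (rotPow c) _))) (ℕ.*-monoˡ-≤ (rotPow c) b)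
    ; cost = ℕ.≤-reflexive (≡.trans rotPow-sum (≡.sym (≡.trans (≡.cong (ℕ._+ (θ ℕ.+ 0)) (ℕ.*-zeroʳ N)) (ℕ.+-identityʳ θ)))) }))
    (lift-T f bs)

  ε-lift : ∀ f x → ε (lift f x) F.≈ eval F f x
  ε-lift []            x = ε-0
  ε-lift ((a , e) ∷ f) x = F.trans (ε-+ _ _) (F.+-cong (F.trans (ε-* _ _) (F.*-cong (ε-[] a) (ε-mono e x))) (ε-lift f x))
    where
    ε-mono : ∀ {k} (e : Fin k → ℕ) x → ε (mono e x) F.≈ evalMono F e x
    ε-mono {zero}  e x = ε-1
    ε-mono {suc k} e x = F.trans (ε-* _ _) (F.*-cong
      (F.trans (ε-^ _ (e zero)) (F.trans (F.^-congˡ (e zero) (ε-[] (x zero))) (F.reflexive (^≡power (x zero) (e zero)))))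
      (ε-mono (λ i → e (suc i)) (λ i → x (suc i))))
      where
      ^≡power : ∀ y j → y F.^ j ≡ power F y j
      ^≡power y zero    = ≡.refl
      ^≡power y (suc j) = ≡.cong (y F.*_) (^≡power y j)

  private
    m≤M : m ℕ.≤ M
    m≤M = ℕ.≤-trans (ℕ.<⇒≤ (n<m^n (s≤s 0<n) m))
      (ℕ.≤-trans (ℕ.m≤n*m (p ℕ.^ m) N {{ℕ.>-nonZero F.N>0}}) (ℕ.≤-reflexive (≡.sym M≡N*p^m)))

    Pow-Π-1 : ∀ {r} (t : Fin r → Carrier) → (∀ l → Pow m (1# - t l)) → Pow m (1# - Πᶠ A t)
    Pow-Π-1 {zero}  t h = resp (sym (-‿inverseʳ 1#)) (Pow-0 m)
    Pow-Π-1 {suc r} t h = resp (telescope (t zero) (Πᶠ A (λ i → t (suc i)))) (add (h zero) (Pow-scale (t zero) (Pow-Π-1 (λ l → t (suc l)) (λ l → h (suc l)))))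
      where
      telescope : ∀ a b → (1# - a) + a * (1# - b) ≈ 1# - a * b
      telescope a b = begin
        (1# - a) + a * (1# - b)          ≈⟨ +-congˡ (trans (distribˡ _ _ _) (+-cong (*-identityʳ a) (sym (-‿distribʳ-* a b)))) ⟩
        (1# - a) + (a - a * b)           ≈⟨ +-assoc _ _ _ ⟩
        1# + (- a + (a - a * b))         ≈⟨ +-congˡ (sym (+-assoc _ _ _)) ⟩
        1# + ((- a + a) - a * b)         ≈⟨ +-congˡ (trans (+-congʳ (-‿inverseˡ a)) (+-identityˡ _)) ⟩
        1# - a * b                       ∎

  detector : Poly F k → Fun.Carrier
  detector f x = 1# - lift f x ^ M

  detector-zero : ∀ f x → eval F f x F.≈ F.0# → Pow m (1# - detector f x)
  detector-zero f x e = resp (sym 1-[1-a]≈a) (Pow-≤ m≤M (Pow-^ M (F.trans (ε-lift f x) e)))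
    where
    1-[1-a]≈a : 1# - detector f x ≈ lift f x ^ M
    1-[1-a]≈a = trans (+-congˡ (trans (sym (-‿+-comm _ _)) (+-congˡ (-‿involutive _))))
      (trans (sym (+-assoc _ _ _)) (trans (+-congʳ (-‿inverseʳ 1#)) (+-identityˡ _)))

  detector-nonzero : ∀ f x → ¬ (eval F f x F.≈ F.0#) → Pow m (detector f x)
  detector-nonzero f x f≉0 = resp -[a-1]≈1-a (Pow-neg (Pow-pred (unit-power m ε≈1)))
    where
    ε≈1 : ε (lift f x ^ N) F.≈ F.1#
    ε≈1 = F.trans (ε-^ _ N) (F.fermat (λ e → f≉0 (F.trans (F.sym (ε-lift f x)) e)))
    -[a-1]≈1-a : - ((lift f x ^ N) ^ (p ℕ.^ m) - 1#) ≈ detector f x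
    -[a-1]≈1-a = trans (sym (-‿+-comm _ _)) (trans (+-comm _ _) (+-cong (-‿involutive 1#)
      (-‿cong (trans (^-assocʳ _ N (p ℕ.^ m)) (^-congʳ _ (≡.sym M≡N*p^m))))))

  detector-U : ∀ {d} f → DegreeAtMost F f d → U d (detector f)
  detector-U f b = addU (U-const 1#) (respU (λ x → trans (sym (-‿distribˡ-* 1# _)) (-‿cong (trans (*-identityˡ _) (pointwise M x))))
    (U-scale (- 1#) (T⇒U (≡.subst (N ℕ.∣_) (≡.sym M≡N*p^m) (ℕ.m∣m*n (p ℕ.^ m))) (T-^M (lift-T f b)))))
    where
    pointwise : ∀ j x → (lift f Fun.^ j) x ≈ lift f x ^ j
    pointwise zero    x = refl
    pointwise (suc j) x = *-congˡ (pointwise j x)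

  -- The product of the detectors agrees with the indicator of the common zeros modulo Iᵐ, and its
  -- sum over all points has order m because its degree is below the number of variables. So the
  -- number of zeros is an integer of order m.
  ax : ∀ {r} (f : Fin r → Poly F k) (ds : Fin r → ℕ) → (∀ j → DegreeAtMost F (f j) (ds j)) →
       sumℕ ds ℕ.< k → p ℕ.^ m ℕ.∣ count (points k) (λ x j → eval F (f j) x)
  ax f ds b d<k = Pow-integer m _ (resp total (add
      (Pow-∑ (points k) difference)
      (U-sum d<k (U-Π ds (λ l → detector (f l)) (λ l → detector-U (f l) (b l))))))
    where
    X : Point F k → ℕ
    X x = χ (vanishes? (λ j → eval F (f j) x))
    G : Fun.Carrier
    G x = Πᶠ A (λ l → detector (f l) x)
    differenceχ : ∀ x (z? : Dec (∀ j → eval F (f j) x F.≈ F.0#)) → Pow m (χ z? · 1# - G x)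
    differenceχ x (yes z) = resp (+-congʳ (sym (+-identityʳ 1#))) (Pow-Π-1 _ (λ l → detector-zero (f l) x (z l)))
    differenceχ x (no ¬z) with j , nz ← Fin.¬∀⟶∃¬ _ _ (λ j → eval F (f j) x F.≟ F.0#) ¬z =
      resp (sym (+-identityˡ _)) (Pow-neg (Pow-Π j (detector-nonzero (f j) x nz)))
    difference : ∀ x → Pow m (X x · 1# - G x)
    difference x = differenceχ x (vanishes? (λ j → eval F (f j) x))
    ∑X : ∀ (xs : List (Point F k)) → ∑ xs (λ x → X x · 1#) ≈ ListSum.∑ ℕ.+-0-commutativeMonoid xs X · 1#
    ∑X []       = refl
    ∑X (x ∷ xs) = trans (+-congˡ (∑X xs)) (sym (×-homo-+ 1# (X x) _))
    total : ∑ (points k) (λ x → X x · 1# - G x) + ∑ (points k) G ≈ count (points k) (λ x j → eval F (f j) x) · 1#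
    total = begin
      ∑ (points k) (λ x → X x · 1# - G x) + ∑ (points k) G   ≈⟨ R+.∑-∙ (points k) _ _ ⟨
      ∑ (points k) (λ x → (X x · 1# - G x) + G x)            ≈⟨ ∑-cong (points k) (λ x → trans (+-comm _ _) (a+[x-a]≈x (G x) _)) ⟩
      ∑ (points k) (λ x → X x · 1#)                          ≈⟨ ∑X (points k) ⟩
      count (points k) (λ x j → eval F (f j) x) · 1#         ∎

-- Polynomial functions and homogenisation along a flat

module PolynomialFunctions {c ℓ : Level} (F : CommutativeRing c ℓ) where
  open RingFacts F hiding (_^_)
  open import Algebra.Properties.CommutativeSemigroup *-commutativeSemigroup using () renaming (interchange to *-interchange)
  open import Relation.Binary.Reasoning.Setoid setoid

  infixr 8 _^_
  _^_ : Carrier → ℕ → Carrier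
  _^_ = power F

  ^-cong : ∀ j {x y} → x ≈ y → x ^ j ≈ y ^ j
  ^-cong zero    e = refl
  ^-cong (suc j) e = *-cong e (^-cong j e)

  ^-+ : ∀ x i j → x ^ (i ℕ.+ j) ≈ x ^ i * x ^ j
  ^-+ x zero    j = sym (*-identityˡ _)
  ^-+ x (suc i) j = trans (*-congˡ (^-+ x i j)) (sym (*-assoc _ _ _))

  ^-distrib : ∀ x y j → (x * y) ^ j ≈ x ^ j * y ^ j
  ^-distrib x y zero    = sym (*-identityˡ 1#)
  ^-distrib x y (suc j) = trans (*-congˡ (^-distrib x y j)) (*-interchange _ _ _ _)

  Π-cong : ∀ {k} {s t : Fin k → Carrier} → (∀ i → s i ≈ t i) → Πᶠ F s ≈ Πᶠ F t
  Π-cong {zero}  e = refl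
  Π-cong {suc k} e = *-cong (e zero) (Π-cong (λ i → e (suc i)))

  Π-* : ∀ {k} (s t : Fin k → Carrier) → Πᶠ F (λ i → s i * t i) ≈ Πᶠ F s * Πᶠ F t
  Π-* {zero}  s t = sym (*-identityˡ 1#)
  Π-* {suc k} s t = trans (*-congˡ (Π-* (λ i → s (suc i)) (λ i → t (suc i)))) (*-interchange _ _ _ _)

  Π-^ : ∀ {k} x (e : Fin k → ℕ) → Πᶠ F (λ i → x ^ e i) ≈ x ^ sumℕ e
  Π-^ {zero}  x e = refl
  Π-^ {suc k} x e = trans (*-congˡ (Π-^ x (λ i → e (suc i)))) (sym (^-+ x (e zero) _))

  Σ-cong : ∀ {k} {s t : Fin k → Carrier} → (∀ i → s i ≈ t i) → Σᶠ F s ≈ Σᶠ F t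
  Σ-cong {zero}  e = refl
  Σ-cong {suc k} e = +-cong (e zero) (Σ-cong (λ i → e (suc i)))

  Σ-scale : ∀ {k} x (t : Fin k → Carrier) → Σᶠ F (λ i → x * t i) ≈ x * Σᶠ F t
  Σ-scale {zero}  x t = sym (zeroʳ x)
  Σ-scale {suc k} x t = trans (+-congˡ (Σ-scale x (λ i → t (suc i)))) (sym (distribˡ _ _ _))

  Σ-+ : ∀ {k} (s t : Fin k → Carrier) → Σᶠ F (λ i → s i + t i) ≈ Σᶠ F s + Σᶠ F t
  Σ-+ {zero}  s t = sym (+-identityˡ 0#)
  Σ-+ {suc k} s t = trans (+-congˡ (Σ-+ (λ i → s (suc i)) (λ i → t (suc i)))) (interchange _ _ _ _)

  eval-cong : ∀ {k} (f : Poly F k) {x y} → _≈ᵥ_ F x y → eval F f x ≈ eval F f y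
  eval-cong []            e = refl
  eval-cong ((a , E) ∷ f) e = +-cong (*-congˡ (Π-cong (λ i → ^-cong (E i) (e i)))) (eval-cong f e)

  -- The homogenisation is easiest to define as a function. This predicate supplies a formal
  -- polynomial with a degree bound, which the divisibility theorem requires.
  IsPoly : ∀ {k} → ℕ → (Point F k → Carrier) → Set (c ⊔ ℓ)
  IsPoly {k} d g = ∃ λ (f : Poly F k) → DegreeAtMost F f d × (∀ x → eval F f x ≈ g x)

  module _ {k : ℕ} where
    private
      evalMono-0 : ∀ {k} (x : Point F k) → evalMono F (λ _ → 0) x ≈ 1#
      evalMono-0 {zero}  x = refl
      evalMono-0 {suc k} x = trans (*-identityˡ _) (evalMono-0 (λ i → x (suc i)))

      evalMono-+ : ∀ (E E′ : Fin k → ℕ) x → evalMono F (λ i → E i ℕ.+ E′ i) x ≈ evalMono F E x * evalMono F E′ x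
      evalMono-+ E E′ x = trans (Π-cong (λ i → ^-+ (x i) (E i) (E′ i))) (Π-* {k} _ _)

      e₁ : ∀ {k} → Fin k → Fin k → ℕ
      e₁ zero    zero    = 1
      e₁ zero    (suc j) = 0
      e₁ (suc i) zero    = 0
      e₁ (suc i) (suc j) = e₁ i j

      sumℕ-0 : ∀ k → sumℕ {k} (λ _ → 0) ≡ 0
      sumℕ-0 zero    = ≡.refl
      sumℕ-0 (suc k) = sumℕ-0 k

      sumℕ-e₁ : ∀ {k} (i : Fin k) → sumℕ (e₁ i) ≡ 1
      sumℕ-e₁ {suc k} zero    = ≡.cong suc (sumℕ-0 k)
      sumℕ-e₁ {suc k} (suc i) = sumℕ-e₁ i

      evalMono-e₁ : ∀ {k} (i : Fin k) (x : Point F k) → evalMono F (e₁ i) x ≈ x i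
      evalMono-e₁ zero    x = trans (*-cong (*-identityʳ _) (evalMono-0 (λ i → x (suc i)))) (*-identityʳ _)
      evalMono-e₁ (suc i) x = trans (*-identityˡ _) (evalMono-e₁ i (λ i → x (suc i)))

      eval-++ : ∀ (f g : Poly F k) x → eval F (f ++ g) x ≈ eval F f x + eval F g x
      eval-++ []      g x = sym (+-identityˡ _)
      eval-++ (t ∷ f) g x = trans (+-congˡ (eval-++ f g x)) (sym (+-assoc _ _ _))

      termMul : Carrier × Monomial F k → Poly F k → Poly F k
      termMul (a , E) = map (λ (b , E′) → a * b , λ i → E i ℕ.+ E′ i)

      eval-termMul : ∀ a E (g : Poly F k) x → eval F (termMul (a , E) g) x ≈ (a * evalMono F E x) * eval F g x
      eval-termMul a E []             x = sym (zeroʳ _)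
      eval-termMul a E ((b , E′) ∷ g) x = trans
        (+-cong (trans (*-congˡ (evalMono-+ E E′ x)) (*-interchange _ _ _ _)) (eval-termMul a E g x)) (sym (distribˡ _ _ _))

      mul : Poly F k → Poly F k → Poly F k
      mul f g = concatMap (λ t → termMul t g) f

      eval-mul : ∀ (f g : Poly F k) x → eval F (mul f g) x ≈ eval F f x * eval F g x
      eval-mul []            g x = sym (zeroˡ _)
      eval-mul ((a , E) ∷ f) g x = trans (eval-++ (termMul (a , E) g) (mul f g) x)
        (trans (+-cong (eval-termMul a E g x) (eval-mul f g x)) (sym (distribʳ _ _ _)))

      degree-mul : ∀ {d e} (f g : Poly F k) → DegreeAtMost F f d → DegreeAtMost F g e → DegreeAtMost F (mul f g) (d ℕ.+ e)
      degree-mul []            g []       bg = []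
      degree-mul ((a , E) ∷ f) g (b ∷ bf) bg = All.++⁺
        (All.map⁺ (All.map (λ {t} b′ → ℕ.≤-trans (ℕ.≤-reflexive (sumℕ-+ E (proj₂ t))) (ℕ.+-mono-≤ b b′)) bg))
        (degree-mul f g bf bg)

    poly-≤ : ∀ {d e} {g : Point F k → Carrier} → d ℕ.≤ e → IsPoly d g → IsPoly e g
    poly-≤ d≤e (f , b , ef) = f , All.map (λ b → ℕ.≤-trans b d≤e) b , ef

    poly-0 : ∀ {d} → IsPoly {k} d (λ _ → 0#)
    poly-0 = [] , [] , λ x → refl

    poly-const : ∀ a → IsPoly {k} 0 (λ _ → a)
    poly-const a = (a , λ _ → 0) ∷ [] , ℕ.≤-reflexive (sumℕ-0 k) ∷ [] ,
      λ x → trans (+-identityʳ _) (trans (*-congˡ (evalMono-0 x)) (*-identityʳ a))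

    poly-coord : ∀ i → IsPoly {k} 1 (λ x → x i)
    poly-coord i = (1# , e₁ i) ∷ [] , ℕ.≤-reflexive (sumℕ-e₁ i) ∷ [] ,
      λ x → trans (+-identityʳ _) (trans (*-identityˡ _) (evalMono-e₁ i x))

    poly-+ : ∀ {d} {g h : Point F k → Carrier} → IsPoly d g → IsPoly d h → IsPoly d (λ x → g x + h x)
    poly-+ (f , b , e) (f′ , b′ , e′) = f ++ f′ , All.++⁺ b b′ , λ x → trans (eval-++ f f′ x) (+-cong (e x) (e′ x))

    poly-* : ∀ {d d′} {g h : Point F k → Carrier} → IsPoly d g → IsPoly d′ h → IsPoly (d ℕ.+ d′) (λ x → g x * h x)
    poly-* (f , b , e) (f′ , b′ , e′) = mul f f′ , degree-mul f f′ b b′ , λ x → trans (eval-mul f f′ x) (*-cong (e x) (e′ x))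

    poly-^ : ∀ {g : Point F k → Carrier} j → IsPoly 1 g → IsPoly j (λ x → g x ^ j)
    poly-^ zero    h = poly-const 1#
    poly-^ (suc j) h = poly-* h (poly-^ j h)

    poly-Σ : ∀ {d r} {g : Fin r → Point F k → Carrier} → (∀ i → IsPoly d (g i)) → IsPoly d (λ x → Σᶠ F (λ i → g i x))
    poly-Σ {r = zero}  h = poly-0
    poly-Σ {r = suc r} h = poly-+ (h zero) (poly-Σ (λ i → h (suc i)))

    poly-Π : ∀ {r} {ds : Fin r → ℕ} {g : Fin r → Point F k → Carrier} → (∀ i → IsPoly (ds i) (g i)) →
             IsPoly (sumℕ ds) (λ x → Πᶠ F (λ i → g i x))
    poly-Π {zero}  h = poly-const 1#
    poly-Π {suc r} h = poly-* (h zero) (poly-Π (λ i → h (suc i)))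

  module Flat {k n : ℕ} (V : Fin k → Point F n) where

    infixl 6 _⊞_
    _⊞_ : Point F n → Point F k → Point F n
    (b ⊞ t) i = b i + Σᶠ F (λ j → t j * V j i)

    ⊞-cong : ∀ b {t t′} → _≈ᵥ_ F t t′ → _≈ᵥ_ F (b ⊞ t) (b ⊞ t′)
    ⊞-cong b e i = +-congˡ (Σ-cong (λ j → *-congʳ (e j)))

    module _ (b : Point F n) where
      line : Point F (suc k) → Point F n
      line y = (λ i → y zero * b i) ⊞ (λ j → y (suc j))

      line-poly : ∀ i → IsPoly 1 (λ y → line y i)
      line-poly i = poly-+ (poly-* (poly-coord zero) (poly-const (b i)))
                           (poly-Σ (λ j → poly-* (poly-coord (suc j)) (poly-const (V j i))))

      -- Homogenisation of t ↦ f (b ⊞ t): for y = (s , t) it equals s ^ d * f (b ⊞ t / s).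
      hom : Poly F n → ℕ → Point F (suc k) → Carrier
      hom []            d y = 0#
      hom ((a , E) ∷ f) d y = (a * y zero ^ (d ℕ.∸ sumℕ E)) * Πᶠ F (λ i → line y i ^ E i) + hom f d y

      hom-poly : ∀ {d} f → DegreeAtMost F f d → IsPoly d (hom f d)
      hom-poly []            []       = poly-0
      hom-poly ((a , E) ∷ f) (E≤d ∷ bs) = poly-+
        (poly-≤ (ℕ.≤-reflexive (ℕ.m∸n+n≡m E≤d))
          (poly-* (poly-* (poly-const a) (poly-^ _ (poly-coord zero))) (poly-Π (λ i → poly-^ (E i) (line-poly i)))))
        (hom-poly f bs)

      -- Writing the remaining coordinates as s t avoids division by s. Each linear form then yields
      -- one factor s, and the extra power of s brings every term up to s^d.
      hom-unit : ∀ {d} f → DegreeAtMost F f d → ∀ y t → (∀ j → y (suc j) ≈ y zero * t j) →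
                 hom f d y ≈ y zero ^ d * eval F f (b ⊞ t)
      hom-unit []            []         y t e = sym (zeroʳ _)
      hom-unit {d} ((a , E) ∷ f) (E≤d ∷ bs) y t e = trans (+-cong (begin
        (a * s ^ (d ℕ.∸ sumℕ E)) * Πᶠ F (λ i → line y i ^ E i)
          ≈⟨ *-congˡ (trans (Π-cong (λ i → trans (^-cong (E i) (line≈ i)) (^-distrib s _ (E i)))) (trans (Π-* {n} _ _) (*-congʳ (Π-^ s E)))) ⟩
        (a * s ^ (d ℕ.∸ sumℕ E)) * (s ^ sumℕ E * evalMono F E (b ⊞ t))
          ≈⟨ regroup a _ _ _ ⟩
        (s ^ (d ℕ.∸ sumℕ E) * s ^ sumℕ E) * (a * evalMono F E (b ⊞ t))
          ≈⟨ *-congʳ (trans (sym (^-+ s (d ℕ.∸ sumℕ E) (sumℕ E))) (reflexive (≡.cong (s ^_) (ℕ.m∸n+n≡m E≤d)))) ⟩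
        s ^ d * (a * evalMono F E (b ⊞ t)) ∎) (hom-unit f bs y t e)) (sym (distribˡ _ _ _))
        where
        s = y zero
        regroup : ∀ a x y z → (a * x) * (y * z) ≈ (x * y) * (a * z)
        regroup a x y z = trans (*-congʳ (*-comm a x)) (*-interchange x a y z)
        line≈ : ∀ i → line y i ≈ s * (b ⊞ t) i
        line≈ i = trans (+-congˡ (trans (Σ-cong (λ j → trans (*-congʳ (e j)) (*-assoc _ _ _))) (Σ-scale {k} s _))) (sym (distribˡ _ _ _))

    -- The base point enters `line` only through its product with s.
    hom-infinity : ∀ b b′ f d y → y zero ≈ 0# → hom b f d y ≈ hom b′ f d y
    hom-infinity b b′ []            d y e = refl
    hom-infinity b b′ ((a , E) ∷ f) d y e = +-cong
      (*-congˡ (Π-cong (λ i → ^-cong (E i) (+-congʳ (trans (*-congʳ e) (trans (zeroˡ _) (sym (trans (*-congʳ e) (zeroˡ _)))))))))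
      (hom-infinity b b′ f d y e)

-- Zeros on a flat and at infinity

module ZeroCounts {c ℓ : Level} (F : CommutativeRing c ℓ) (isField : IsField F) (fin : IsFinite F) where
  open FieldFacts F isField fin hiding (_^_; ∑; ∑-cong; ∑-congAll)
  open PointSums F isField fin
  open PolynomialFunctions F
  open ListSum ℕ.+-0-commutativeMonoid using (∑; ∑-cong; ∑-congAll)

  ax-q : ∀ {k r} (f : Fin r → Poly F k) (ds : Fin r → ℕ) → (∀ j → DegreeAtMost F (f j) (ds j)) →
         sumℕ ds ℕ.< k → q ℕ.∣ count (points k) (λ x j → eval F (f j) x)
  ax-q {k} {r} f ds b d<k with characteristic
  ... | suc n , pr , p·1≈0 with prime-power pr p·1≈0
  ...   | zero  , q≡1   = ⊥-elim (ℕ.<-irrefl (≡.sym (ℕ.suc-injective (≡.trans (≡.sym q≡1+N) q≡1))) N>0)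
  ...   | suc m , q≡p^m = ≡.subst (ℕ._∣ count (points k) (λ x j → eval F (f j) x)) (≡.sym q≡p^m)
    (Weighted.ax F isField fin pr p·1≈0 (MonoidRing.lifting F isField fin pr) (suc m) q≡p^m k f ds b d<k)

  pointSetoid : ℕ → Setoid c ℓ
  pointSetoid k = record
    { Carrier = Point F k ; _≈_ = _≈ᵥ_ F
    ; isEquivalence = record { refl = λ i → refl ; sym = λ e i → sym (e i) ; trans = λ e e′ i → trans (e i) (e′ i) } }

  private module P (k : ℕ) = DistinctLists (pointSetoid k)

  points-complete : ∀ {k} (x : Point F k) → P._∈_ k x (points k)
  points-complete {zero}  x = here (λ ())
  points-complete {suc k} x = Any.concatMap⁺ (λ a → map (a ∷ₚ_) (points k)) (Any.map
    (λ x₀≈a → Any.map⁺ (Any.map (λ e → λ { zero → x₀≈a ; (suc i) → e i }) (points-complete (λ i → x (suc i))))) (complete (x zero)))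

  points-distinct : ∀ k → P.Distinct k (points k)
  points-distinct zero    = [] ∷ []
  points-distinct (suc k) = AllPairs.concat⁺
    (All.map⁺ (All.universal (λ a → AllPairs.map⁺ (AllPairs.map (λ n e → n (λ i → e (suc i))) (points-distinct k))) elems))
    (AllPairs.map⁺ (AllPairs.map (λ a≉b → All.map⁺ (All.universal (λ x → All.map⁺ (All.universal (λ y e → a≉b (e zero)) (points k))) (points k))) distinct))

  count-cong : ∀ {a r r′} {X : Set a} (xs : List X) {g : X → Fin r → Carrier} {h : X → Fin r′ → Carrier} →
    (∀ x → (∀ j → g x j ≈ 0#) → ∀ j → h x j ≈ 0#) → (∀ x → (∀ j → h x j ≈ 0#) → ∀ j → g x j ≈ 0#) →
    count xs g ≡ count xs h
  count-cong xs {g} {h} to from = ∑-cong xs (λ x → χ-cong (vanishes? (g x)) (vanishes? (h x)) (to x) (from x))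

  ∑-points-scale : ∀ k {s} → ¬ (s ≈ 0#) → ∀ (h : Point F k → ℕ) → (∀ {x y} → _≈ᵥ_ F x y → h x ≡ h y) →
                   ∑ (points k) (λ x → h (λ i → s * x i)) ≡ ∑ (points k) h
  ∑-points-scale zero    s≉0 h hc = ≡.cong (ℕ._+ 0) (hc (λ ()))
  ∑-points-scale (suc k) {s} s≉0 h hc = begin
    ∑ (points (suc k)) (λ x → h (λ i → s * x i))
      ≡⟨ ∑-points-suc ℕ.+-0-commutativeMonoid k _ ⟩
    ∑ elems (λ a → ∑ (points k) (λ x → h (λ i → s * (a ∷ₚ x) i)))
      ≡⟨ ∑-cong elems (λ a → ∑-cong (points k) (λ x → hc (λ { zero → refl ; (suc i) → refl }))) ⟩
    ∑ elems (λ a → ∑ (points k) (λ x → h (s * a ∷ₚ λ i → s * x i)))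
      ≡⟨ ∑-cong elems (λ a → ∑-points-scale k s≉0 (λ x → h (s * a ∷ₚ x)) (λ e → hc (λ { zero → refl ; (suc i) → e i }))) ⟩
    ∑ elems (λ a → ∑ (points k) (λ x → h (s * a ∷ₚ x)))
      ≡⟨ ∑-scale ℕ.+-0-commutativeMonoid s≉0 (λ a → ∑ (points k) (λ x → h (a ∷ₚ x)))
           (λ e → ∑-cong (points k) (λ x → hc (λ { zero → e ; (suc i) → refl }))) ⟩
    ∑ elems (λ a → ∑ (points k) (λ x → h (a ∷ₚ x)))
      ≡⟨ ∑-points-suc ℕ.+-0-commutativeMonoid k h ⟨
    ∑ (points (suc k)) h ∎
    where open ≡.≡-Reasoning

  module _ {k n r : ℕ} (V : Fin k → Point F n) (f : Fin r → Poly F n) (ds : Fin r → ℕ)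
           (deg : ∀ j → DegreeAtMost F (f j) (ds j)) where
    open Flat V

    zerosOn : Point F n → ℕ
    zerosOn b = count (points k) (λ t j → eval F (f j) (b ⊞ t))

    zerosAtInfinity : Point F n → ℕ
    zerosAtInfinity b = count (points k) (λ t j → hom b (f j) (ds j) (0# ∷ₚ t))

    zerosAtInfinity-const : ∀ b b′ → zerosAtInfinity b ≡ zerosAtInfinity b′
    zerosAtInfinity-const b b′ = count-cong (points k)
      (λ t z j → trans (hom-infinity b′ b (f j) (ds j) (0# ∷ₚ t) refl) (z j))
      (λ t z j → trans (hom-infinity b b′ (f j) (ds j) (0# ∷ₚ t) refl) (z j))

    private
      ^-nonzero : ∀ {s} j → ¬ (s ≈ 0#) → ¬ (s ^ j ≈ 0#)
      ^-nonzero zero    s≉0 = 0≉1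
      ^-nonzero (suc j) s≉0 = *-nonzero s≉0 (^-nonzero j s≉0)

    -- The zeros of the homogenised system in k + 1 variables are sorted by the value of s. For a
    -- unit s the substitution of s t for t permutes the slice, and s^d can be cancelled, so the
    -- slice counts the zeros on the flat.
    zeros-congruence : sumℕ ds ≤ k → ∀ b → q ℕ.∣ zerosAtInfinity b ℕ.+ N ℕ.* zerosOn b
    zeros-congruence d≤k b = ≡.subst (q ℕ.∣_) total (ax-q g ds (λ j → proj₁ (proj₂ (poly j))) (s≤s d≤k))
      where
      poly = λ j → hom-poly b (f j) (deg j)
      g = λ j → proj₁ (poly j)
      g≈ : ∀ j y → eval F (g j) y ≈ hom b (f j) (ds j) y
      g≈ j = proj₂ (proj₂ (poly j))
      slice : Carrier → ℕ
      slice s = count (points k) (λ t j → eval F (g j) (s ∷ₚ t))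
      χ-eval : ∀ {x y} → _≈ᵥ_ F x y → χ (vanishes? (λ j → eval F (g j) x)) ≡ χ (vanishes? (λ j → eval F (g j) y))
      χ-eval e = χ-cong (vanishes? _) (vanishes? _)
        (λ z j → trans (sym (eval-cong (g j) e)) (z j)) (λ z j → trans (eval-cong (g j) e) (z j))
      slice-unit : ∀ s → ¬ (s ≈ 0#) → slice s ≡ zerosOn b
      slice-unit s s≉0 = ≡.trans
        (≡.sym (∑-points-scale k s≉0 (λ t → χ (vanishes? (λ j → eval F (g j) (s ∷ₚ t)))) (λ {t} {t′} e → χ-eval {s ∷ₚ t} {s ∷ₚ t′} (λ { zero → refl ; (suc i) → e i }))))
        (count-cong (points k)
          (λ t z j → cancel-nonzero (^-nonzero (ds j) s≉0) (trans (sym (scaled t j)) (trans (z j) (sym (zeroʳ _)))))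
          (λ t z j → trans (scaled t j) (trans (*-congˡ (z j)) (zeroʳ _))))
        where
        scaled : ∀ t j → eval F (g j) (s ∷ₚ λ i → s * t i) ≈ s ^ ds j * eval F (f j) (b ⊞ t)
        scaled t j = trans (g≈ j _) (hom-unit b (f j) (deg j) (s ∷ₚ λ i → s * t i) t (λ i → refl))
      slice-zero : slice 0# ≡ zerosAtInfinity b
      slice-zero = count-cong (points k) (λ t z j → trans (sym (g≈ j _)) (z j)) (λ t z j → trans (g≈ j _) (z j))
      ∑-constant : ∀ (xs : List Carrier) a → ∑ xs (λ _ → a) ≡ length xs ℕ.* a
      ∑-constant []       a = ≡.refl
      ∑-constant (x ∷ xs) a = ≡.cong (a ℕ.+_) (∑-constant xs a)
      total : count (points (suc k)) (λ y j → eval F (g j) y) ≡ zerosAtInfinity b ℕ.+ N ℕ.* zerosOn b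
      total = ≡.trans (∑-points-suc ℕ.+-0-commutativeMonoid k _) (≡.trans
        (∑-split-zero ℕ.+-0-commutativeMonoid slice (λ {s} {s′} e → ∑-cong (points k) (λ t → χ-eval {s ∷ₚ t} {s′ ∷ₚ t} (λ { zero → e ; (suc i) → refl }))))
        (≡.cong₂ ℕ._+_ slice-zero (≡.trans (∑-congAll units-nonzero slice-unit) (∑-constant units (zerosOn b)))))

    module _ (indep : ∀ (t : Fin k → Carrier) → (∀ i → Σᶠ F (λ j → t j * V j i) ≈ 0#) → ∀ j → t j ≈ 0#) where

      ⊞-injective : ∀ b {t t′} → _≈ᵥ_ F (b ⊞ t) (b ⊞ t′) → _≈ᵥ_ F t t′
      ⊞-injective b {t} {t′} e j = x-y≈0⇒x≈y _ _ (indep (λ j → t j - t′ j) vanish j)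
        where
        open import Relation.Binary.Reasoning.Setoid setoid
        vanish : ∀ i → Σᶠ F (λ j → (t j - t′ j) * V j i) ≈ 0#
        vanish i = begin
          Σᶠ F (λ j → (t j - t′ j) * V j i)                           ≈⟨ Σ-cong (λ j → trans (distribʳ _ _ _)
                                                                           (+-congˡ (trans (*-congʳ (-1* (t′ j))) (*-assoc _ _ _)))) ⟩
          Σᶠ F (λ j → t j * V j i + - 1# * (t′ j * V j i))            ≈⟨ trans (Σ-+ {k} _ _) (+-congˡ (Σ-scale {k} (- 1#) _)) ⟩
          Σᶠ F (λ j → t j * V j i) + - 1# * Σᶠ F (λ j → t′ j * V j i) ≈⟨ +-cong (+-cancelˡ (b i) _ _ (e i)) (sym (-1* _)) ⟩
          Σᶠ F (λ j → t′ j * V j i) - Σᶠ F (λ j → t′ j * V j i)       ≈⟨ -‿inverseʳ _ ⟩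
          0#                                                          ∎
          where
          -1* : ∀ x → - x ≈ - 1# * x
          -1* x = trans (-‿cong (sym (*-identityˡ x))) (-‿distribˡ-* 1# x)

      -- Any enumeration of the zeros has the members of the list of points b ⊞ t with t a zero, and
      -- independence of the directions makes that list repetition-free. Membership is an arbitrary
      -- predicate `P` with this description, so that the flat may be presented by other directions.
      length-zeros : ∀ b {a} {P : Point F n → Set a} →
        (∀ x → P x → (∃ λ t → _≈ᵥ_ F x (b ⊞ t)) × CommonZero F f x) →
        (∀ x → (∃ λ t → _≈ᵥ_ F x (b ⊞ t)) × CommonZero F f x → P x) →
        ∀ Z → Enumerates F P Z → length Z ≡ zerosOn b
      length-zeros b {P = P} to from Z (sound , full , Z!) = ≡.trans
        (length-unique (pointSetoid n) Z W Z! W! Z⊆W W⊆Z) (≡.trans (length-map (b ⊞_) (filter zero? (points k))) (length-filter≡∑χ zero? (points k)))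
        where
        module S = Setoid (pointSetoid n)
        zero? : ∀ t → Dec (CommonZero F f (b ⊞ t))
        zero? t = vanishes? (λ j → eval F (f j) (b ⊞ t))
        zero-resp : ∀ {x y} → _≈ᵥ_ F x y → CommonZero F f x → CommonZero F f y
        zero-resp e z j = trans (sym (eval-cong (f j) e)) (z j)
        Q : Point F n → Set (c ⊔ ℓ)
        Q x = (∃ λ t → _≈ᵥ_ F x (b ⊞ t)) × CommonZero F f x
        Q-resp : ∀ {x y} → _≈ᵥ_ F x y → Q x → Q y
        Q-resp e ((t , x≈) , z) = (t , S.trans (S.sym e) x≈) , zero-resp e z
        W = map (b ⊞_) (filter zero? (points k))
        W! = AllPairs.map⁺ (AllPairs.filter⁺ zero? (AllPairs.map (λ n e → n (⊞-injective b e)) (points-distinct k)))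
        Z⊆W : ∀ z → P._∈_ n z Z → P._∈_ n z W
        Z⊆W z z∈ with (t , z≈) , zz ← P.∈-lookup n Q-resp (All.map (to _) sound) z∈ =
          Any.map⁺ (Any.map (λ t≈ → S.trans z≈ (⊞-cong b t≈))
            (∈-filter⁺ (pointSetoid k) zero? (λ e → zero-resp (⊞-cong b e)) (points-complete t) (zero-resp z≈ zz)))
        W⊆Z : ∀ z → P._∈_ n z W → P._∈_ n z Z
        W⊆Z z z∈ = full z (from z (P.∈-lookup n Q-resp
          (All.map⁺ (All.map (λ {t} zt → (t , S.refl) , zt) (All.all-filter zero? (points k)))) z∈))

-- Comparison of two parallel flats

open import Data.Integer using (+_; _-_)
open import Data.Integer.Divisibility using (_∣_)

-- N is -1 modulo N + 1, so the hypotheses say that both counts are congruent to T.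
parallel-cancel : ∀ {N T C₁ C₂} → suc N ℕ.∣ T ℕ.+ N ℕ.* C₁ → suc N ℕ.∣ T ℕ.+ N ℕ.* C₂ → (+ suc N) ℤ.∣ (+ C₁ ℤ.- + C₂)
parallel-cancel {N} {T} {C₁} {C₂} (divides a ea) (divides b eb) = Signed.∣⇒∣ᵤ (Signed.divides (+ C₁ ℤ.- + C₂ ℤ.- (+ a ℤ.- + b))
  (≡.trans (identity (+ N) (+ T) (+ C₁) (+ C₂)) (≡.trans
    (≡.cong₂ (λ x y → (+ C₁ ℤ.- + C₂) ℤ.* ℤ.suc (+ N) ℤ.- (x ℤ.- y)) (toℤ a C₁ ea) (toℤ b C₂ eb)) (regroup (+ N) (+ C₁) (+ C₂) (+ a) (+ b)))))
  where
  toℤ : ∀ a C → T ℕ.+ N ℕ.* C ≡ a ℕ.* suc N → + T ℤ.+ + N ℤ.* + C ≡ + a ℤ.* ℤ.suc (+ N)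
  toℤ a C e = ≡.trans (≡.cong (ℤ._+_ (+ T)) (≡.sym (ℤ.pos-* N C))) (≡.trans (≡.cong +_ e) (ℤ.pos-* a (suc N)))
  identity : ∀ N T C D → C ℤ.- D ≡ (C ℤ.- D) ℤ.* (ℤ.1ℤ ℤ.+ N) ℤ.- ((T ℤ.+ N ℤ.* C) ℤ.- (T ℤ.+ N ℤ.* D))
  identity = solve-ℤ
  regroup : ∀ N C D a b → (C ℤ.- D) ℤ.* (ℤ.1ℤ ℤ.+ N) ℤ.- (a ℤ.* (ℤ.1ℤ ℤ.+ N) ℤ.- b ℤ.* (ℤ.1ℤ ℤ.+ N)) ≡ (C ℤ.- D ℤ.- (a ℤ.- b)) ℤ.* (ℤ.1ℤ ℤ.+ N)
  regroup = solve-ℤ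

theorem1 : ∀ {c ℓ : Level} (F : CommutativeRing c ℓ) → IsField F →
    (fin : IsFinite F) →
    ∀ (n r : ℕ) (f : Fin r → Poly F n) (ds : Fin r → ℕ) →
    (∀ j → DegreeAtMost F (f j) (ds j)) →
    ∀ (L₁ L₂ : AffineSubspace F n) → Parallel F L₁ L₂ →
    sumℕ ds ≤ AffineSubspace.dim L₁ → sumℕ ds ≤ AffineSubspace.dim L₂ →
    ∀ (Z₁ Z₂ : List (Point F n)) →
    CountsZerosIn F f L₁ Z₁ → CountsZerosIn F f L₂ Z₂ →
    (+ card F fin) ∣ ((+ length Z₁) - (+ length Z₂))
theorem1 F isField fin n r f ds deg L₁ L₂ (w , par) d≤k _ Z₁ Z₂ enum₁ enum₂ =
  ≡.subst₂ (λ a b → (+ q) ∣ ((+ a) - (+ b))) (≡.sym count₁) (≡.sym count₂)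
    (≡.subst (λ q → (+ q) ∣ ((+ zerosOn′ base) - (+ zerosOn′ base′))) (≡.sym q≡1+N)
      (parallel-cancel
        (≡.subst (ℕ._∣ zerosAtInfinity dir f ds deg base ℕ.+ N ℕ.* zerosOn′ base) q≡1+N (zeros-congruence dir f ds deg d≤k base))
        (≡.subst₂ (λ q T → q ℕ.∣ T ℕ.+ N ℕ.* zerosOn′ base′) q≡1+N
          (zerosAtInfinity-const dir f ds deg base′ base) (zeros-congruence dir f ds deg d≤k base′))))
  where
  open AffineSubspace L₁
  open ZeroCounts F isField fin
  open FieldFacts F isField fin hiding (_-_)
  shift⁺ : ∀ {x b w s} → x + - w ≈ b + s → x ≈ b + w + s
  shift⁺ {x} {b} {w} {s} e = trans (sym (a+[x-a]≈x w x)) (trans (+-congˡ e) (trans (sym (+-assoc w b s)) (+-congʳ (+-comm w b))))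
  shift⁻ : ∀ {x b w s} → x ≈ b + w + s → x + - w ≈ b + s
  shift⁻ {x} {b} {w} {s} e = +-cancelˡ w _ _ (trans (a+[x-a]≈x w x) (trans e (trans (+-congʳ (+-comm b w)) (+-assoc w b s))))
  -- The second flat is parametrised from this base point by the directions of the first. With the
  -- directions shared, both flats have the same zeros at infinity.
  base′ : Point F n
  base′ i = base i + w i
  zerosOn′ = zerosOn dir f ds deg
  count₁ : length Z₁ ≡ zerosOn′ base
  count₁ = length-zeros dir f ds deg indep base (λ x h → h) (λ x h → h) Z₁ enum₁
  count₂ : length Z₂ ≡ zerosOn′ base′
  count₂ = length-zeros dir f ds deg indep base′
    (λ x (x∈L₂ , z) → (proj₁ (proj₁ (par x) x∈L₂) , λ i → shift⁺ (proj₂ (proj₁ (par x) x∈L₂) i)) , z)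
    (λ x ((t , x≈) , z) → proj₂ (par x) (t , λ i → shift⁻ (x≈ i)) , z) Z₂ enum₂
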